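{- Let $H_0(x)=\sum_{n\ge0}\left|\mathcal{S}^2_n(321)\right|x^n$ be the generating function of $321$-avoiding binary shrub forests (with constant term $1$ for the empty forest). Then $H_0(x)$ is a root of the polynomial $$\begin{aligned}&(4x^2+4x+1)-(x^4-24x^3+8x^2-54x+1)H_0^2+(15x^4+24x^3-71x^2-54x)H_0^4+(18x^5-215x^4+2x^3-360x^2)H_0^6\\&+(3x^6-228x^5-213x^4+162x^3+729x^2)H_0^8-(138x^6-354x^5-1053x^4)H_0^{10}-(36x^7-751x^6-486x^5)H_0^{12}\\&-(3x^8-420x^7-54x^6)H_0^{14}+123x^8H_0^{16}+18x^9H_0^{18}+x^{10}H_0^{20}.\end{aligned}$$ Consequently, the growth rate $\lim_{n\to\infty}\left|\mathcal{S}^2_n(321)\right|^{1/n}$ of $321$-avoiding binary shrub forests equals the greatest real root of $729x^4-28674x^3-15505x^2-25758x+621$, approximately $39.88873$.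
   Context: $\mathcal{S}^2_n(321)$ denotes the set of permutations $\pi\in\mathcal{S}_{3n}$ that avoid $321$ (no indices $a<b<c$ with $\pi_a>\pi_b>\pi_c$) and satisfy $\pi_{3i+1}<\pi_{3i+2}$ and $\pi_{3i+1}<\pi_{3i+3}$ for all $0\le i<n$. -}

module Defs where

open import Data.Nat as ℕ using (ℕ; zero; suc; _∸_)
open import Data.Fin as Fin using (Fin; combine)
open import Data.Fin.Properties using (any?; all?)
import Data.Fin.Properties as FinP
open import Data.Vec using (Vec; lookup)
open import Data.List using (List; []; _∷_; foldr; map; upTo)
open import Data.Integer as ℤ using (ℤ; +_)
open import Data.Rational as ℚ using (ℚ; 0ℚ; 1ℚ)
open import Data.Product using (Σ; ∃; _×_; _,_)
open import Relation.Nullary using (¬_; Dec)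
open import Relation.Nullary.Decidable using (True; ¬?; _×-dec_; _→-dec_)
open import Relation.Binary.PropositionalEquality using (_≡_)

-- Permutations of {0,…,m-1} in one-line notation: π = (π₀,…,π_{m-1}),
-- stored as a vector of length m with entries in Fin m, that is injective
-- (hence a bijection of the finite set Fin m).

Word : ℕ → Set
Word m = Vec (Fin m) m

IsPermutation : ∀ {m} → Word m → Set
IsPermutation {m} v = ∀ (i j : Fin m) → lookup v i ≡ lookup v j → i ≡ j

Contains321 : ∀ {m} → Word m → Set
Contains321 {m} v =
  ∃ λ (a : Fin m) → ∃ λ (b : Fin m) → ∃ λ (c : Fin m) →
    (a Fin.< b) × (b Fin.< c) × (lookup v c Fin.< lookup v b) × (lookup v b Fin.< lookup v a)

Avoids321 : ∀ {m} → Word m → Set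
Avoids321 v = ¬ Contains321 v

-- position 3i+k (0-based) in a word of length n*3 is  combine i k
-- (toℕ (combine i k) = toℕ i * 3 + toℕ k).
pos : ∀ {n} → Fin n → Fin 3 → Fin (n ℕ.* 3)
pos i k = combine i k

-- shrub condition: π_{3i+1} < π_{3i+2} and π_{3i+1} < π_{3i+3} (1-based),
-- i.e. in 0-based positions  v[3i] < v[3i+1]  and  v[3i] < v[3i+2].
ShrubCondition : ∀ n → Word (n ℕ.* 3) → Set
ShrubCondition n v = ∀ (i : Fin n) →
  (lookup v (pos i Fin.zero) Fin.< lookup v (pos i (Fin.suc Fin.zero))) ×
  (lookup v (pos i Fin.zero) Fin.< lookup v (pos i (Fin.suc (Fin.suc Fin.zero))))

IsS2-321 : ∀ n → Word (n ℕ.* 3) → Set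
IsS2-321 n v = IsPermutation v × Avoids321 v × ShrubCondition n v

-- decision procedures (used only to make membership a proposition)
isPermutation? : ∀ {m} (v : Word m) → Dec (IsPermutation v)
isPermutation? v = all? λ i → all? λ j →
  (lookup v i FinP.≟ lookup v j) →-dec (i FinP.≟ j)

contains321? : ∀ {m} (v : Word m) → Dec (Contains321 v)
contains321? v = any? λ a → any? λ b → any? λ c →
  (a FinP.<? b) ×-dec (b FinP.<? c) ×-dec
  (lookup v c FinP.<? lookup v b) ×-dec (lookup v b FinP.<? lookup v a)

shrubCondition? : ∀ n (v : Word (n ℕ.* 3)) → Dec (ShrubCondition n v)
shrubCondition? n v = all? λ i →
  (lookup v (pos i Fin.zero) FinP.<? lookup v (pos i (Fin.suc Fin.zero))) ×-dec
  (lookup v (pos i Fin.zero) FinP.<? lookup v (pos i (Fin.suc (Fin.suc Fin.zero))))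

isS2-321? : ∀ n (v : Word (n ℕ.* 3)) → Dec (IsS2-321 n v)
isS2-321? n v = isPermutation? v ×-dec ¬? (contains321? v) ×-dec shrubCondition? n v

-- the set S²_n(321), as a type whose elements are such permutations
-- (membership proof is the proposition True (isS2-321? n v)).
S2-321 : ℕ → Set
S2-321 n = Σ (Word (n ℕ.* 3)) λ v → True (isS2-321? n v)

Series : Set
Series = ℕ → ℤ

_⊕_ : Series → Series → Series
(f ⊕ g) n = f n ℤ.+ g n

_⊛_ : Series → Series → Series
(f ⊛ g) n = foldr ℤ._+_ (+ 0) (map (λ i → f i ℤ.* g (n ∸ i)) (upTo (suc n)))

infixl 6 _⊕_
infixl 7 _⊛_

poly : List ℤ → Series
poly []       n       = + 0
poly (c ∷ cs) zero    = c
poly (c ∷ cs) (suc n) = poly cs n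

evalInSquare : List (List ℤ) → Series → Series
evalInSquare []       H = λ _ → + 0
evalInSquare (p ∷ ps) H = poly p ⊕ H ⊛ H ⊛ evalInSquare ps H

ogf : (ℕ → ℕ) → Series
ogf a n = + a n

private
  neg : ℕ → ℤ
  neg k = ℤ.- (+ k)

theorem18-coeffs : List (List ℤ)
theorem18-coeffs =
  (+ 1 ∷ + 4 ∷ + 4 ∷ []) ∷
  (neg 1 ∷ + 54 ∷ neg 8 ∷ + 24 ∷ neg 1 ∷ []) ∷
  (+ 0 ∷ neg 54 ∷ neg 71 ∷ + 24 ∷ + 15 ∷ []) ∷
  (+ 0 ∷ + 0 ∷ neg 360 ∷ + 2 ∷ neg 215 ∷ + 18 ∷ []) ∷
  (+ 0 ∷ + 0 ∷ + 729 ∷ + 162 ∷ neg 213 ∷ neg 228 ∷ + 3 ∷ []) ∷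
  (+ 0 ∷ + 0 ∷ + 0 ∷ + 0 ∷ + 1053 ∷ + 354 ∷ neg 138 ∷ []) ∷
  (+ 0 ∷ + 0 ∷ + 0 ∷ + 0 ∷ + 0 ∷ + 486 ∷ + 751 ∷ neg 36 ∷ []) ∷
  (+ 0 ∷ + 0 ∷ + 0 ∷ + 0 ∷ + 0 ∷ + 0 ∷ + 54 ∷ + 420 ∷ neg 3 ∷ []) ∷
  (+ 0 ∷ + 0 ∷ + 0 ∷ + 0 ∷ + 0 ∷ + 0 ∷ + 0 ∷ + 0 ∷ + 123 ∷ []) ∷
  (+ 0 ∷ + 0 ∷ + 0 ∷ + 0 ∷ + 0 ∷ + 0 ∷ + 0 ∷ + 0 ∷ + 0 ∷ + 18 ∷ []) ∷
  (+ 0 ∷ + 0 ∷ + 0 ∷ + 0 ∷ + 0 ∷ + 0 ∷ + 0 ∷ + 0 ∷ + 0 ∷ + 0 ∷ + 1 ∷ []) ∷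
  []

_^ℚ_ : ℚ → ℕ → ℚ
r ^ℚ zero  = 1ℚ
r ^ℚ suc n = r ℚ.* (r ^ℚ n)

ℕ→ℚ : ℕ → ℚ
ℕ→ℚ k = (+ k) ℚ./ 1

growthQuartic : ℚ → ℚ
growthQuartic r =
  ℕ→ℚ 729 ℚ.* (r ^ℚ 4) ℚ.- ℕ→ℚ 28674 ℚ.* (r ^ℚ 3) ℚ.- ℕ→ℚ 15505 ℚ.* (r ^ℚ 2)
  ℚ.- ℕ→ℚ 25758 ℚ.* r ℚ.+ ℕ→ℚ 621

-- Dedekind-cut description of the greatest real root ρ of growthQuartic
-- (valid for this quartic: it has exactly two simple real roots and
-- positive leading coefficient, so Q < 0 exactly between them, Q > 0 above ρ).
-- "p < ρ":
BelowGreatestRoot : ℚ → Set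
BelowGreatestRoot p = ∃ λ r → (p ℚ.≤ r) × (growthQuartic r ℚ.< 0ℚ)

AboveGreatestRoot : ℚ → Set
AboveGreatestRoot q = ∀ r → q ℚ.≤ r → 0ℚ ℚ.< growthQuartic r

-- lim_{n→∞} a_n^{1/n} = ρ, in rational terms: for all rationals
-- 0 ≤ p < ρ < q, eventually p^n < a_n < q^n.
GrowthRateIsGreatestRoot : (ℕ → ℕ) → Set
GrowthRateIsGreatestRoot a =
  ∀ (p q : ℚ) → 0ℚ ℚ.≤ p → BelowGreatestRoot p → AboveGreatestRoot q →
    ∃ λ (N : ℕ) → ∀ n → N ℕ.≤ n →
      ((p ^ℚ n) ℚ.< ℕ→ℚ (a n)) × (ℕ→ℚ (a n) ℚ.< (q ^ℚ n))

module Submission where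

-- Read from right to left, a 321-avoiding permutation is built by prepending values, and its state k
-- (the number of values below every inversion top) determines which values may come next.  Hence the
-- numbers of continuations from state k have generating functions h_k with h_k = 1 + x φ(h)_k for an
-- explicit operator φ, and H₀ = h₀.  Extended by h₋₁ = 1 and h₋₂ = 1 − x h₂, the h_k satisfy the linear
-- recurrence with characteristic polynomial (1 − z)³ + x(z³ − z⁵ + z⁶).  Over ℤ[[x]] this splits into
-- two cubics, one for the roots tending to 1 and one for the roots tending to ∞, and the h_k already
-- satisfy the recurrence of the first.  In terms of the reciprocal cubics A, B (monic in t = 1/z, with
-- coefficients aᵢ, bᵢ) the boundary conditions give x H₀ = b₁ + b₂ − a₁ − a₂, and eliminating the
-- coefficients gives the polynomial; it is even in H₀ because exchanging A and B changes the sign.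
--
-- For the growth rate, k ↦ uᵏ is superharmonic for φ with eigenvalue S(u) = u³ + 2u²v + uv³ whenever
-- 1/u + 1/v = 1, so the count is at most S(u)ⁿ; near the minimum of S a truncated bump
-- uᵏ (k − 3)(l − k) is subharmonic with an eigenvalue arbitrarily close to min S.  The quartic takes the
-- value (slope factor)² · (positive) at S(u), which identifies min S with its greatest root.

open import Defs
open import Data.Nat using (ℕ)
open import Data.Fin using (Fin)
open import Data.Integer using (ℤ; +_)
open import Data.Product using (_×_; _,_)
open import Function.Bundles using (_↔_)
open import Relation.Binary.PropositionalEquality using (_≡_)

-- The polynomial algebra rests on two kinds of certificate, both checked by evaluation over ℤ: an
-- expression is exhibited as a combination of known relations, or an inequality is read off from
-- nonnegative coefficients.
--
-- The elimination is governed by the exchange of A and B. Interpolating both cubics at 0 and 1, the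
-- roots of t³(t - 1)³, makes this symmetry visible: three quantities change sign under it, and
-- their pairwise products form a symmetric matrix of rank one. Its minors involve only invariant
-- quantities, hence the even powers of H₀.
--
-- In the growth rate the obstacle is that the minimiser of S is irrational while every statement
-- lives over ℚ. It is replaced by rational points at which the slope is small but not zero. If the
-- quartic is negative at r ≥ 39, then S - r is bounded below by a constant that does not depend on
-- how close the point is to the minimiser. This fixed room pays for the remaining slope, for the
-- curvature of the bump and for the constant factor in the lower bound.

-- Polynomial identities and ideal membership in commutative rings

module PolySolver where
  open import Algebra.Bundles using (CommutativeRing)
  import Algebra.Properties.CommutativeSemigroup as CommutativeSemigroupProperties
  import Algebra.Properties.Ring as RingProperties
  open import Data.Bool.Base using (Bool; true; false; _∧_; if_then_else_)
  open import Data.Fin.Base using (Fin; zero; suc)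
  open import Data.Integer.Base as ℤ using (ℤ; +_)
  open import Data.List.Base using (List; []; _∷_)
  open import Data.List.Relation.Unary.All using (All; []; _∷_)
  open import Data.Nat.Base using (ℕ; zero; suc)
  open import Data.Product using (_×_; _,_; proj₁; proj₂)
  open import Data.Vec.Base using (Vec; []; _∷_; lookup)
  open import Relation.Binary.PropositionalEquality as ≡ using (_≡_)
  import Relation.Binary.Reasoning.Setoid as SetoidReasoning

  infixl 6 _:+_ _:-_
  infixl 7 _:*_
  infixr 8 _:^_ :-_

  data Expr (n : ℕ) : Set where
    var       : Fin n → Expr n
    con       : ℤ → Expr n
    _:+_ _:*_ : Expr n → Expr n → Expr n
    :-_       : Expr n → Expr n

  infix 9 #_
  pattern #_ c = con (+ c)

  _:-_ : ∀ {n} → Expr n → Expr n → Expr n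
  e :- f = e :+ :- f

  -- The first power is the expression itself, so that evaluating a positive power leaves no
  -- trailing factor 1.
  _:^_ : ∀ {n} → Expr n → ℕ → Expr n
  e :^ zero        = # 1
  e :^ suc zero    = e
  e :^ suc (suc k) = e :* e :^ suc k

  combination : ∀ {n} → List (Expr n × Expr n) → Expr n
  combination []             = # 0
  combination ((c , l) ∷ cs) = c :* l :+ combination cs

  -- Dense recursive polynomials: the list holds the coefficients of the first variable.
  Pol : ℕ → Set
  Pol zero    = ℤ
  Pol (suc n) = List (Pol n)

  constant : ∀ {n} → ℤ → Pol n
  constant {zero}  c = c
  constant {suc n} c = constant c ∷ []

  variable-pol : ∀ {n} → Fin n → Pol n
  variable-pol zero    = constant (+ 0) ∷ constant (+ 1) ∷ []
  variable-pol (suc i) = variable-pol i ∷ []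

  add : ∀ {n} → Pol n → Pol n → Pol n
  add {zero}  a       b       = a ℤ.+ b
  add {suc n} []      q       = q
  add {suc n} (a ∷ p) []      = a ∷ p
  add {suc n} (a ∷ p) (b ∷ q) = add a b ∷ add p q

  negate : ∀ {n} → Pol n → Pol n
  negate {zero}  a       = ℤ.- a
  negate {suc n} []      = []
  negate {suc n} (a ∷ p) = negate a ∷ negate p

  isZeroℤ : ℤ → Bool
  isZeroℤ (+ zero) = true
  isZeroℤ _        = false

  isZero : ∀ {n} → Pol n → Bool
  isZero {zero}  a       = isZeroℤ a
  isZero {suc n} []      = true
  isZero {suc n} (a ∷ p) = isZero a ∧ isZero p

  mutual
    mul : ∀ {n} → Pol n → Pol n → Pol n
    mul {zero}  a       b = a ℤ.* b
    mul {suc n} []      q = []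
    -- Zero coefficients are frequent in a dense representation; skipping them saves a full `scale`
    -- each time.
    mul {suc n} (a ∷ p) q =
      if isZero a then constant (+ 0) ∷ mul p q else add (scale a q) (constant (+ 0) ∷ mul p q)

    scale : ∀ {n} → Pol n → Pol (suc n) → Pol (suc n)
    scale a []      = []
    scale a (b ∷ q) = mul a b ∷ scale a q

  normalise : ∀ {n} → Expr n → Pol n
  normalise (var i)  = variable-pol i
  normalise (con c)  = constant c
  normalise (e :+ f) = add (normalise e) (normalise f)
  normalise (e :* f) = mul (normalise e) (normalise f)
  normalise (:- e)   = negate (normalise e)

  record IsIntegerHomomorphism {c ℓ} (R : CommutativeRing c ℓ) (ι : ℤ → CommutativeRing.Carrier R) : Set ℓ where
    open CommutativeRing R hiding (zero)
    field
      ι-0   : ι (+ 0) ≈ 0#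
      ι-1   : ι (+ 1) ≈ 1#
      ι-+   : ∀ a b → ι (a ℤ.+ b) ≈ ι a + ι b
      ι-*   : ∀ a b → ι (a ℤ.* b) ≈ ι a * ι b
      ι-neg : ∀ a → ι (ℤ.- a) ≈ - ι a

  module Evaluation {c ℓ} (R : CommutativeRing c ℓ) (ι : ℤ → CommutativeRing.Carrier R)
    (ι-homomorphism : IsIntegerHomomorphism R ι) where
    open CommutativeRing R hiding (zero)
    open IsIntegerHomomorphism ι-homomorphism
    open RingProperties ring using (-0#≈0#; -‿+-comm; -‿distribʳ-*)
    open CommutativeSemigroupProperties +-commutativeSemigroup using (interchange)
    open CommutativeSemigroupProperties *-commutativeSemigroup using (x∙yz≈y∙xz)
    open SetoidReasoning setoid

    ⟦_⟧ : ∀ {n} → Expr n → Vec Carrier n → Carrier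
    ⟦ var i ⟧  ρ = lookup ρ i
    ⟦ con c ⟧  ρ = ι c
    ⟦ e :+ f ⟧ ρ = ⟦ e ⟧ ρ + ⟦ f ⟧ ρ
    ⟦ e :* f ⟧ ρ = ⟦ e ⟧ ρ * ⟦ f ⟧ ρ
    ⟦ :- e ⟧   ρ = - ⟦ e ⟧ ρ

    value : ∀ {n} → Pol n → Vec Carrier n → Carrier
    value {zero}  a       ρ       = ι a
    value {suc n} []      ρ       = 0#
    value {suc n} (a ∷ p) (x ∷ ρ) = value a ρ + x * value p (x ∷ ρ)

    value-constant : ∀ {n} c (ρ : Vec Carrier n) → value (constant {n} c) ρ ≈ ι c
    value-constant c []      = refl
    value-constant c (x ∷ ρ) = trans (+-cong (value-constant c ρ) (zeroʳ x)) (+-identityʳ _)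

    value-shift : ∀ {n} x (ρ : Vec Carrier n) (p : Pol (suc n)) →
      value (constant {n} (+ 0) ∷ p) (x ∷ ρ) ≈ x * value p (x ∷ ρ)
    value-shift x ρ p = trans (+-congʳ (trans (value-constant (+ 0) ρ) ι-0)) (+-identityˡ _)

    value-variable : ∀ {n} (i : Fin n) ρ → value (variable-pol i) ρ ≈ lookup ρ i
    value-variable zero (x ∷ ρ) = begin
      value (variable-pol zero) (x ∷ ρ)         ≈⟨ value-shift x ρ (constant (+ 1) ∷ []) ⟩
      x * (value (constant (+ 1)) ρ + x * 0#)   ≈⟨ *-congˡ (+-cong (value-constant (+ 1) ρ) (zeroʳ x)) ⟩
      x * (ι (+ 1) + 0#)                        ≈⟨ *-congˡ (trans (+-identityʳ _) ι-1) ⟩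
      x * 1#                                    ≈⟨ *-identityʳ x ⟩
      x                                         ∎
    value-variable (suc i) (x ∷ ρ) =
      trans (+-cong (value-variable i ρ) (zeroʳ x)) (+-identityʳ _)

    value-add : ∀ {n} (p q : Pol n) ρ → value (add p q) ρ ≈ value p ρ + value q ρ
    value-add {zero}  a       b       ρ = ι-+ a b
    value-add {suc n} []      q       ρ = sym (+-identityˡ _)
    value-add {suc n} (a ∷ p) []      ρ = sym (+-identityʳ _)
    value-add {suc n} (a ∷ p) (b ∷ q) (x ∷ ρ) = begin
      value (add a b) ρ + x * value (add p q) (x ∷ ρ)
        ≈⟨ +-cong (value-add a b ρ) (trans (*-congˡ (value-add p q (x ∷ ρ))) (distribˡ x _ _)) ⟩
      (value a ρ + value b ρ) + (x * value p (x ∷ ρ) + x * value q (x ∷ ρ))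
        ≈⟨ interchange _ _ _ _ ⟩
      (value a ρ + x * value p (x ∷ ρ)) + (value b ρ + x * value q (x ∷ ρ)) ∎

    value-negate : ∀ {n} (p : Pol n) ρ → value (negate p) ρ ≈ - value p ρ
    value-negate {zero}  a       ρ = ι-neg a
    value-negate {suc n} []      ρ = sym -0#≈0#
    value-negate {suc n} (a ∷ p) (x ∷ ρ) = begin
      value (negate a) ρ + x * value (negate p) (x ∷ ρ)
        ≈⟨ +-cong (value-negate a ρ) (trans (*-congˡ (value-negate p (x ∷ ρ))) (sym (-‿distribʳ-* x _))) ⟩
      - value a ρ + - (x * value p (x ∷ ρ)) ≈⟨ -‿+-comm _ _ ⟩
      - (value a ρ + x * value p (x ∷ ρ))   ∎

    value-isZero : ∀ {n} (p : Pol n) ρ → isZero p ≡ true → value p ρ ≈ 0#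
    value-isZero {zero}  (+ zero) ρ eq = ι-0
    value-isZero {suc n} []       ρ eq = refl
    value-isZero {suc n} (a ∷ p)  (x ∷ ρ) eq with isZero a in eqa | isZero p in eqp
    ... | true | true = begin
      value a ρ + x * value p (x ∷ ρ) ≈⟨ +-cong (value-isZero a ρ eqa) (*-congˡ (value-isZero p (x ∷ ρ) eqp)) ⟩
      0# + x * 0#                     ≈⟨ trans (+-identityˡ _) (zeroʳ x) ⟩
      0#                              ∎

    mutual
      value-mul : ∀ {n} (p q : Pol n) ρ → value (mul p q) ρ ≈ value p ρ * value q ρ
      value-mul {zero}  a       b ρ       = ι-* a b
      value-mul {suc n} []      q ρ       = sym (zeroˡ _)
      value-mul {suc n} (a ∷ p) q (x ∷ ρ) with isZero a in eq
      ... | false = begin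
        value (add (scale a q) (constant (+ 0) ∷ mul p q)) (x ∷ ρ)
          ≈⟨ value-add (scale a q) _ (x ∷ ρ) ⟩
        value (scale a q) (x ∷ ρ) + value (constant {n} (+ 0) ∷ mul p q) (x ∷ ρ)
          ≈⟨ +-cong (value-scale a q x ρ) (trans (value-shift x ρ (mul p q)) (*-congˡ (value-mul p q (x ∷ ρ)))) ⟩
        value a ρ * value q (x ∷ ρ) + x * (value p (x ∷ ρ) * value q (x ∷ ρ))
          ≈⟨ +-congˡ (*-assoc x _ _) ⟨
        value a ρ * value q (x ∷ ρ) + x * value p (x ∷ ρ) * value q (x ∷ ρ)
          ≈⟨ distribʳ _ _ _ ⟨
        (value a ρ + x * value p (x ∷ ρ)) * value q (x ∷ ρ) ∎
      ... | true = begin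
        value (constant {n} (+ 0) ∷ mul p q) (x ∷ ρ)    ≈⟨ value-shift x ρ (mul p q) ⟩
        x * value (mul p q) (x ∷ ρ)                     ≈⟨ *-congˡ (value-mul p q (x ∷ ρ)) ⟩
        x * (value p (x ∷ ρ) * value q (x ∷ ρ))         ≈⟨ *-assoc x _ _ ⟨
        x * value p (x ∷ ρ) * value q (x ∷ ρ)           ≈⟨ *-congʳ (+-identityˡ _) ⟨
        (0# + x * value p (x ∷ ρ)) * value q (x ∷ ρ)    ≈⟨ *-congʳ (+-congʳ (value-isZero a ρ eq)) ⟨
        (value a ρ + x * value p (x ∷ ρ)) * value q (x ∷ ρ) ∎

      value-scale : ∀ {n} (a : Pol n) (q : Pol (suc n)) x ρ →
        value (scale a q) (x ∷ ρ) ≈ value a ρ * value q (x ∷ ρ)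
      value-scale a []      x ρ = sym (zeroʳ _)
      value-scale a (b ∷ q) x ρ = begin
        value (mul a b) ρ + x * value (scale a q) (x ∷ ρ)
          ≈⟨ +-cong (value-mul a b ρ) (*-congˡ (value-scale a q x ρ)) ⟩
        value a ρ * value b ρ + x * (value a ρ * value q (x ∷ ρ))
          ≈⟨ +-congˡ (x∙yz≈y∙xz x _ _) ⟩
        value a ρ * value b ρ + value a ρ * (x * value q (x ∷ ρ))
          ≈⟨ distribˡ _ _ _ ⟨
        value a ρ * (value b ρ + x * value q (x ∷ ρ)) ∎

    correct : ∀ {n} (e : Expr n) ρ → value (normalise e) ρ ≈ ⟦ e ⟧ ρ
    correct (var i)  ρ = value-variable i ρ
    correct (con c)  ρ = value-constant c ρ
    correct (e :+ f) ρ = trans (value-add (normalise e) _ ρ) (+-cong (correct e ρ) (correct f ρ))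
    correct (e :* f) ρ = trans (value-mul (normalise e) _ ρ) (*-cong (correct e ρ) (correct f ρ))
    correct (:- e)   ρ = trans (value-negate (normalise e) ρ) (-‿cong (correct e ρ))

    private
      cancel : ∀ {a b} → a + - b ≈ 0# → a ≈ b
      cancel {a} {b} eq = begin
        a             ≈⟨ +-identityʳ a ⟨
        a + 0#        ≈⟨ +-congˡ (-‿inverseˡ b) ⟨
        a + (- b + b) ≈⟨ +-assoc a _ b ⟨
        a + - b + b   ≈⟨ +-congʳ eq ⟩
        0# + b        ≈⟨ +-identityˡ b ⟩
        b             ∎

    combination-vanishes : ∀ {n} (cs : List (Expr n × Expr n)) ρ →
      All (λ cl → ⟦ proj₂ cl ⟧ ρ ≈ 0#) cs → ⟦ combination cs ⟧ ρ ≈ 0#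
    combination-vanishes []       ρ []       = ι-0
    combination-vanishes (c ∷ cs) ρ (z ∷ zs) = begin
      ⟦ proj₁ c ⟧ ρ * ⟦ proj₂ c ⟧ ρ + ⟦ combination cs ⟧ ρ
        ≈⟨ +-cong (trans (*-congˡ z) (zeroʳ _)) (combination-vanishes cs ρ zs) ⟩
      0# + 0# ≈⟨ +-identityˡ _ ⟩
      0#      ∎

    identity : ∀ {n} (e f : Expr n) → isZero (normalise (e :- f)) ≡ true → ∀ ρ → ⟦ e ⟧ ρ ≈ ⟦ f ⟧ ρ
    identity e f eq ρ = cancel (trans (sym (correct (e :- f) ρ)) (value-isZero (normalise (e :- f)) ρ eq))

    -- An ideal membership certificate: `cs` lists cofactors with generators. The Boolean condition
    -- is a computation with integer polynomials and therefore serves every ring and every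
    -- environment.
    consequence : ∀ {n} (e : Expr n) (cs : List (Expr n × Expr n)) →
      isZero (normalise (e :- combination cs)) ≡ true →
      ∀ ρ → All (λ cl → ⟦ proj₂ cl ⟧ ρ ≈ 0#) cs → ⟦ e ⟧ ρ ≈ 0#
    consequence e cs eq ρ zs = trans (identity e (combination cs) eq ρ) (combination-vanishes cs ρ zs)

-- Elimination of the coefficients of the two cubics

module Elimination where
  open import Algebra.Bundles using (CommutativeRing)
  open import Data.Fin.Base using (Fin; zero; suc)
  open import Data.Fin.Patterns
  open import Data.Integer.Base as ℤ using (ℤ; +_; -[1+_])
  open import Data.List.Base using (List; []; _∷_)
  open import Data.List.Relation.Unary.All using (All; []; _∷_)
  open import Data.Product using (_×_; _,_)
  open import Data.Vec.Base using (Vec; []; _∷_)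
  open import Defs using (theorem18-coeffs)
  open import Relation.Binary.PropositionalEquality as ≡ using (_≡_)
  open PolySolver

  polyExpr : ∀ {n} → Expr n → List ℤ → Expr n
  polyExpr x []       = # 0
  polyExpr x (c ∷ cs) = con c :+ x :* polyExpr x cs

  evalExpr : ∀ {n} → Expr n → Expr n → List (List ℤ) → Expr n
  evalExpr x H []       = # 0
  evalExpr x H (p ∷ ps) = polyExpr x p :+ (H :* H) :* evalExpr x H ps

  -- P(z) = z³ + p₂z² + p₁z + p₀ and Q(z) = xz³ + xr₂z² + xr₁z + (xr₀ − 1) satisfy
  -- P Q = (1 − z)³ + x(z³ − z⁵ + z⁶) as soon as the three `factor` expressions vanish.
  module Factorisation {n} (x p₀ p₁ p₂ : Expr n) where
    r₂ r₁ r₀ factor₀ factor₁ factor₂ : Expr n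
    r₂ = :- (# 1 :+ p₂)
    r₁ = p₂ :* (# 1 :+ p₂) :- p₁
    r₀ = # 1 :- p₀ :- p₂ :* r₁ :- p₁ :* r₂
    factor₀ = p₀ :- (con -[1+ 0 ] :+ x :* (p₀ :* r₀))
    factor₁ = p₁ :- (# 3 :+ x :* (p₁ :* r₀ :+ p₀ :* r₁))
    factor₂ = p₂ :- (con -[1+ 2 ] :+ x :* (p₂ :* r₀ :+ p₁ :* r₁ :+ p₀ :* r₂))

  -- h₀, …, h₃ extended to the left by h₋₁ = 1 and h₋₂ = 1 − x h₂ satisfy the recurrence
  -- with characteristic polynomial P.
  module Recurrence {n} (x p₀ p₁ p₂ h₀ h₁ h₂ h₃ : Expr n) where
    recurrence₀ recurrence₁ recurrence₂ boundary : Expr n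
    recurrence₀ = h₁ :+ p₂ :* h₀ :+ p₁ :* # 1 :+ p₀ :* (# 1 :- x :* h₂)
    recurrence₁ = h₂ :+ p₂ :* h₁ :+ p₁ :* h₀ :+ p₀ :* # 1
    recurrence₂ = h₃ :+ p₂ :* h₂ :+ p₁ :* h₁ :+ p₀ :* h₀
    boundary    = h₀ :- (# 1 :+ x :* (h₂ :+ h₃))

  -- With t = 1/z the factorisation becomes A B = t³(t − 1)³ + x(t³ − t + 1) for
  -- A = t³ + a₂t² + a₁t + a₀ and B = t³ + b₂t² + b₁t + b₀; coefficientᵢ compares coefficients of tⁱ.
  module Reciprocal {n} (x a₀ a₁ a₂ b₀ b₁ b₂ : Expr n) where
    coefficient₀ coefficient₁ coefficient₂ coefficient₃ coefficient₄ coefficient₅ : Expr n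
    coefficient₀ = x :- a₀ :* b₀
    coefficient₁ = a₀ :* b₁ :+ a₁ :* b₀ :+ x
    coefficient₂ = a₀ :* b₂ :+ a₂ :* b₀ :+ a₁ :* b₁
    coefficient₃ = a₀ :+ b₀ :+ a₁ :* b₂ :+ a₂ :* b₁ :+ # 1 :- x
    coefficient₄ = b₁ :- (# 3 :- a₁ :- a₂ :* b₂)
    coefficient₅ = b₂ :- (con -[1+ 2 ] :- a₂)

    determinant difference : Expr n
    determinant =
      x :* a₀ :* b₁ :- x :* a₀ :* b₂ :^ 2 :+ x :* b₀ :* b₂ :- x :* b₁ :^ 2 :+ x :* b₁ :+ a₀ :* b₀ :^ 2
      :- # 2 :* a₀ :* b₀ :* b₁ :* b₂ :+ a₀ :* b₁ :^ 3 :+ b₀ :^ 2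
    difference = b₁ :+ b₂ :- a₁ :- a₂

  -- Writing A = t(t−1)(t−m) + α + μt and B = t(t−1)(t−n) + β + νt with n = 1 − m.
  module Interpolation {k} (x h m α β μ ν : Expr k) where
    n q d e z s f g σ κ : Expr k
    n = # 1 :- m
    q = m :* n
    d = m :- n
    e = d :* h
    z = h :* h
    s = q :+ # 2 :* x :+ e
    f = q :* q :- z :- q :- # 6 :* x :- e
    g = :- z :- # 2 :* x :* q :- q :* e
    σ = # 2 :* (α :+ β)
    κ = # 2 :* (β :- α)

    hyp₁ hyp₂ hyp₃ hyp₄ hyp₅ hyp₆ : Expr k
    hyp₁ = μ :+ ν :+ m :* n
    hyp₂ = m :* n :+ x :- α :- β :+ m :* ν :+ n :* μ
    hyp₃ = x :+ m :* β :+ n :* α :- μ :* ν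
    hyp₄ = α :* β :- x
    hyp₅ = α :* ν :+ β :* μ :+ μ :* ν
    hyp₆ = h :- ν :+ μ

  -- Exchanging A and B reverses the signs of d = m - n, h and κ. Here `D`, `e`, `z`, `f`, `g` and
  -- `s`² - 16x stand for d², dh, h², κd, κh and κ², and the six equations are the 2 × 2 minors of
  -- the symmetric rank-one matrix formed by these products.
  module Symmetric {k} (x q e z : Expr k) where
    s f g D : Expr k
    s = q :+ # 2 :* x :+ e
    f = q :* q :- z :- q :- # 6 :* x :- e
    g = :- z :- # 2 :* x :* q :- q :* e
    D = # 1 :- # 4 :* q

    eq₁ eq₂ eq₃ eq₄ eq₅ eq₆ : Expr k
    eq₁ = e :* e :- D :* z
    eq₂ = f :* z :- g :* e
    eq₃ = f :* e :- g :* D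
    eq₄ = f :* f :- (s :* s :- # 16 :* x) :* D
    eq₅ = f :* g :- (s :* s :- # 16 :* x) :* e
    eq₆ = g :* g :- (s :* s :- # 16 :* x) :* z

    -- Consequences of eq₁, …, eq₆ that are linear in 1, q, q², e over ℤ[x, z].
    linear₁ linear₂ linear₃ linear₄ : Expr k
    linear₁ =
      # 4 :* x :^ 2 :* q :^ 2 :+ # 8 :* x :^ 2 :* q :- # 24 :* x :^ 2 :* e
      :- # 36 :* x :^ 2 :* z :+ # 72 :* x :* q :* z :- # 40 :* x :* e :* z
      :+ # 144 :* x :* z :+ # 48 :* q :* z :^ 2
    linear₂ =
      # 384 :* x :^ 3 :* q :+ # 768 :* x :^ 3 :+ # 48 :* x :^ 2 :* q :^ 2
      :- # 1440 :* x :^ 2 :* q :+ # 480 :* x :^ 2 :* e :+ # 1872 :* x :^ 2 :* z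
      :+ # 384 :* x :^ 2 :+ # 224 :* x :* q :^ 2 :* z :+ # 160 :* x :* q :* z
      :+ # 480 :* x :* e :* z :+ # 288 :* x :* z :^ 2 :- # 1728 :* x :* z
      :- # 864 :* q :^ 2 :* z :+ # 64 :* e :* z :^ 2 :- # 288 :* z :^ 2
    linear₃ =
      con -[1+ 383 ] :* x :^ 3 :* e :- # 2304 :* x :^ 3 :- # 128 :* x :^ 2 :* q :^ 2
      :+ # 2304 :* x :^ 2 :* q :* z :+ # 4352 :* x :^ 2 :* q :- # 2688 :* x :^ 2 :* z
      :- # 1152 :* x :^ 2 :- # 96 :* x :* q :^ 2 :* z :- # 2496 :* x :* q :* z
      :- # 1600 :* x :* e :* z :+ # 3168 :* x :* z :^ 2 :+ # 5760 :* x :* z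
      :+ # 960 :* q :^ 2 :* z :^ 2 :+ # 2592 :* q :^ 2 :* z :+ # 192 :* q :* z :^ 2
      :- # 192 :* e :* z :^ 2 :+ # 576 :* z :^ 3 :+ # 864 :* z :^ 2
    linear₄ =
      # 4096 :* x :^ 4 :* q :^ 2 :- # 1024 :* x :^ 4 :* q :+ # 3072 :* x :^ 4 :* e
      :+ # 4608 :* x :^ 3 :* q :* z :+ # 512 :* x :^ 3 :* e :* z
      :- # 4032 :* x :^ 2 :* q :^ 2 :* z :+ # 21504 :* x :^ 2 :* q :* z :^ 2
      :+ # 1152 :* x :^ 2 :* q :* z :- # 3456 :* x :^ 2 :* e :* z
      :+ # 36288 :* x :^ 2 :* z :^ 2 :- # 20736 :* x :* q :^ 2 :* z :^ 2
      :- # 72576 :* x :* q :* z :^ 2 :- # 5760 :* x :* e :* z :^ 2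
      :+ # 76032 :* x :* z :^ 3 :+ # 20736 :* x :* z :^ 2 :+ # 6912 :* q :^ 2 :* z :^ 3
      :+ # 6912 :* q :* z :^ 3 :+ # 11520 :* z :^ 4

  module Consequences {c ℓ} (R : CommutativeRing c ℓ) (ι : ℤ → CommutativeRing.Carrier R)
    (ι-homomorphism : IsIntegerHomomorphism R ι) where
    open CommutativeRing R hiding (zero)
    open Evaluation R ι ι-homomorphism

    Vanishes : ∀ {n} → Vec Carrier n → Expr n → Set ℓ
    Vanishes ρ e = ⟦ e ⟧ ρ ≈ 0#

    module _ (x h q e : Carrier) where
      private
        ρ : Vec Carrier 4
        ρ = x ∷ h ∷ q ∷ e ∷ []
        X H Q E Z : Expr 4
        X = var 0F
        H = var 1F
        Q = var 2F
        E = var 3F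
        Z = H :* H
        module S = Symmetric X Q E Z

      symmetric⇒linear : All (Vanishes ρ) (S.eq₁ ∷ S.eq₂ ∷ S.eq₃ ∷ S.eq₄ ∷ S.eq₅ ∷ S.eq₆ ∷ []) →
        All (Vanishes ρ) (S.linear₁ ∷ S.linear₂ ∷ S.linear₃ ∷ S.linear₄ ∷ [])
      symmetric⇒linear (v₁ ∷ v₂ ∷ v₃ ∷ v₄ ∷ v₅ ∷ v₆ ∷ []) =
        consequence S.linear₁
          (((# 4 :* X :+ # 3 :* Q :^ 2 :+ # 9 :* Z) , S.eq₁) ∷
           ((con -[1+ 11 ] :* Q) , S.eq₂) ∷
           ((# 4 :* X) , S.eq₃) ∷
           ((# 9) , S.eq₆) ∷ [])
          ≡.refl ρ (v₁ ∷ v₂ ∷ v₃ ∷ v₆ ∷ []) ∷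
        consequence S.linear₂
          (((# 134 :* X :* Q :- # 102 :* X :+ # 21 :* Q :^ 2 :+ # 19 :* Q :* E
           :- # 297 :* Q :- # 9 :* E :- # 18 :* Z) , S.eq₁) ∷
           ((con -[1+ 263 ] :* X :- # 72 :* Q :- # 55 :* E :+ # 297) , S.eq₂) ∷
           ((# 6 :* X :+ # 3 :* Q :^ 2 :+ # 9 :* Q) , S.eq₃) ∷
           ((# 24 :* X :+ # 9 :* E) , S.eq₄) ∷
           ((con -[1+ 8 ]) , S.eq₅) ∷ [])
          ≡.refl ρ (v₁ ∷ v₂ ∷ v₃ ∷ v₄ ∷ v₅ ∷ []) ∷
        consequence S.linear₃
          (((# 384 :* X :^ 2 :- # 210 :* X :* Q :+ # 96 :* X :* E :+ # 322 :* X
           :- # 12 :* Q :^ 3 :- # 87 :* Q :^ 2 :- # 129 :* Q :* E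
           :+ # 396 :* Q :* Z :+ # 891 :* Q :+ # 27 :* E :+ # 54 :* Z) , S.eq₁) ∷
           ((# 528 :* X :+ # 12 :* Q :^ 2 :+ # 240 :* Q :+ # 237 :* E
           :- # 540 :* Z :- # 891) , S.eq₂) ∷
           ((con -[1+ 23 ] :* X :* Q :- # 2 :* X :- # 9 :* Q :^ 2 :- # 27 :* Q) , S.eq₃) ∷
           ((con -[1+ 71 ] :* X :- # 27 :* E :+ # 36 :* Z) , S.eq₄) ∷
           ((# 96 :* X :+ # 27) , S.eq₅) ∷ [])
          ≡.refl ρ (v₁ ∷ v₂ ∷ v₃ ∷ v₄ ∷ v₅ ∷ []) ∷
        consequence S.linear₄
          (((con -[1+ 511 ] :* X :^ 3 :+ # 192 :* X :^ 2 :* Q :^ 2 :- # 1152 :* X :^ 2 :* Q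
           :- # 72 :* X :* Q :^ 2 :* E :- # 90 :* X :* Q :* E :- # 6696 :* X :* Q :* Z
           :- # 1458 :* X :* Z :- # 324 :* Q :^ 3 :* Z :+ # 108 :* Q :^ 2 :* E :^ 2
           :- # 729 :* Q :^ 2 :* Z :+ # 243 :* Q :* E :^ 2 :- # 2592 :* Q :* E :* Z
           :+ # 4932 :* Q :* Z :^ 2 :- # 243 :* Q :* Z :- # 243 :* Z :^ 2) , S.eq₁) ∷
           ((con -[1+ 767 ] :* X :^ 2 :* Q :+ # 288 :* X :* Q :* E :+ # 576 :* X :* E
           :+ # 864 :* X :* Z :- # 108 :* Q :* E :^ 2 :- # 243 :* E :^ 2
           :+ # 2592 :* E :* Z :- # 10224 :* Z :^ 2 :+ # 243 :* Z) , S.eq₂) ∷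
           ((con -[1+ 511 ] :* X :^ 3) , S.eq₃) ∷
           ((# 1296 :* Z :^ 2) , S.eq₄) ∷ [])
          ≡.refl ρ (v₁ ∷ v₂ ∷ v₃ ∷ v₄ ∷ []) ∷
        []

    -- The coefficients are the cofactors of a 4 × 4 determinant: they express the determinant of the
    -- coefficient matrix of linear₁, …, linear₄ with respect to 1, q, q², e.
    module _ (x H q e : Carrier) where
      private
        ρ : Vec Carrier 4
        ρ = x ∷ H ∷ q ∷ e ∷ []
        X Y Q E Z : Expr 4
        X = var 0F
        Y = var 1F
        Q = var 2F
        E = var 3F
        Z = (X :* Y) :* (X :* Y)
        module S = Symmetric X Q E Z

      linear⇒algebraic : All (Vanishes ρ) (S.linear₁ ∷ S.linear₂ ∷ S.linear₃ ∷ S.linear₄ ∷ []) →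
        Vanishes ρ (# 36864 :* X :^ 10 :* evalExpr X Y theorem18-coeffs)
      linear⇒algebraic (v₁ ∷ v₂ ∷ v₃ ∷ v₄ ∷ []) =
        consequence (# 36864 :* X :^ 10 :* evalExpr X Y theorem18-coeffs)
          (((# 1024 :* X :^ 10 :- # 4064 :* X :^ 9 :+ # 10560 :* X :^ 8 :* Z
           :+ # 14272 :* X :^ 8 :+ # 768 :* X :^ 7 :* Z :^ 2 :- # 4608 :* X :^ 7 :* Z
           :- # 512 :* X :^ 6 :* Z :^ 3 :+ # 17408 :* X :^ 6 :* Z :^ 2
           :- # 11712 :* X :^ 6 :* Z :- # 55168 :* X :^ 5 :* Z :^ 3
           :- # 90912 :* X :^ 5 :* Z :^ 2 :- # 52992 :* X :^ 4 :* Z :^ 4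
           :- # 19584 :* X :^ 4 :* Z :^ 3 :- # 2592 :* X :^ 4 :* Z :^ 2
           :- # 9984 :* X :^ 3 :* Z :^ 5 :+ # 105408 :* X :^ 3 :* Z :^ 4
           :+ # 163296 :* X :^ 3 :* Z :^ 3 :- # 512 :* X :^ 2 :* Z :^ 6
           :+ # 42240 :* X :^ 2 :* Z :^ 5 :- # 15552 :* X :^ 2 :* Z :^ 4
           :+ # 864 :* X :* Z :^ 6 :- # 576 :* Z :^ 7) , S.linear₁) ∷
           ((con -[1+ 23 ] :* X :^ 9 :+ # 252 :* X :^ 8 :* Z :+ # 816 :* X :^ 8
           :+ # 576 :* X :^ 7 :* Z :^ 2 :+ # 744 :* X :^ 7 :* Z
           :- # 1512 :* X :^ 6 :* Z :^ 2 :- # 816 :* X :^ 6 :* Z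
           :- # 2064 :* X :^ 5 :* Z :^ 3 :- # 6192 :* X :^ 5 :* Z :^ 2
           :- # 3600 :* X :^ 4 :* Z :^ 4 :- # 6516 :* X :^ 4 :* Z :^ 3
           :- # 576 :* X :^ 3 :* Z :^ 5 :+ # 7992 :* X :^ 3 :* Z :^ 4
           :+ # 8748 :* X :^ 3 :* Z :^ 3 :+ # 5904 :* X :^ 2 :* Z :^ 5
           :+ # 14580 :* X :^ 2 :* Z :^ 4 :- # 648 :* X :* Z :^ 6 :- # 108 :* Z :^ 7) , S.linear₂) ∷
           ((con -[1+ 71 ] :* X :^ 9 :- # 108 :* X :^ 8 :* Z :+ # 240 :* X :^ 8
           :+ # 216 :* X :^ 7 :* Z :+ # 264 :* X :^ 6 :* Z :^ 2 :- # 240 :* X :^ 6 :* Z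
           :+ # 720 :* X :^ 5 :* Z :^ 3 :- # 2064 :* X :^ 5 :* Z :^ 2
           :+ # 144 :* X :^ 4 :* Z :^ 4 :- # 2268 :* X :^ 4 :* Z :^ 3
           :+ # 72 :* X :^ 3 :* Z :^ 4 :+ # 2916 :* X :^ 3 :* Z :^ 3
           :+ # 240 :* X :^ 2 :* Z :^ 5 :+ # 4860 :* X :^ 2 :* Z :^ 4
           :- # 216 :* X :* Z :^ 6 :- # 36 :* Z :^ 7) , S.linear₃) ∷
           ((con -[1+ 0 ] :* X :^ 8 :+ # 2 :* X :^ 7 :- # 18 :* X :^ 6 :* Z
           :- # 16 :* X :^ 6 :- # 12 :* X :^ 5 :* Z :^ 2 :+ # 6 :* X :^ 5 :* Z
           :- # 4 :* X :^ 4 :* Z :^ 3 :+ # 31 :* X :^ 4 :* Z :^ 2 :+ # 18 :* X :^ 4 :* Z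
           :+ # 154 :* X :^ 3 :* Z :^ 3 :+ # 81 :* X :^ 3 :* Z :^ 2
           :+ # 132 :* X :^ 2 :* Z :^ 4 :- # 27 :* X :^ 2 :* Z :^ 3
           :+ # 48 :* X :* Z :^ 5 :+ # 5 :* Z :^ 6) , S.linear₄) ∷ [])
          ≡.refl ρ (v₁ ∷ v₂ ∷ v₃ ∷ v₄ ∷ [])

    module _ (x h m α β μ ν : Carrier) where
      private
        ρ : Vec Carrier 7
        ρ = x ∷ h ∷ m ∷ α ∷ β ∷ μ ∷ ν ∷ []
        X M N A B U V W : Expr 7
        X = var 0F
        W = var 1F
        M = var 2F
        A = var 3F
        B = var 4F
        U = var 5F
        V = var 6F
        N = # 1 :- M
        module I = Interpolation X W M A B U V
        module S = Symmetric X I.q I.e I.z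

      -- On the hypotheses `s`, `f` and `g` become σ, κd and κh, and κ² = σ² - 16αβ, where αβ = x by
      -- `hyp₄`.
      interpolation⇒symmetric :
        All (Vanishes ρ) (I.hyp₁ ∷ I.hyp₂ ∷ I.hyp₃ ∷ I.hyp₄ ∷ I.hyp₅ ∷ I.hyp₆ ∷ []) →
        All (Vanishes ρ) (S.eq₁ ∷ S.eq₂ ∷ S.eq₃ ∷ S.eq₄ ∷ S.eq₅ ∷ S.eq₆ ∷ [])
      interpolation⇒symmetric (v₁ ∷ v₂ ∷ v₃ ∷ v₄ ∷ v₅ ∷ v₆ ∷ []) =
        consequence S.eq₁ [] ≡.refl ρ [] ∷
        consequence S.eq₂ ((I.z , f-κd) ∷ (:- I.e , g-κh) ∷ []) ≡.refl ρ (vf ∷ vg ∷ []) ∷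
        consequence S.eq₃ ((I.e , f-κd) ∷ (:- S.D , g-κh) ∷ []) ≡.refl ρ (vf ∷ vg ∷ []) ∷
        consequence S.eq₄ ((I.f :+ I.κ :* I.d , f-κd) ∷ (:- S.D :* (I.s :+ I.σ) , s-σ) ∷ (con -[1+ 15 ] :* S.D , I.hyp₄) ∷ [])
          ≡.refl ρ (vf ∷ vs ∷ v₄ ∷ []) ∷
        consequence S.eq₅ ((I.g , f-κd) ∷ (I.κ :* I.d , g-κh) ∷ (:- I.e :* (I.s :+ I.σ) , s-σ) ∷ (con -[1+ 15 ] :* I.e , I.hyp₄) ∷ [])
          ≡.refl ρ (vf ∷ vg ∷ vs ∷ v₄ ∷ []) ∷
        consequence S.eq₆ ((I.g :+ I.κ :* W , g-κh) ∷ (:- I.z :* (I.s :+ I.σ) , s-σ) ∷ (con -[1+ 15 ] :* I.z , I.hyp₄) ∷ [])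
          ≡.refl ρ (vg ∷ vs ∷ v₄ ∷ []) ∷
        []
        where
        s-σ f-κd g-κh : Expr 7
        s-σ  = I.s :- I.σ
        f-κd = I.f :- I.κ :* I.d
        g-κh = I.g :- I.κ :* W

        vs : Vanishes ρ s-σ
        vs = consequence s-σ ((# 2 , I.hyp₂) ∷ (con -[1+ 0 ] , I.hyp₁) ∷ (I.d , I.hyp₆) ∷ [])
          ≡.refl ρ (v₂ ∷ v₁ ∷ v₆ ∷ [])

        vf : Vanishes ρ f-κd
        vf = consequence f-κd
          ((I.q :- U :- V , I.hyp₁) ∷ (:- (W :+ V :- U) , I.hyp₆) ∷ (con -[1+ 3 ] , I.hyp₃) ∷ (con -[1+ 0 ] , s-σ) ∷ [])
          ≡.refl ρ (v₁ ∷ v₆ ∷ v₃ ∷ vs ∷ [])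

        vg : Vanishes ρ g-κh
        vg = consequence g-κh
          ((# 4 , I.hyp₅) ∷ (:- (I.σ :+ U :+ V :- I.q) , I.hyp₁) ∷ (:- (W :+ V :- U :+ I.κ) , I.hyp₆) ∷ (:- I.q , s-σ) ∷ [])
          ≡.refl ρ (v₅ ∷ v₁ ∷ v₆ ∷ vs ∷ [])

    module _ (x a₀′ a₁′ a₂′ b₀′ b₁′ b₂′ h₀′ h₁′ h₂′ h₃′ : Carrier) where
      private
        ρ : Vec Carrier 11
        ρ = x ∷ a₀′ ∷ a₁′ ∷ a₂′ ∷ b₀′ ∷ b₁′ ∷ b₂′ ∷ h₀′ ∷ h₁′ ∷ h₂′ ∷ h₃′ ∷ []
        X a₀ a₁ a₂ b₀ b₁ b₂ h₀ h₁ h₂ h₃ rec₀ rec₁ rec₂ boundary : Expr 11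
        X  = var 0F
        a₀ = var 1F
        a₁ = var 2F
        a₂ = var 3F
        b₀ = var 4F
        b₁ = var 5F
        b₂ = var 6F
        h₀ = var 7F
        h₁ = var 8F
        h₂ = var 9F
        h₃ = var (suc 9F)
        module A = Reciprocal X a₀ a₁ a₂ b₀ b₁ b₂
        rec₀ = b₀ :* h₁ :+ b₁ :* h₀ :+ b₂ :+ # 1 :- X :* h₂
        rec₁ = b₀ :* h₂ :+ b₁ :* h₁ :+ b₂ :* h₀ :+ # 1
        rec₂ = b₀ :* h₃ :+ b₁ :* h₂ :+ b₂ :* h₁ :+ h₀
        boundary = h₀ :- (# 1 :+ X :* (h₂ :+ h₃))

      reciprocal-relations : List (Expr 11)
      reciprocal-relations =
        A.coefficient₀ ∷ A.coefficient₁ ∷ A.coefficient₂ ∷ A.coefficient₃ ∷ A.coefficient₄ ∷ A.coefficient₅ ∷ []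

      recurrence-relations : List (Expr 11)
      recurrence-relations = rec₀ ∷ rec₁ ∷ rec₂ ∷ boundary ∷ []

      -- The three recurrences and the boundary condition are linear in h₀, h₁, h₂; Cramer's rule.
      determinant-h₀ : All (Vanishes ρ) reciprocal-relations → All (Vanishes ρ) recurrence-relations →
        Vanishes ρ (A.determinant :* (X :* h₀ :- A.difference))
      determinant-h₀ (v₀ ∷ v₁ ∷ v₂ ∷ v₃ ∷ v₄ ∷ v₅ ∷ []) (w₀ ∷ w₁ ∷ w₂ ∷ w₃ ∷ []) =
        consequence (A.determinant :* (X :* h₀ :- A.difference))
          (((con -[1+ 0 ] :* X :^ 2 :* b₁ :- X :* a₀ :* b₀ :* b₂ :+ X :* a₀ :* b₁ :^ 2) , rec₀) ∷
           ((con -[1+ 0 ] :* X :^ 2 :* a₀ :* b₂ :+ X :^ 2 :* b₀ :- X :* a₀ :* b₀ :* b₁) , rec₁) ∷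
           ((X :^ 2 :* a₀ :* b₁ :+ X :* a₀ :* b₀ :^ 2) , rec₂) ∷
           ((X :^ 2 :* b₁ :+ X :* b₀ :^ 2) , boundary) ∷
           ((X :^ 2 :* b₁ :+ X :* b₀ :^ 2) :* h₃ :+ (con -[1+ 0 ] :* X :* b₂ :- X :- a₁ :* b₀ :+ a₁ :* b₁ :* b₂ :+ a₂ :* b₁ :^ 2 :- b₀ :* b₁
           :- b₀ :* b₂ :^ 2 :- # 2 :* b₀ :* b₂ :+ b₁ :^ 2 :* b₂ :+ # 2 :* b₁ :^ 2 :+ b₁) , A.coefficient₀) ∷
           ((X :* a₂ :* b₂ :+ X :* b₀ :- X :* b₁ :* b₂ :- # 2 :* X :* b₁ :+ X :* b₂ :^ 2
           :+ # 4 :* X :* b₂ :+ X :+ a₁ :* b₁ :^ 2 :+ a₂ :* b₀ :* b₁ :- a₂ :* b₀ :* b₂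
           :+ a₂ :* b₁ :^ 2 :- b₀ :^ 2 :+ # 2 :* b₀ :* b₁ :* b₂ :+ # 2 :* b₀ :* b₁
           :+ b₀ :* b₂ :^ 2 :+ b₀ :- b₁ :^ 3 :- b₁ :^ 2 :* b₂) , A.coefficient₁) ∷
           ((X :^ 2 :- X :* a₁ :* b₂ :- X :* a₂ :* b₁ :- X :* a₂ :* b₂ :+ X :* b₀ :* b₂ :+ X :* b₀
           :- # 4 :* X :* b₁ :+ X :* b₂ :^ 2 :- a₁ :* b₀ :* b₁ :- a₂ :* b₀ :* b₁ :- b₀ :^ 2 :* b₂
           :- # 2 :* b₀ :^ 2 :+ b₀ :* b₁ :^ 2 :+ b₀ :* b₁ :* b₂) , A.coefficient₂) ∷
           ((X :* a₁ :* b₁ :+ X :* a₂ :* b₁ :- X :* b₀ :* b₂ :- X :* b₀ :- X :* b₁ :* b₂ :- X :* b₁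
           :+ a₂ :* b₀ :^ 2 :- b₀ :^ 2 :* b₁ :- b₀ :^ 2 :* b₂) , A.coefficient₃) ∷
           ((X :* a₂ :* b₀ :- X :* b₀ :^ 2 :- X :* b₀ :* b₂ :+ # 3 :* X :* b₀
           :+ # 2 :* X :* b₁ :^ 2 :+ b₀ :^ 3) , A.coefficient₄) ∷
           ((con -[1+ 0 ] :* X :^ 2 :* b₀ :+ X :^ 2 :* b₁ :- X :^ 2 :* b₂ :- X :* a₁ :* b₀
           :+ X :* a₂ :* b₀ :* b₁ :- X :* a₂ :* b₁ :^ 2 :- X :* b₀ :* b₁ :- X :* b₀ :* b₂
           :+ # 3 :* X :* b₀ :+ X :* b₁ :^ 2 :+ b₀ :^ 3) , A.coefficient₅) ∷ [])
          ≡.refl ρ (w₀ ∷ w₁ ∷ w₂ ∷ w₃ ∷ v₀ ∷ v₁ ∷ v₂ ∷ v₃ ∷ v₄ ∷ v₅ ∷ [])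

    module _ (x h a₀′ a₁′ a₂′ b₀′ b₁′ b₂′ : Carrier) where
      private
        ρ : Vec Carrier 8
        ρ = x ∷ h ∷ a₀′ ∷ a₁′ ∷ a₂′ ∷ b₀′ ∷ b₁′ ∷ b₂′ ∷ []
        X W a₀ a₁ a₂ b₀ b₁ b₂ : Expr 8
        X  = var 0F
        W  = var 1F
        a₀ = var 2F
        a₁ = var 3F
        a₂ = var 4F
        b₀ = var 5F
        b₁ = var 6F
        b₂ = var 7F
        module A = Reciprocal X a₀ a₁ a₂ b₀ b₁ b₂
        module I = Interpolation X W (con -[1+ 0 ] :- a₂) a₀ b₀ (# 1 :+ a₂ :+ a₁) (# 1 :+ b₂ :+ b₁)

      reciprocal⇒interpolation :
        All (Vanishes ρ) (A.coefficient₀ ∷ A.coefficient₁ ∷ A.coefficient₂ ∷ A.coefficient₃ ∷ A.coefficient₄ ∷ A.coefficient₅ ∷ []) →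
        Vanishes ρ (W :- A.difference) →
        All (Vanishes ρ) (I.hyp₁ ∷ I.hyp₂ ∷ I.hyp₃ ∷ I.hyp₄ ∷ I.hyp₅ ∷ I.hyp₆ ∷ [])
      reciprocal⇒interpolation (v₀ ∷ v₁ ∷ v₂ ∷ v₃ ∷ v₄ ∷ v₅ ∷ []) v =
        consequence I.hyp₁ ((one , A.coefficient₄) ∷ (one :- a₂ , A.coefficient₅) ∷ [])
          ≡.refl ρ (v₄ ∷ v₅ ∷ []) ∷
        consequence I.hyp₂ ((:- one , A.coefficient₃) ∷ (:- one , A.coefficient₄) ∷ (a₁ :- one , A.coefficient₅) ∷ [])
          ≡.refl ρ (v₃ ∷ v₄ ∷ v₅ ∷ []) ∷
        consequence I.hyp₃
          ((:- one , A.coefficient₂) ∷ (:- one , A.coefficient₃) ∷ (:- one , A.coefficient₄) ∷ (a₀ :- one , A.coefficient₅) ∷ [])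
          ≡.refl ρ (v₂ ∷ v₃ ∷ v₄ ∷ v₅ ∷ []) ∷
        consequence I.hyp₄ ((:- one , A.coefficient₀) ∷ []) ≡.refl ρ (v₀ ∷ []) ∷
        consequence I.hyp₅
          ((one , A.coefficient₁) ∷ (one , A.coefficient₂) ∷ (one , A.coefficient₃) ∷ (one , A.coefficient₄) ∷ (one , A.coefficient₅) ∷ [])
          ≡.refl ρ (v₁ ∷ v₂ ∷ v₃ ∷ v₄ ∷ v₅ ∷ []) ∷
        consequence I.hyp₆ ((one , W :- A.difference) ∷ []) ≡.refl ρ (v ∷ []) ∷
        []
        where
        one : Expr 8
        one = # 1

    module _ (x h₀ : Carrier) where
      Algebraic : Set ℓ
      Algebraic = ⟦ # 36864 :* var 0F :^ 10 :* evalExpr (var 0F) (var 1F) theorem18-coeffs ⟧ (x ∷ h₀ ∷ []) ≈ 0#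

      private
        h : Carrier
        h = x * h₀

      module _ (q e : Carrier) where
        private
          module S = Symmetric {4} (var 0F) (var 2F) (var 3F) (var 1F :* var 1F)
          module S′ = Symmetric {4} (var 0F) (var 2F) (var 3F) ((var 0F :* var 1F) :* (var 0F :* var 1F))

          -- The old and new expressions have definitionally equal values in their environments;
          -- only the list has to be rebuilt, because the expressions themselves differ.
          regroup : All (Vanishes (x ∷ h ∷ q ∷ e ∷ [])) (S.linear₁ ∷ S.linear₂ ∷ S.linear₃ ∷ S.linear₄ ∷ []) →
            All (Vanishes (x ∷ h₀ ∷ q ∷ e ∷ [])) (S′.linear₁ ∷ S′.linear₂ ∷ S′.linear₃ ∷ S′.linear₄ ∷ [])
          regroup (l₁ ∷ l₂ ∷ l₃ ∷ l₄ ∷ []) = l₁ ∷ l₂ ∷ l₃ ∷ l₄ ∷ []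

        symmetric⇒algebraic :
          All (Vanishes (x ∷ h ∷ q ∷ e ∷ [])) (S.eq₁ ∷ S.eq₂ ∷ S.eq₃ ∷ S.eq₄ ∷ S.eq₅ ∷ S.eq₆ ∷ []) → Algebraic
        symmetric⇒algebraic eqs = linear⇒algebraic x h₀ q e (regroup (symmetric⇒linear x h q e eqs))

      module _ (m α β μ ν : Carrier) where
        private
          ρ : Vec Carrier 7
          ρ = x ∷ h ∷ m ∷ α ∷ β ∷ μ ∷ ν ∷ []
          module I = Interpolation {7} (var 0F) (var 1F) (var 2F) (var 3F) (var 4F) (var 5F) (var 6F)
          module S = Symmetric {7} (var 0F) I.q I.e I.z
          module S′ = Symmetric {4} (var 0F) (var 2F) (var 3F) (var 1F :* var 1F)

          regroup : All (Vanishes ρ) (S.eq₁ ∷ S.eq₂ ∷ S.eq₃ ∷ S.eq₄ ∷ S.eq₅ ∷ S.eq₆ ∷ []) →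
            All (Vanishes (x ∷ h ∷ ⟦ I.q ⟧ ρ ∷ ⟦ I.e ⟧ ρ ∷ []))
              (S′.eq₁ ∷ S′.eq₂ ∷ S′.eq₃ ∷ S′.eq₄ ∷ S′.eq₅ ∷ S′.eq₆ ∷ [])
          regroup (s₁ ∷ s₂ ∷ s₃ ∷ s₄ ∷ s₅ ∷ s₆ ∷ []) = s₁ ∷ s₂ ∷ s₃ ∷ s₄ ∷ s₅ ∷ s₆ ∷ []

        interpolation⇒algebraic :
          All (Vanishes ρ) (I.hyp₁ ∷ I.hyp₂ ∷ I.hyp₃ ∷ I.hyp₄ ∷ I.hyp₅ ∷ I.hyp₆ ∷ []) → Algebraic
        interpolation⇒algebraic hyps = symmetric⇒algebraic (⟦ I.q ⟧ ρ) (⟦ I.e ⟧ ρ)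
          (regroup (interpolation⇒symmetric x h m α β μ ν hyps))

      module _ (a₀ a₁ a₂ b₀ b₁ b₂ : Carrier) where
        private
          ρ : Vec Carrier 8
          ρ = x ∷ h ∷ a₀ ∷ a₁ ∷ a₂ ∷ b₀ ∷ b₁ ∷ b₂ ∷ []
          m μ ν : Expr 8
          m = con -[1+ 0 ] :- var 4F
          μ = # 1 :+ var 4F :+ var 3F
          ν = # 1 :+ var 7F :+ var 6F
          module A = Reciprocal {8} (var 0F) (var 2F) (var 3F) (var 4F) (var 5F) (var 6F) (var 7F)
          module I = Interpolation {8} (var 0F) (var 1F) m (var 2F) (var 5F) μ ν
          module I′ = Interpolation {7} (var 0F) (var 1F) (var 2F) (var 3F) (var 4F) (var 5F) (var 6F)

          regroup : All (Vanishes ρ) (I.hyp₁ ∷ I.hyp₂ ∷ I.hyp₃ ∷ I.hyp₄ ∷ I.hyp₅ ∷ I.hyp₆ ∷ []) →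
            All (Vanishes (x ∷ h ∷ ⟦ m ⟧ ρ ∷ a₀ ∷ b₀ ∷ ⟦ μ ⟧ ρ ∷ ⟦ ν ⟧ ρ ∷ []))
              (I′.hyp₁ ∷ I′.hyp₂ ∷ I′.hyp₃ ∷ I′.hyp₄ ∷ I′.hyp₅ ∷ I′.hyp₆ ∷ [])
          regroup (s₁ ∷ s₂ ∷ s₃ ∷ s₄ ∷ s₅ ∷ s₆ ∷ []) = s₁ ∷ s₂ ∷ s₃ ∷ s₄ ∷ s₅ ∷ s₆ ∷ []

        reciprocal⇒algebraic :
          All (Vanishes ρ) (A.coefficient₀ ∷ A.coefficient₁ ∷ A.coefficient₂ ∷ A.coefficient₃ ∷ A.coefficient₄ ∷ A.coefficient₅ ∷ []) →
          Vanishes ρ (var 1F :- A.difference) → Algebraic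
        reciprocal⇒algebraic vs v = interpolation⇒algebraic (⟦ m ⟧ ρ) a₀ b₀ (⟦ μ ⟧ ρ) (⟦ ν ⟧ ρ)
          (regroup (reciprocal⇒interpolation x h a₀ a₁ a₂ b₀ b₁ b₂ vs v))

    module _ (x p₀′ p₁′ p₂′ h₀′ h₁′ h₂′ h₃′ : Carrier) where
      private
        ρ : Vec Carrier 8
        ρ = x ∷ p₀′ ∷ p₁′ ∷ p₂′ ∷ h₀′ ∷ h₁′ ∷ h₂′ ∷ h₃′ ∷ []
        X p₀ p₁ p₂ h₀ h₁ h₂ h₃ a₀ a₁ a₂ b₀ b₁ b₂ : Expr 8
        X  = var 0F
        p₀ = var 1F
        p₁ = var 2F
        p₂ = var 3F
        h₀ = var 4F
        h₁ = var 5F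
        h₂ = var 6F
        h₃ = var 7F
        module F = Factorisation X p₀ p₁ p₂
        module C = Recurrence X p₀ p₁ p₂ h₀ h₁ h₂ h₃
        -- By `factor₀`, p₀ and `b₀` = xr₀ - 1 are mutually inverse. Multiplying the reversed Q by
        -- p₀ and the reversed P by `b₀` makes both monic without a division.
        a₀ = X :* p₀
        a₁ = X :* F.r₂ :* p₀
        a₂ = X :* F.r₁ :* p₀
        b₀ = con -[1+ 0 ] :+ X :* F.r₀
        b₁ = p₂ :* b₀
        b₂ = p₁ :* b₀
        module A = Reciprocal X a₀ a₁ a₂ b₀ b₁ b₂

      factorisation-relations : List (Expr 8)
      factorisation-relations = F.factor₀ ∷ F.factor₁ ∷ F.factor₂ ∷ []

      boundary-relations : List (Expr 8)
      boundary-relations = C.recurrence₀ ∷ C.recurrence₁ ∷ C.recurrence₂ ∷ C.boundary ∷ []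

      determinant : Carrier
      determinant = ⟦ A.determinant ⟧ ρ

      -- Cramer's rule yields the equation x h₀ = b₁ + b₂ - a₁ - a₂ only up to the factor
      -- `determinant`; `regular` cancels it in a ring that need not be a field.
      algebraic : All (Vanishes ρ) factorisation-relations → All (Vanishes ρ) boundary-relations →
        (∀ y → determinant * y ≈ 0# → y ≈ 0#) →
        Algebraic x h₀′
      algebraic (f₀ ∷ f₁ ∷ f₂ ∷ []) (w₀ ∷ w₁ ∷ w₂ ∷ w₃ ∷ []) regular =
        result
        where
        v₀ : Vanishes ρ A.coefficient₀
        v₀ = consequence A.coefficient₀ ((X , F.factor₀) ∷ []) ≡.refl ρ (f₀ ∷ [])
        v₁ : Vanishes ρ A.coefficient₁
        v₁ = consequence A.coefficient₁ ((X , F.factor₀) ∷ []) ≡.refl ρ (f₀ ∷ [])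
        v₂ : Vanishes ρ A.coefficient₂
        v₂ = consequence A.coefficient₂ [] ≡.refl ρ []
        v₃ : Vanishes ρ A.coefficient₃
        v₃ = consequence A.coefficient₃ ((:- X :* (F.r₂ :* p₁ :+ F.r₁ :* p₂) , F.factor₀) ∷ []) ≡.refl ρ (f₀ ∷ [])
        v₄ : Vanishes ρ A.coefficient₄
        v₄ = consequence A.coefficient₄ ((con -[1+ 0 ] , F.factor₂) ∷ (:- X :* F.r₁ :* p₁ , F.factor₀) ∷ []) ≡.refl ρ (f₂ ∷ f₀ ∷ [])
        v₅ : Vanishes ρ A.coefficient₅
        v₅ = consequence A.coefficient₅ ((con -[1+ 0 ] , F.factor₁) ∷ []) ≡.refl ρ (f₁ ∷ [])
        rec₀ rec₁ rec₂ : Expr 8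
        rec₀ = b₀ :* h₁ :+ b₁ :* h₀ :+ b₂ :+ # 1 :- X :* h₂
        rec₁ = b₀ :* h₂ :+ b₁ :* h₁ :+ b₂ :* h₀ :+ # 1
        rec₂ = b₀ :* h₃ :+ b₁ :* h₂ :+ b₂ :* h₁ :+ h₀
        r₀ : Vanishes ρ rec₀
        r₀ = consequence rec₀ ((b₀ , C.recurrence₀) ∷ (# 1 :- X :* h₂ , F.factor₀) ∷ []) ≡.refl ρ (w₀ ∷ f₀ ∷ [])
        r₁ : Vanishes ρ rec₁
        r₁ = consequence rec₁ ((b₀ , C.recurrence₁) ∷ (# 1 , F.factor₀) ∷ []) ≡.refl ρ (w₁ ∷ f₀ ∷ [])
        r₂ : Vanishes ρ rec₂
        r₂ = consequence rec₂ ((b₀ , C.recurrence₂) ∷ (h₀ , F.factor₀) ∷ []) ≡.refl ρ (w₂ ∷ f₀ ∷ [])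
        key : Vanishes ρ (X :* h₀ :- A.difference)
        key = regular _ (determinant-h₀ x (⟦ a₀ ⟧ ρ) (⟦ a₁ ⟧ ρ) (⟦ a₂ ⟧ ρ) (⟦ b₀ ⟧ ρ) (⟦ b₁ ⟧ ρ) (⟦ b₂ ⟧ ρ) h₀′ h₁′ h₂′ h₃′
          (v₀ ∷ v₁ ∷ v₂ ∷ v₃ ∷ v₄ ∷ v₅ ∷ []) (r₀ ∷ r₁ ∷ r₂ ∷ w₃ ∷ []))
        result : Algebraic x h₀′
        result = reciprocal⇒algebraic x h₀′ (⟦ a₀ ⟧ ρ) (⟦ a₁ ⟧ ρ) (⟦ a₂ ⟧ ρ) (⟦ b₀ ⟧ ρ) (⟦ b₁ ⟧ ρ) (⟦ b₂ ⟧ ρ)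
          (v₀ ∷ v₁ ∷ v₂ ∷ v₃ ∷ v₄ ∷ v₅ ∷ []) key

-- The ring of formal power series over ℤ and its x-adic approximation

module PowerSeries where
  open import Algebra.Bundles using (CommutativeRing)
  open import Data.Fin.Base using (Fin; zero; suc)
  open import Data.Fin.Patterns
  open import Data.Integer.Base as ℤ using (ℤ; +_; 0ℤ; 1ℤ)
  import Data.Integer.Properties as ℤ
  open import Data.List.Base using (List; []; _∷_; foldr; map; upTo; applyUpTo)
  open import Data.List.Properties using (map-applyUpTo)
  open import Data.Nat.Base as ℕ using (ℕ; zero; suc; _∸_; _<_; z<s; s<s)
  import Data.Nat.Properties as ℕ
  open import Data.Product using (_,_)
  open import Data.Sum.Base using (inj₁; inj₂)
  open import Data.Vec.Base using (Vec; []; _∷_; lookup)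
  open import Defs using (Series; _⊕_; _⊛_; poly; evalInSquare)
  open import Function.Base using (_∘_; id)
  open import Relation.Binary.PropositionalEquality
  open import Relation.Nullary using (contradiction)
  open import Algebra.Properties.CommutativeSemigroup ℤ.+-commutativeSemigroup using (interchange)
  open PolySolver
  open Elimination using (polyExpr; evalExpr; module Consequences)

  infix 4 _≈_
  _≈_ : Series → Series → Set
  f ≈ g = ∀ n → f n ≡ g n

  constant-series : ℤ → Series
  constant-series c = poly (c ∷ [])

  0ˢ : Series
  0ˢ _ = 0ℤ

  X : Series
  X = poly (0ℤ ∷ 1ℤ ∷ [])

  ⊖_ : Series → Series
  (⊖ f) n = ℤ.- f n

  scalar : ℤ → Series → Series
  scalar c f n = c ℤ.* f n

  tail : Series → Series
  tail f n = f (suc n)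

  ⊛-zero : ∀ f g → (f ⊛ g) 0 ≡ f 0 ℤ.* g 0
  ⊛-zero f g = ℤ.+-identityʳ _

  -- Splitting off the first summand turns convolution into a recursion on tails, on which the
  -- inductive proofs of the ring laws rest.
  ⊛-suc : ∀ f g n → (f ⊛ g) (suc n) ≡ f 0 ℤ.* g (suc n) ℤ.+ (tail f ⊛ g) n
  ⊛-suc f g n = cong (λ t → f 0 ℤ.* g (suc n) ℤ.+ foldr ℤ._+_ 0ℤ t) (begin
    map (λ i → f i ℤ.* g (suc n ∸ i)) (applyUpTo suc (suc n)) ≡⟨ map-applyUpTo suc _ (suc n) ⟩
    applyUpTo (λ i → f (suc i) ℤ.* g (n ∸ i)) (suc n)         ≡⟨ map-applyUpTo id _ (suc n) ⟨
    map (λ i → f (suc i) ℤ.* g (n ∸ i)) (upTo (suc n))        ∎)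
    where open ≡-Reasoning

  ⊛-cong : ∀ {f f′ g g′} → f ≈ f′ → g ≈ g′ → f ⊛ g ≈ f′ ⊛ g′
  ⊛-cong {f} {f′} {g} {g′} p q zero    = cong₂ (λ a b → a ℤ.* b ℤ.+ 0ℤ) (p 0) (q 0)
  ⊛-cong {f} {f′} {g} {g′} p q (suc n) = begin
    (f ⊛ g) (suc n)                           ≡⟨ ⊛-suc f g n ⟩
    f 0 ℤ.* g (suc n) ℤ.+ (tail f ⊛ g) n      ≡⟨ cong₂ ℤ._+_ (cong₂ ℤ._*_ (p 0) (q (suc n))) (⊛-cong (p ∘ suc) q n) ⟩
    f′ 0 ℤ.* g′ (suc n) ℤ.+ (tail f′ ⊛ g′) n  ≡⟨ ⊛-suc f′ g′ n ⟨
    (f′ ⊛ g′) (suc n)                         ∎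
    where open ≡-Reasoning

  ⊛-distribʳ : ∀ h f g → (f ⊕ g) ⊛ h ≈ (f ⊛ h) ⊕ (g ⊛ h)
  ⊛-distribʳ h f g zero = begin
    ((f ⊕ g) ⊛ h) 0                     ≡⟨ ⊛-zero (f ⊕ g) h ⟩
    (f 0 ℤ.+ g 0) ℤ.* h 0               ≡⟨ ℤ.*-distribʳ-+ (h 0) (f 0) (g 0) ⟩
    f 0 ℤ.* h 0 ℤ.+ g 0 ℤ.* h 0         ≡⟨ cong₂ ℤ._+_ (⊛-zero f h) (⊛-zero g h) ⟨
    ((f ⊛ h) ⊕ (g ⊛ h)) 0               ∎
    where open ≡-Reasoning
  ⊛-distribʳ h f g (suc n) = begin
    ((f ⊕ g) ⊛ h) (suc n)
      ≡⟨ ⊛-suc (f ⊕ g) h n ⟩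
    (f 0 ℤ.+ g 0) ℤ.* h (suc n) ℤ.+ ((tail f ⊕ tail g) ⊛ h) n
      ≡⟨ cong₂ ℤ._+_ (ℤ.*-distribʳ-+ (h (suc n)) (f 0) (g 0)) (⊛-distribʳ h (tail f) (tail g) n) ⟩
    (f 0 ℤ.* h (suc n) ℤ.+ g 0 ℤ.* h (suc n)) ℤ.+ ((tail f ⊛ h) n ℤ.+ (tail g ⊛ h) n)
      ≡⟨ interchange (f 0 ℤ.* h (suc n)) (g 0 ℤ.* h (suc n)) ((tail f ⊛ h) n) ((tail g ⊛ h) n) ⟩
    (f 0 ℤ.* h (suc n) ℤ.+ (tail f ⊛ h) n) ℤ.+ (g 0 ℤ.* h (suc n) ℤ.+ (tail g ⊛ h) n)
      ≡⟨ cong₂ ℤ._+_ (⊛-suc f h n) (⊛-suc g h n) ⟨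
    ((f ⊛ h) ⊕ (g ⊛ h)) (suc n) ∎
    where open ≡-Reasoning

  -- The mirror image of `⊛-suc`; commutativity comes from playing the two recursions against each
  -- other.
  ⊛-sucʳ : ∀ f g n → (f ⊛ g) (suc n) ≡ (f ⊛ tail g) n ℤ.+ f (suc n) ℤ.* g 0
  ⊛-sucʳ f g zero = begin
    (f ⊛ g) 1                                 ≡⟨ ⊛-suc f g 0 ⟩
    f 0 ℤ.* g 1 ℤ.+ (tail f ⊛ g) 0            ≡⟨ cong₂ ℤ._+_ (sym (⊛-zero f (tail g))) (⊛-zero (tail f) g) ⟩
    (f ⊛ tail g) 0 ℤ.+ f 1 ℤ.* g 0            ∎
    where open ≡-Reasoning
  ⊛-sucʳ f g (suc n) = begin
    (f ⊛ g) (suc (suc n))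
      ≡⟨ ⊛-suc f g (suc n) ⟩
    f 0 ℤ.* g (suc (suc n)) ℤ.+ (tail f ⊛ g) (suc n)
      ≡⟨ cong (λ t → f 0 ℤ.* g (suc (suc n)) ℤ.+ t) (⊛-sucʳ (tail f) g n) ⟩
    f 0 ℤ.* g (suc (suc n)) ℤ.+ ((tail f ⊛ tail g) n ℤ.+ f (suc (suc n)) ℤ.* g 0)
      ≡⟨ ℤ.+-assoc (f 0 ℤ.* g (suc (suc n))) _ _ ⟨
    f 0 ℤ.* g (suc (suc n)) ℤ.+ (tail f ⊛ tail g) n ℤ.+ f (suc (suc n)) ℤ.* g 0
      ≡⟨ cong (ℤ._+ f (suc (suc n)) ℤ.* g 0) (⊛-suc f (tail g) n) ⟨
    (f ⊛ tail g) (suc n) ℤ.+ f (suc (suc n)) ℤ.* g 0 ∎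
    where open ≡-Reasoning

  ⊛-comm : ∀ f g → f ⊛ g ≈ g ⊛ f
  ⊛-comm f g zero    = cong (ℤ._+ 0ℤ) (ℤ.*-comm (f 0) (g 0))
  ⊛-comm f g (suc n) = begin
    (f ⊛ g) (suc n)                          ≡⟨ ⊛-suc f g n ⟩
    f 0 ℤ.* g (suc n) ℤ.+ (tail f ⊛ g) n     ≡⟨ ℤ.+-comm (f 0 ℤ.* g (suc n)) _ ⟩
    (tail f ⊛ g) n ℤ.+ f 0 ℤ.* g (suc n)     ≡⟨ cong₂ ℤ._+_ (⊛-comm (tail f) g n) (ℤ.*-comm (f 0) (g (suc n))) ⟩
    (g ⊛ tail f) n ℤ.+ g (suc n) ℤ.* f 0     ≡⟨ ⊛-sucʳ g f n ⟨
    (g ⊛ f) (suc n)                          ∎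
    where open ≡-Reasoning

  scalar-⊛ : ∀ c f g → scalar c f ⊛ g ≈ scalar c (f ⊛ g)
  scalar-⊛ c f g zero = begin
    (scalar c f ⊛ g) 0        ≡⟨ ⊛-zero (scalar c f) g ⟩
    c ℤ.* f 0 ℤ.* g 0         ≡⟨ ℤ.*-assoc c (f 0) (g 0) ⟩
    c ℤ.* (f 0 ℤ.* g 0)       ≡⟨ cong (λ t → c ℤ.* t) (⊛-zero f g) ⟨
    scalar c (f ⊛ g) 0        ∎
    where open ≡-Reasoning
  scalar-⊛ c f g (suc n) = begin
    (scalar c f ⊛ g) (suc n)
      ≡⟨ ⊛-suc (scalar c f) g n ⟩
    c ℤ.* f 0 ℤ.* g (suc n) ℤ.+ (scalar c (tail f) ⊛ g) n
      ≡⟨ cong₂ ℤ._+_ (ℤ.*-assoc c (f 0) (g (suc n))) (scalar-⊛ c (tail f) g n) ⟩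
    c ℤ.* (f 0 ℤ.* g (suc n)) ℤ.+ c ℤ.* (tail f ⊛ g) n
      ≡⟨ ℤ.*-distribˡ-+ c _ _ ⟨
    c ℤ.* (f 0 ℤ.* g (suc n) ℤ.+ (tail f ⊛ g) n)
      ≡⟨ cong (λ t → c ℤ.* t) (⊛-suc f g n) ⟨
    scalar c (f ⊛ g) (suc n) ∎
    where open ≡-Reasoning

  ⊛-assoc : ∀ f g h → (f ⊛ g) ⊛ h ≈ f ⊛ (g ⊛ h)
  ⊛-assoc f g h zero = begin
    ((f ⊛ g) ⊛ h) 0            ≡⟨ ⊛-zero (f ⊛ g) h ⟩
    (f ⊛ g) 0 ℤ.* h 0          ≡⟨ cong (ℤ._* h 0) (⊛-zero f g) ⟩
    f 0 ℤ.* g 0 ℤ.* h 0        ≡⟨ ℤ.*-assoc (f 0) (g 0) (h 0) ⟩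
    f 0 ℤ.* (g 0 ℤ.* h 0)      ≡⟨ cong (λ t → f 0 ℤ.* t) (⊛-zero g h) ⟨
    f 0 ℤ.* (g ⊛ h) 0          ≡⟨ ⊛-zero f (g ⊛ h) ⟨
    (f ⊛ (g ⊛ h)) 0            ∎
    where open ≡-Reasoning
  ⊛-assoc f g h (suc n) = begin
    ((f ⊛ g) ⊛ h) (suc n)
      ≡⟨ ⊛-suc (f ⊛ g) h n ⟩
    (f ⊛ g) 0 ℤ.* h (suc n) ℤ.+ (tail (f ⊛ g) ⊛ h) n
      ≡⟨ cong₂ ℤ._+_
           (trans (cong (ℤ._* h (suc n)) (⊛-zero f g)) (ℤ.*-assoc (f 0) (g 0) (h (suc n))))
           (trans (⊛-cong {g = h} (⊛-suc f g) (λ _ → refl) n) (⊛-distribʳ h (scalar (f 0) (tail g)) (tail f ⊛ g) n)) ⟩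
    f 0 ℤ.* (g 0 ℤ.* h (suc n)) ℤ.+ ((scalar (f 0) (tail g) ⊛ h) n ℤ.+ ((tail f ⊛ g) ⊛ h) n)
      ≡⟨ cong (λ t → f 0 ℤ.* (g 0 ℤ.* h (suc n)) ℤ.+ t)
           (cong₂ ℤ._+_ (scalar-⊛ (f 0) (tail g) h n) (⊛-assoc (tail f) g h n)) ⟩
    f 0 ℤ.* (g 0 ℤ.* h (suc n)) ℤ.+ (f 0 ℤ.* (tail g ⊛ h) n ℤ.+ (tail f ⊛ (g ⊛ h)) n)
      ≡⟨ ℤ.+-assoc (f 0 ℤ.* (g 0 ℤ.* h (suc n))) _ _ ⟨
    f 0 ℤ.* (g 0 ℤ.* h (suc n)) ℤ.+ f 0 ℤ.* (tail g ⊛ h) n ℤ.+ (tail f ⊛ (g ⊛ h)) n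
      ≡⟨ cong (ℤ._+ (tail f ⊛ (g ⊛ h)) n) (ℤ.*-distribˡ-+ (f 0) (g 0 ℤ.* h (suc n)) ((tail g ⊛ h) n)) ⟨
    f 0 ℤ.* (g 0 ℤ.* h (suc n) ℤ.+ (tail g ⊛ h) n) ℤ.+ (tail f ⊛ (g ⊛ h)) n
      ≡⟨ cong (λ t → f 0 ℤ.* t ℤ.+ (tail f ⊛ (g ⊛ h)) n) (⊛-suc g h n) ⟨
    f 0 ℤ.* (g ⊛ h) (suc n) ℤ.+ (tail f ⊛ (g ⊛ h)) n
      ≡⟨ ⊛-suc f (g ⊛ h) n ⟨
    (f ⊛ (g ⊛ h)) (suc n) ∎
    where open ≡-Reasoning

  ⊛-zeroˡ : ∀ g → 0ˢ ⊛ g ≈ 0ˢ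
  ⊛-zeroˡ g zero    = refl
  ⊛-zeroˡ g (suc n) = trans (⊛-suc 0ˢ g n) (trans (ℤ.+-identityˡ _) (⊛-zeroˡ g n))

  constant-⊛ : ∀ c g → constant-series c ⊛ g ≈ scalar c g
  constant-⊛ c g zero    = ℤ.+-identityʳ _
  constant-⊛ c g (suc n) = trans (⊛-suc (constant-series c) g n)
    (trans (cong (λ t → c ℤ.* g (suc n) ℤ.+ t) (⊛-zeroˡ g n)) (ℤ.+-identityʳ _))

  X-⊛-suc : ∀ f n → (X ⊛ f) (suc n) ≡ f n
  X-⊛-suc f n = begin
    (X ⊛ f) (suc n)                       ≡⟨ ⊛-suc X f n ⟩
    0ℤ ℤ.* f (suc n) ℤ.+ (tail X ⊛ f) n   ≡⟨ ℤ.+-identityˡ _ ⟩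
    (tail X ⊛ f) n                        ≡⟨ constant-⊛ 1ℤ f n ⟩
    1ℤ ℤ.* f n                            ≡⟨ ℤ.*-identityˡ (f n) ⟩
    f n                                   ∎
    where open ≡-Reasoning

  ⊛-distribˡ : ∀ h f g → h ⊛ (f ⊕ g) ≈ (h ⊛ f) ⊕ (h ⊛ g)
  ⊛-distribˡ h f g n = begin
    (h ⊛ (f ⊕ g)) n                ≡⟨ ⊛-comm h (f ⊕ g) n ⟩
    ((f ⊕ g) ⊛ h) n                ≡⟨ ⊛-distribʳ h f g n ⟩
    (f ⊛ h) n ℤ.+ (g ⊛ h) n        ≡⟨ cong₂ ℤ._+_ (⊛-comm f h n) (⊛-comm g h n) ⟩
    ((h ⊛ f) ⊕ (h ⊛ g)) n          ∎
    where open ≡-Reasoning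

  ⊛-identityˡ : ∀ g → constant-series 1ℤ ⊛ g ≈ g
  ⊛-identityˡ g n = trans (constant-⊛ 1ℤ g n) (ℤ.*-identityˡ (g n))

  series-ring : CommutativeRing _ _
  series-ring = record
    { Carrier = Series ; _≈_ = _≈_ ; _+_ = _⊕_ ; _*_ = _⊛_ ; -_ = ⊖_
    ; 0# = 0ˢ ; 1# = constant-series 1ℤ
    ; isCommutativeRing = record
      { isRing = record
        { +-isAbelianGroup = record
          { isGroup = record
            { isMonoid = record
              { isSemigroup = record
                { isMagma = record
                  { isEquivalence = record
                    { refl = λ _ → refl ; sym = λ p n → sym (p n) ; trans = λ p q n → trans (p n) (q n) }
                  ; ∙-cong = λ p q n → cong₂ ℤ._+_ (p n) (q n) }
                ; assoc = λ f g h n → ℤ.+-assoc (f n) (g n) (h n) }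
              ; identity = (λ f n → ℤ.+-identityˡ (f n)) , (λ f n → ℤ.+-identityʳ (f n)) }
            ; inverse = (λ f n → ℤ.+-inverseˡ (f n)) , (λ f n → ℤ.+-inverseʳ (f n))
            ; ⁻¹-cong = λ p n → cong ℤ.-_ (p n) }
          ; comm = λ f g n → ℤ.+-comm (f n) (g n) }
        ; *-cong = ⊛-cong
        ; *-assoc = ⊛-assoc
        ; *-identity = ⊛-identityˡ , λ g n → trans (⊛-comm g (constant-series 1ℤ) n) (⊛-identityˡ g n)
        ; distrib = ⊛-distribˡ , ⊛-distribʳ }
      ; *-comm = ⊛-comm } }

  constant-0 : constant-series 0ℤ ≈ 0ˢ
  constant-0 zero    = refl
  constant-0 (suc n) = refl

  constant-+ : ∀ a b → constant-series (a ℤ.+ b) ≈ constant-series a ⊕ constant-series b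
  constant-+ a b zero    = refl
  constant-+ a b (suc n) = refl

  constant-* : ∀ a b → constant-series (a ℤ.* b) ≈ constant-series a ⊛ constant-series b
  constant-* a b zero    = sym (ℤ.+-identityʳ _)
  constant-* a b (suc n) = sym (trans (constant-⊛ a (constant-series b) (suc n)) (ℤ.*-zeroʳ a))

  constant-neg : ∀ a → constant-series (ℤ.- a) ≈ ⊖ constant-series a
  constant-neg a zero    = refl
  constant-neg a (suc n) = refl

  constant-homomorphism : IsIntegerHomomorphism series-ring constant-series
  constant-homomorphism = record
    { ι-0 = constant-0 ; ι-1 = λ _ → refl ; ι-+ = constant-+ ; ι-* = constant-* ; ι-neg = constant-neg }

  open Evaluation series-ring constant-series constant-homomorphism public
  module SeriesConsequences = Consequences series-ring constant-series constant-homomorphism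

  evaluate-poly : ∀ cs (H : Series) → ⟦ polyExpr (var 0F) cs ⟧ (X ∷ H ∷ []) ≈ poly cs
  evaluate-poly []       H n       = constant-0 n
  evaluate-poly (c ∷ cs) H zero    = ℤ.+-identityʳ c
  evaluate-poly (c ∷ cs) H (suc n) =
    trans (ℤ.+-identityˡ _) (trans (X-⊛-suc (⟦ polyExpr (var 0F) cs ⟧ (X ∷ H ∷ [])) n) (evaluate-poly cs H n))

  evaluate-square : ∀ ps (H : Series) → ⟦ evalExpr (var 0F) (var 1F) ps ⟧ (X ∷ H ∷ []) ≈ evalInSquare ps H
  evaluate-square []       H n = constant-0 n
  evaluate-square (p ∷ ps) H n = cong₂ ℤ._+_ (evaluate-poly p H n)
    (⊛-cong {f = H ⊛ H} (λ _ → refl) (evaluate-square ps H) n)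

  infix 4 _≈[_]_
  -- Congruence modulo xⁿ.
  _≈[_]_ : Series → ℕ → Series → Set
  f ≈[ n ] g = ∀ m → m < n → f m ≡ g m

  ⊛-cong[] : ∀ {n f f′ g g′} → f ≈[ n ] f′ → g ≈[ n ] g′ → f ⊛ g ≈[ n ] f′ ⊛ g′
  ⊛-cong[] {n} {f} {f′} {g} {g′} p q zero    m<n = cong₂ (λ a b → a ℤ.* b ℤ.+ 0ℤ) (p 0 m<n) (q 0 m<n)
  ⊛-cong[] {suc n} {f} {f′} {g} {g′} p q (suc m) (s<s m<n) = begin
    (f ⊛ g) (suc m)                           ≡⟨ ⊛-suc f g m ⟩
    f 0 ℤ.* g (suc m) ℤ.+ (tail f ⊛ g) m
      ≡⟨ cong₂ ℤ._+_ (cong₂ ℤ._*_ (p 0 z<s) (q (suc m) (s<s m<n)))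
           (⊛-cong[] {n} (λ k k<n → p (suc k) (s<s k<n)) (λ k k<n → q k (ℕ.m<n⇒m<1+n k<n)) m m<n) ⟩
    f′ 0 ℤ.* g′ (suc m) ℤ.+ (tail f′ ⊛ g′) m  ≡⟨ ⊛-suc f′ g′ m ⟨
    (f′ ⊛ g′) (suc m)                         ∎
    where open ≡-Reasoning

  -- Multiplication by x gains one coefficient. Together with `⟦⟧-cong[]` this makes every map c + x
  -- · (polynomial) a contraction.
  X-cong[] : ∀ {n f g} → f ≈[ n ] g → X ⊛ f ≈[ suc n ] X ⊛ g
  X-cong[] p zero    _         = refl
  X-cong[] {n} {f} {g} p (suc m) (s<s m<n) = trans (X-⊛-suc f m) (trans (p m m<n) (sym (X-⊛-suc g m)))

  ⟦⟧-cong[] : ∀ {k n} (e : Expr k) {ρ ρ′} → (∀ i → lookup ρ i ≈[ n ] lookup ρ′ i) → ⟦ e ⟧ ρ ≈[ n ] ⟦ e ⟧ ρ′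
  ⟦⟧-cong[] (var i)  p m m<n = p i m m<n
  ⟦⟧-cong[] (con c)  p m m<n = refl
  ⟦⟧-cong[] (e :+ f) p m m<n = cong₂ ℤ._+_ (⟦⟧-cong[] e p m m<n) (⟦⟧-cong[] f p m m<n)
  ⟦⟧-cong[] (e :* f) p m m<n = ⊛-cong[] (⟦⟧-cong[] e p) (⟦⟧-cong[] f p) m m<n
  ⟦⟧-cong[] (:- e)   p m m<n = cong ℤ.-_ (⟦⟧-cong[] e p m m<n)

  -- Coefficients are cancelled from the lowest upwards: once those of g below m vanish, the
  -- coefficient m of the product is f₀ gₘ, and ℤ has no zero divisors.
  ⊛-cancelˡ : ∀ f g → f 0 ≢ 0ℤ → f ⊛ g ≈ 0ˢ → g ≈ 0ˢ
  ⊛-cancelˡ f g f₀≢0 fg≈0 n = go (suc n) n (ℕ.n<1+n n)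
    where
    open ≡-Reasoning
    cancel : ∀ a → f 0 ℤ.* a ≡ 0ℤ → a ≡ 0ℤ
    cancel a eq with ℤ.i*j≡0⇒i≡0∨j≡0 (f 0) eq
    ... | inj₁ f₀≡0 = contradiction f₀≡0 f₀≢0
    ... | inj₂ a≡0  = a≡0

    go : ∀ k → g ≈[ k ] 0ˢ
    go (suc k) zero    _ = cancel (g 0) (trans (sym (⊛-zero f g)) (fg≈0 0))
    go (suc k) (suc m) (s<s m<k) = cancel (g (suc m)) (begin
      f 0 ℤ.* g (suc m)                       ≡⟨ ℤ.+-identityʳ _ ⟨
      f 0 ℤ.* g (suc m) ℤ.+ 0ℤ
        ≡⟨ cong (λ t → f 0 ℤ.* g (suc m) ℤ.+ t) (begin
             (tail f ⊛ g) m
               ≡⟨ ⊛-cong[] {k} {tail f} {tail f} (λ _ _ → refl) (go k) m m<k ⟩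
             (tail f ⊛ 0ˢ) m ≡⟨ ⊛-comm (tail f) 0ˢ m ⟩
             (0ˢ ⊛ tail f) m ≡⟨ ⊛-zeroˡ (tail f) m ⟩
             0ℤ                      ∎) ⟨
      f 0 ℤ.* g (suc m) ℤ.+ (tail f ⊛ g) m    ≡⟨ ⊛-suc f g m ⟨
      (f ⊛ g) (suc m)                         ≡⟨ fg≈0 (suc m) ⟩
      0ℤ                                      ∎)

  X-cancelˡ : ∀ f g → f ≈ X → f ⊛ g ≈ 0ˢ → g ≈ 0ˢ
  X-cancelˡ f g x eq n =
    trans (sym (X-⊛-suc g n)) (trans (sym (⊛-cong {g = g} x (λ _ → refl) (suc n))) (eq (suc n)))

  -- Stated for expressions, so that applying them never unfolds a convolution.
  Zero : ∀ {n} → Expr n → Vec Series n → Set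
  Zero e ρ = ⟦ e ⟧ ρ ≈ 0ˢ

  cancel-factor : ∀ {n} (e f : Expr n) ρ → ⟦ e ⟧ ρ 0 ≢ 0ℤ → Zero (e :* f) ρ → Zero f ρ
  cancel-factor e f ρ = ⊛-cancelˡ (⟦ e ⟧ ρ) (⟦ f ⟧ ρ)

  reassociate : ∀ {n} (e f g : Expr n) ρ → Zero (e :* f :* g) ρ → Zero (e :* (f :* g)) ρ
  reassociate e f g ρ z m = trans (sym (⊛-assoc (⟦ e ⟧ ρ) (⟦ f ⟧ ρ) (⟦ g ⟧ ρ) m)) (z m)

  cancel-power : ∀ k {n} (i : Fin n) (f : Expr n) ρ → lookup ρ i ≈ X → Zero (var i :^ k :* f) ρ → Zero f ρ
  cancel-power zero          i f ρ x z n = trans (sym (⊛-identityˡ (⟦ f ⟧ ρ) n)) (z n)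
  cancel-power (suc zero)    i f ρ x z   = X-cancelˡ (lookup ρ i) (⟦ f ⟧ ρ) x z
  cancel-power (suc (suc k)) i f ρ x z   = cancel-power (suc k) i f ρ x
    (X-cancelˡ (lookup ρ i) (⟦ var i :^ suc k :* f ⟧ ρ) x (reassociate (var i) (var i :^ suc k) f ρ z))

  evalInSquare-cong : ∀ ps {f g} → f ≈ g → evalInSquare ps f ≈ evalInSquare ps g
  evalInSquare-cong []       f≈g n = refl
  evalInSquare-cong (p ∷ ps) f≈g n = cong (λ t → poly p n ℤ.+ t)
    (⊛-cong (⊛-cong f≈g f≈g) (evalInSquare-cong ps f≈g) n)

  evalInSquare-zero : ∀ ps {f g} → f ≈ g → evalInSquare ps g ≈ 0ˢ → evalInSquare ps f ≈ 0ˢ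
  evalInSquare-zero ps f≈g zero-g n = trans (evalInSquare-cong ps f≈g n) (zero-g n)

-- The transfer operator and its iterates

module Transfer where
  open import Data.Nat.Base using (ℕ; zero; suc)
  open import Relation.Binary.PropositionalEquality

  -- The closed recursive form of H ↦ Σ H(new state) over all ways of prepending one shrub to a word
  -- in state k.
  module Operator {a} {A : Set a} (_+_ : A → A → A) (0# : A) where
    ψ Ψ φ : (ℕ → A) → ℕ → A
    ψ H zero    = H 1
    ψ H (suc k) = ψ H k + H (suc (suc k))
    Ψ H zero    = 0#
    Ψ H (suc k) = Ψ H k + ψ H (suc k)
    φ H zero    = H 3 + H 2
    φ H (suc k) = φ H k + ((H (suc (suc (suc (suc k)))) + H (suc (suc (suc k)))) + Ψ H (suc k))

  -- Built from sums alone, the three operators commute with every additive map. The instances are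
  -- the embeddings of ℕ into ℤ and ℚ and multiplication by a scalar.
  module Homomorphism {a b} {A : Set a} {B : Set b}
    (_+_ : A → A → A) (0# : A) (_+′_ : B → B → B) (0#′ : B)
    (f : A → B) (f-+ : ∀ x y → f (x + y) ≡ f x +′ f y) (f-0 : f 0# ≡ 0#′)
    where
    private
      module A = Operator _+_ 0#
      module B = Operator _+′_ 0#′

    ψ-homo : ∀ H k → f (A.ψ H k) ≡ B.ψ (λ i → f (H i)) k
    ψ-homo H zero    = refl
    ψ-homo H (suc k) = trans (f-+ _ _) (cong (_+′ _) (ψ-homo H k))

    Ψ-homo : ∀ H k → f (A.Ψ H k) ≡ B.Ψ (λ i → f (H i)) k
    Ψ-homo H zero    = f-0
    Ψ-homo H (suc k) = trans (f-+ _ _) (cong₂ _+′_ (Ψ-homo H k) (ψ-homo H (suc k)))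

    φ-homo : ∀ H k → f (A.φ H k) ≡ B.φ (λ i → f (H i)) k
    φ-homo H zero    = f-+ _ _
    φ-homo H (suc k) = trans (f-+ _ _)
      (cong₂ _+′_ (φ-homo H k) (trans (f-+ _ _) (cong₂ _+′_ (f-+ _ _) (Ψ-homo H (suc k)))))

module Counting where
  open import Data.Nat.Base as ℕ using (ℕ; zero; suc)
  open Transfer

  open Operator ℕ._+_ 0 public

  -- count n k is the number of ways of prepending n shrubs to a word in state k.
  count : ℕ → ℕ → ℕ
  count zero    k = 1
  count (suc n) k = φ (count n) k

-- The algebraic equation of the generating function

module Algebraicity where
  open import Data.Fin.Base using (Fin; zero; suc)
  open import Data.Fin.Patterns
  open import Data.Integer.Base as ℤ using (ℤ; +_; -[1+_]; 0ℤ; 1ℤ)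
  import Data.Integer.Properties as ℤ
  open import Data.Integer.Tactic.RingSolver using (solve-∀)
  open import Data.List.Base using (List; []; _∷_)
  open import Data.List.Relation.Unary.All using (All; []; _∷_)
  open import Data.Nat.Base as ℕ using (ℕ; zero; suc)
  import Data.Nat.Properties as ℕ
  open import Data.Product using (_,_)
  open import Data.Vec.Base using (Vec; []; _∷_; lookup)
  open import Defs
  open import Relation.Binary.PropositionalEquality
  open PolySolver
  open Elimination hiding (module Consequences)
  open PowerSeries
  open Transfer
  open Counting using (count)

  open SeriesConsequences using (Vanishes; algebraic; determinant)

  factorisation : List (Expr 4)
  factorisation = F.factor₀ ∷ F.factor₁ ∷ F.factor₂ ∷ []
    where
    module F = Factorisation (var 0F) (var 1F) (var 2F) (var 3F)

  -- Comparing the coefficients of z⁵, z⁴ and z³ in P Q defines r₂, r₁ and r₀. Those of 1, z and z²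
  -- remain as equations pᵢ = constant + x · (polynomial), which contract x-adically; the constants
  -- make P equal to (z - 1)³ at x = 0.
  module FixedPoint where
    private
      x p₀ p₁ p₂ : Expr 4
      x  = var 0F
      p₀ = var 1F
      p₁ = var 2F
      p₂ = var 3F
      module F = Factorisation x p₀ p₁ p₂

      constantPart : Fin 3 → ℤ
      constantPart 0F = -[1+ 0 ]
      constantPart 1F = + 3
      constantPart 2F = -[1+ 2 ]

      linearPart : Fin 3 → Expr 4
      linearPart 0F = p₀ :* F.r₀
      linearPart 1F = p₁ :* F.r₀ :+ p₀ :* F.r₁
      linearPart 2F = p₂ :* F.r₀ :+ p₁ :* F.r₁ :+ p₀ :* F.r₂

      env : (Fin 3 → Series) → Vec Series 4
      env p = X ∷ p 0F ∷ p 1F ∷ p 2F ∷ []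

      step : (Fin 3 → Series) → Fin 3 → Series
      step p i = constant-series (constantPart i) ⊕ X ⊛ ⟦ linearPart i ⟧ (env p)

      env-cong : ∀ {n p p′} → (∀ i → p i ≈[ n ] p′ i) → ∀ i → lookup (env p) i ≈[ n ] lookup (env p′) i
      env-cong e 0F m _   = refl
      env-cong e 1F = e 0F
      env-cong e 2F = e 1F
      env-cong e 3F = e 2F

      step-cong : ∀ {n p p′} → (∀ i → p i ≈[ n ] p′ i) → ∀ i → step p i ≈[ suc n ] step p′ i
      step-cong e i m m<1+n =
        cong (λ t → constant-series (constantPart i) m ℤ.+ t)
          (X-cong[] (⟦⟧-cong[] (linearPart i) (env-cong e)) m m<1+n)

      approx : ℕ → Fin 3 → Series
      approx zero    = λ _ _ → 0ℤ
      approx (suc k) = step (approx k)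

      approx-stable : ∀ k d i → approx k i ≈[ k ] approx (d ℕ.+ k) i
      approx-stable zero    d i m ()
      approx-stable (suc k) d i m m<1+k =
        trans (step-cong (approx-stable k d) i m m<1+k)
          (cong (λ t → approx t i m) (sym (ℕ.+-suc d k)))

    -- The first k coefficients are final after k iterations, so coefficient n is read from iterate
    -- n + 1.
    solution : Fin 3 → Series
    solution i n = approx (suc n) i n

    private
      solution-approx : ∀ k i → solution i ≈[ k ] approx k i
      solution-approx k i m m<k = trans (approx-stable (suc m) (k ℕ.∸ suc m) i m (ℕ.n<1+n m))
        (cong (λ t → approx t i m) (ℕ.m∸n+n≡m m<k))

    solution-step : ∀ i → solution i ≈ step solution i
    solution-step i n = sym (step-cong (solution-approx n) i n (ℕ.n<1+n n))

    solution-vanishes : All (Vanishes (X ∷ solution 0F ∷ solution 1F ∷ solution 2F ∷ [])) factorisation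
    solution-vanishes = cancel 0F ∷ cancel 1F ∷ cancel 2F ∷ []
      where
      cancel : ∀ i → (solution i ⊕ (⊖ step solution i)) ≈ 0ˢ
      cancel i n = trans (cong (ℤ._- step solution i n) (solution-step i n)) (ℤ.+-inverseʳ (step solution i n))

  open FixedPoint using (solution; solution-vanishes)

  open Operator ℤ._+_ 0ℤ using () renaming (ψ to ψᶻ; Ψ to Ψᶻ; φ to φᶻ)
  open Homomorphism ℕ._+_ 0 ℤ._+_ 0ℤ +_ ℤ.pos-+ refl using () renaming (φ-homo to φ-pos)

  series : ℕ → Series
  series k n = + count n k

  series-suc : ∀ k n → series k (suc n) ≡ φᶻ (λ i → series i n) k
  series-suc k n = φ-pos (count n) k

  -- The index is shifted by two: `extended k` is h with index k - 2.
  extended : ℕ → Series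
  extended 0             = constant-series 1ℤ ⊕ (⊖ (X ⊛ series 2))
  extended 1             = constant-series 1ℤ
  extended (suc (suc k)) = series k

  -- Differencing φ exposes Ψ, differencing Ψ exposes ψ, and differencing ψ leaves single values of
  -- H. These three differences are the origin of (1 - z)³.
  third-difference : ∀ H k →
    φᶻ H k ℤ.- (φᶻ H (1 ℕ.+ k) ℤ.+ φᶻ H (1 ℕ.+ k) ℤ.+ φᶻ H (1 ℕ.+ k))
    ℤ.+ (φᶻ H (2 ℕ.+ k) ℤ.+ φᶻ H (2 ℕ.+ k) ℤ.+ φᶻ H (2 ℕ.+ k)) ℤ.- φᶻ H (3 ℕ.+ k)
    ℤ.+ (H (3 ℕ.+ k) ℤ.- H (5 ℕ.+ k) ℤ.+ H (6 ℕ.+ k)) ≡ 0ℤ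
  third-difference H k = lemma (φᶻ H k) (H (3 ℕ.+ k)) (H (4 ℕ.+ k)) (H (5 ℕ.+ k)) (H (6 ℕ.+ k)) (Ψᶻ H (1 ℕ.+ k)) (ψᶻ H (2 ℕ.+ k))
    where
    lemma : ∀ f h₃ h₄ h₅ h₆ a b →
      let f₁ = f ℤ.+ ((h₄ ℤ.+ h₃) ℤ.+ a)
          f₂ = f₁ ℤ.+ ((h₅ ℤ.+ h₄) ℤ.+ (a ℤ.+ b))
          f₃ = f₂ ℤ.+ ((h₆ ℤ.+ h₅) ℤ.+ ((a ℤ.+ b) ℤ.+ (b ℤ.+ h₄)))
      in f ℤ.- (f₁ ℤ.+ f₁ ℤ.+ f₁) ℤ.+ (f₂ ℤ.+ f₂ ℤ.+ f₂) ℤ.- f₃ ℤ.+ (h₃ ℤ.- h₅ ℤ.+ h₆) ≡ 0ℤ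
    lemma = solve-∀

  module _ {n} (x g₀ g₁ g₂ g₃ g₅ g₆ : Expr n) where
    -- Triples are written as sums because sums are coefficientwise by definition, whereas a numeral
    -- factor would evaluate to a convolution.
    sixth-order : Expr n
    sixth-order = g₀ :- (g₁ :+ g₁ :+ g₁) :+ (g₂ :+ g₂ :+ g₂) :- g₃ :+ x :* (g₃ :- g₅ :+ g₆)

  private
    sixth-order-cong : ∀ {a a′ b b′ c c′ d d′ e e′ : ℤ} → a ≡ a′ → b ≡ b′ → c ≡ c′ → d ≡ d′ → e ≡ e′ →
      a ℤ.- (b ℤ.+ b ℤ.+ b) ℤ.+ (c ℤ.+ c ℤ.+ c) ℤ.- d ℤ.+ e
        ≡ a′ ℤ.- (b′ ℤ.+ b′ ℤ.+ b′) ℤ.+ (c′ ℤ.+ c′ ℤ.+ c′) ℤ.- d′ ℤ.+ e′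
    sixth-order-cong refl refl refl refl refl = refl

  sixth-order-vanishes : ∀ k →
    ⟦ sixth-order (var 0F) (var 1F) (var 2F) (var 3F) (var 4F) (var 5F) (var 6F) ⟧
      (X ∷ extended k ∷ extended (1 ℕ.+ k) ∷ extended (2 ℕ.+ k) ∷ extended (3 ℕ.+ k)
         ∷ extended (5 ℕ.+ k) ∷ extended (6 ℕ.+ k) ∷ []) ≈ 0ˢ
  -- All constant terms are 1, and 1 - 3 + 3 - 1 = 0.
  sixth-order-vanishes 0 zero    = refl
  sixth-order-vanishes 0 (suc n)
    = trans
        (sixth-order-cong (cong (λ t → 0ℤ ℤ.- t) (X-⊛-suc (series 2) n)) (refl {x = 0ℤ}) (series-suc 0 n) (series-suc 1 n)
          (X-⊛-suc (series 1 ⊕ (⊖ series 3) ⊕ series 4) n))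
        (lemma (series 1 n) (series 2 n) (series 3 n) (series 4 n))
    where
    lemma : ∀ h₁ h₂ h₃ h₄ →
      let f₀ = h₃ ℤ.+ h₂
          f₁ = f₀ ℤ.+ ((h₄ ℤ.+ h₃) ℤ.+ (0ℤ ℤ.+ (h₁ ℤ.+ h₂)))
      in 0ℤ ℤ.- h₂ ℤ.- 0ℤ ℤ.+ (f₀ ℤ.+ f₀ ℤ.+ f₀) ℤ.- f₁ ℤ.+ (h₁ ℤ.- h₃ ℤ.+ h₄) ≡ 0ℤ
    lemma = solve-∀
  sixth-order-vanishes 1 zero    = refl
  sixth-order-vanishes 1 (suc n)
    = trans
        (sixth-order-cong (refl {x = 0ℤ}) (series-suc 0 n) (series-suc 1 n) (series-suc 2 n)
          (X-⊛-suc (series 2 ⊕ (⊖ series 4) ⊕ series 5) n))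
        (lemma (series 1 n) (series 2 n) (series 3 n) (series 4 n) (series 5 n))
    where
    lemma : ∀ h₁ h₂ h₃ h₄ h₅ →
      let f₀ = h₃ ℤ.+ h₂
          f₁ = f₀ ℤ.+ ((h₄ ℤ.+ h₃) ℤ.+ (0ℤ ℤ.+ (h₁ ℤ.+ h₂)))
          f₂ = f₁ ℤ.+ ((h₅ ℤ.+ h₄) ℤ.+ (0ℤ ℤ.+ (h₁ ℤ.+ h₂) ℤ.+ (h₁ ℤ.+ h₂ ℤ.+ h₃)))
      in 0ℤ ℤ.- (f₀ ℤ.+ f₀ ℤ.+ f₀) ℤ.+ (f₁ ℤ.+ f₁ ℤ.+ f₁) ℤ.- f₂ ℤ.+ (h₂ ℤ.- h₄ ℤ.+ h₅) ≡ 0ℤ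
    lemma = solve-∀
  sixth-order-vanishes (suc (suc k)) zero    = refl
  sixth-order-vanishes (suc (suc k)) (suc n)
    = trans
        (sixth-order-cong (series-suc k n) (series-suc (1 ℕ.+ k) n) (series-suc (2 ℕ.+ k) n) (series-suc (3 ℕ.+ k) n)
          (X-⊛-suc (series (3 ℕ.+ k) ⊕ (⊖ series (5 ℕ.+ k)) ⊕ series (6 ℕ.+ k)) n))
        (third-difference (λ i → series i n) k)

  module Residual (P₀ P₁ P₂ : Series)
    (factors : All (Vanishes (X ∷ P₀ ∷ P₁ ∷ P₂ ∷ [])) factorisation)
    (g : ℕ → Series)
    (sixth : ∀ k → ⟦ sixth-order (var 0F) (var 1F) (var 2F) (var 3F) (var 4F) (var 5F) (var 6F) ⟧
      (X ∷ g k ∷ g (1 ℕ.+ k) ∷ g (2 ℕ.+ k) ∷ g (3 ℕ.+ k) ∷ g (5 ℕ.+ k) ∷ g (6 ℕ.+ k) ∷ []) ≈ 0ˢ)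
    where
    residual : ℕ → Series
    residual k = g (3 ℕ.+ k) ⊕ P₂ ⊛ g (2 ℕ.+ k) ⊕ P₁ ⊛ g (1 ℕ.+ k) ⊕ P₀ ⊛ g k

    private
      x p₀ p₁ p₂ g₀ g₁ g₂ g₃ g₄ g₅ g₆ : Expr 11
      x  = var 0F
      p₀ = var 1F
      p₁ = var 2F
      p₂ = var 3F
      g₀ = var 4F
      g₁ = var 5F
      g₂ = var 6F
      g₃ = var 7F
      g₄ = var 8F
      g₅ = var 9F
      g₆ = var (suc 9F)
      module F = Factorisation x p₀ p₁ p₂

      ρ : ℕ → Vec Series 11
      ρ k = X ∷ P₀ ∷ P₁ ∷ P₂ ∷ g k ∷ g (1 ℕ.+ k) ∷ g (2 ℕ.+ k) ∷ g (3 ℕ.+ k)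
        ∷ g (4 ℕ.+ k) ∷ g (5 ℕ.+ k) ∷ g (6 ℕ.+ k) ∷ []

      e : Expr 11 → Expr 11 → Expr 11 → Expr 11 → Expr 11
      e a b c d = d :+ p₂ :* c :+ p₁ :* b :+ p₀ :* a

      e₀ e₁ e₂ e₃ tails : Expr 11
      e₀ = e g₀ g₁ g₂ g₃
      e₁ = e g₁ g₂ g₃ g₄
      e₂ = e g₂ g₃ g₄ g₅
      e₃ = e g₃ g₄ g₅ g₆
      tails = e₃ :+ F.r₂ :* e₂ :+ F.r₁ :* e₁ :+ F.r₀ :* e₀

      cofactor-recurrence : ∀ k → ⟦ x :* tails :- e₀ ⟧ (ρ k) ≈ 0ˢ
      cofactor-recurrence k = from factors
        where
        from : All (Vanishes (X ∷ P₀ ∷ P₁ ∷ P₂ ∷ [])) factorisation → ⟦ x :* tails :- e₀ ⟧ (ρ k) ≈ 0ˢ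
        from (f₀ ∷ f₁ ∷ f₂ ∷ []) =
          consequence (x :* tails :- e₀)
            ((con 1ℤ , sixth-order x g₀ g₁ g₂ g₃ g₅ g₆)
              ∷ (:- g₀ , F.factor₀) ∷ (:- g₁ , F.factor₁) ∷ (:- g₂ , F.factor₂) ∷ [])
            refl (ρ k) (sixth k ∷ f₀ ∷ f₁ ∷ f₂ ∷ [])

      tail-expr : Expr 7
      tail-expr = var 3F :+ R.r₂ :* var 2F :+ R.r₁ :* var 1F :+ R.r₀ :* var 0F
        where module R = Factorisation (con 0ℤ) (var 4F) (var 5F) (var 6F)

      residuals : ℕ → Vec Series 7
      residuals k = residual k ∷ residual (1 ℕ.+ k) ∷ residual (2 ℕ.+ k) ∷ residual (3 ℕ.+ k) ∷ P₀ ∷ P₁ ∷ P₂ ∷ []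

      zeros : Vec Series 7
      zeros = 0ˢ ∷ 0ˢ ∷ 0ˢ ∷ 0ˢ ∷ P₀ ∷ P₁ ∷ P₂ ∷ []

      residual≈X : ∀ k → residual k ≈
        X ⊛ ⟦ tail-expr ⟧ (residuals k)
      residual≈X k n = sym (ℤ.i-j≡0⇒i≡j _ _ (cofactor-recurrence k n))

      tail-zero : ∀ n → ⟦ tail-expr ⟧ zeros n ≡ 0ℤ
      tail-zero n = trans
        (sym (⟦⟧-cong[] {n = suc n} tail-expr {λ₀} {zeros} same n (ℕ.n<1+n n)))
        (identity substituted (con 0ℤ) refl (P₀ ∷ P₁ ∷ P₂ ∷ []) n ▹ constant-0 n)
        where
        infixl 4 _▹_
        _▹_ = trans {A = ℤ}
        λ₀ : Vec Series 7
        λ₀ = constant-series 0ℤ ∷ constant-series 0ℤ ∷ constant-series 0ℤ ∷ constant-series 0ℤ ∷ P₀ ∷ P₁ ∷ P₂ ∷ []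
        same : ∀ i → lookup λ₀ i ≈[ suc n ] lookup zeros i
        same 0F m _ = constant-0 m
        same 1F m _ = constant-0 m
        same 2F m _ = constant-0 m
        same 3F m _ = constant-0 m
        same 4F m _ = refl
        same 5F m _ = refl
        same 6F m _ = refl
        substituted : Expr 3
        substituted = con 0ℤ :+ R.r₂ :* con 0ℤ :+ R.r₁ :* con 0ℤ :+ R.r₀ :* con 0ℤ
          where module R = Factorisation (con 0ℤ) (var 0F) (var 1F) (var 2F)

    -- With E the shift, `residual` is P(E) applied to g, and Q(E) annihilates it. Since Q = x(z³ +
    -- r₂z² + r₁z + r₀) - 1, each residual is x times a combination of residuals, hence divisible by
    -- every power of x.
    residual-vanishes : ∀ k → residual k ≈ 0ˢ
    residual-vanishes k n = go (suc n) k n (ℕ.n<1+n n)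
      where
      go : ∀ m k → residual k ≈[ m ] 0ˢ
      go zero    k n ()
      go (suc m) k n n<1+m = begin
        residual k n                              ≡⟨ residual≈X k n ⟩
        (X ⊛ ⟦ tail-expr ⟧ (residuals k)) n
          ≡⟨ X-cong[] {m} {⟦ tail-expr ⟧ (residuals k)} {0ˢ} (λ i i<m → trans (⟦⟧-cong[] tail-expr {residuals k} {zeros} all-zero i i<m) (tail-zero i)) n n<1+m ⟩
        (X ⊛ 0ˢ) n                        ≡⟨ ⊛-comm X 0ˢ n ⟩
        (0ˢ ⊛ X) n                        ≡⟨ ⊛-zeroˡ X n ⟩
        0ℤ                                        ∎
        where
        open ≡-Reasoning
        all-zero : ∀ i → lookup (residuals k) i
          ≈[ m ] lookup zeros i
        all-zero 0F = go m k
        all-zero 1F = go m (1 ℕ.+ k)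
        all-zero 2F = go m (2 ℕ.+ k)
        all-zero 3F = go m (3 ℕ.+ k)
        all-zero 4F _ _ = refl
        all-zero 5F _ _ = refl
        all-zero 6F _ _ = refl

  module Conclusion (P₀ P₁ P₂ : Series)
    (factors : All (Vanishes (X ∷ P₀ ∷ P₁ ∷ P₂ ∷ [])) factorisation)
    where
    open Residual P₀ P₁ P₂ factors extended sixth-order-vanishes using (residual-vanishes)

    boundary-vanishes : series 0 ⊕ (⊖ (constant-series 1ℤ ⊕ X ⊛ (series 2 ⊕ series 3))) ≈ 0ˢ
    boundary-vanishes zero    = refl
    boundary-vanishes (suc n) =
      trans (cong₂ (λ a b → a ℤ.- (0ℤ ℤ.+ b)) (series-suc 0 n) (X-⊛-suc (series 2 ⊕ series 3) n))
        (lemma (series 2 n) (series 3 n))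
      where
      lemma : ∀ a b → b ℤ.+ a ℤ.- (0ℤ ℤ.+ (a ℤ.+ b)) ≡ 0ℤ
      lemma = solve-∀

    det : Series
    det = determinant X P₀ P₁ P₂ (series 0) (series 1) (series 2) (series 3)

    relation : det 0 ≢ 0ℤ →
      ⟦ # 36864 :* var 0F :^ 10 :* evalExpr (var 0F) (var 1F) theorem18-coeffs ⟧ (X ∷ series 0 ∷ []) ≈ 0ˢ
    relation det₀≢0 =
      algebraic X P₀ P₁ P₂ (series 0) (series 1) (series 2) (series 3)
        (regroup factors)
        (residual-vanishes 0 ∷ residual-vanishes 1 ∷ residual-vanishes 2 ∷ boundary-vanishes ∷ [])
        (λ y → ⊛-cancelˡ det y det₀≢0)
      where
      module F′ = Factorisation {8} (var 0F) (var 1F) (var 2F) (var 3F)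
      regroup : All (Vanishes (X ∷ P₀ ∷ P₁ ∷ P₂ ∷ [])) factorisation →
        All (Vanishes (X ∷ P₀ ∷ P₁ ∷ P₂ ∷ series 0 ∷ series 1 ∷ series 2 ∷ series 3 ∷ []))
          (F′.factor₀ ∷ F′.factor₁ ∷ F′.factor₂ ∷ [])
      regroup (f₀ ∷ f₁ ∷ f₂ ∷ []) = f₀ ∷ f₁ ∷ f₂ ∷ []

  open Conclusion (solution 0F) (solution 1F) (solution 2F) solution-vanishes

  private
    -- The determinant of the four linear relations carries the extra factor 36864 x¹⁰ with 36864 =
    -- 2¹² · 3²; neither part is a zero divisor in ℤ[[x]].
    unscale : ∀ ps H → Zero (# 36864 :* var 0F :^ 10 :* evalExpr (var 0F) (var 1F) ps) (X ∷ H ∷ []) →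
      evalInSquare ps H ≈ 0ˢ
    unscale ps H z n = trans (sym (evaluate-square ps H n)) (cancelled n)
      where
      e : Expr 2
      e = evalExpr (var 0F) (var 1F) ps
      cancelled : Zero e (X ∷ H ∷ [])
      cancelled = cancel-power 10 0F e _ (λ _ → refl)
        (cancel-factor (# 36864) (var 0F :^ 10 :* e) (X ∷ H ∷ []) (λ ())
          (reassociate (# 36864) (var 0F :^ 10) e (X ∷ H ∷ []) z))

  count-algebraic : evalInSquare theorem18-coeffs (series 0) ≈ 0ˢ
  -- At x = 0 one has a₀ = 0 and b₀ = -1, so the determinant has constant term b₀² = 1.
  count-algebraic = unscale theorem18-coeffs (series 0) (relation λ ())

  count-annihilated : ∀ {a : ℕ → ℕ} → (∀ n → a n ≡ count n 0) → evalInSquare theorem18-coeffs (ogf a) ≈ 0ˢ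
  count-annihilated {a} a≡count =
    evalInSquare-zero theorem18-coeffs {ogf a} {series 0} (λ n → cong +_ (a≡count n)) count-algebraic

-- Prepending values to 321-avoiding permutations

module Enumeration where
  open import Data.Bool.Properties using (T-irrelevant)
  open import Data.Fin.Base as Fin using (Fin; zero; suc; toℕ; punchIn; punchOut; _↑ʳ_; fromℕ<)
  open import Data.Fin.Permutation using (↔⇒≡)
  import Data.Fin.Properties as Fin
  open import Data.Nat.Base as ℕ using (ℕ; zero; suc; _≤_; _<_; z≤n; s≤s; s≤s⁻¹; z<s; _⊓_)
  import Data.Nat.Properties as ℕ
  open import Data.Nat.Tactic.RingSolver using (solve-∀)
  open import Data.Product using (Σ; ∃; _×_; _,_; proj₁; proj₂)
  open import Data.Sum.Base using (_⊎_; inj₁; inj₂)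
  open import Data.Sum.Function.Propositional using (_⊎-↔_)
  open import Data.Unit.Base using (⊤; tt)
  open import Data.Vec.Base using (Vec; []; _∷_; lookup; map; tabulate)
  open import Data.Vec.Properties using (lookup-map; lookup∘tabulate; tabulate∘lookup; tabulate-cong; ∷-injective)
  open import Defs
  open import Function.Base using (_∘_)
  open import Function.Bundles using (_↔_; mk↔ₛ′)
  open import Function.Construct.Composition using (_↔-∘_)
  open import Function.Construct.Symmetry using (↔-sym)
  open import Relation.Binary.PropositionalEquality
  open import Relation.Nullary using (yes; no; contradiction)
  open import Relation.Nullary.Decidable using (True; fromWitness; toWitness)
  open Counting

  -- Prepending 0 creates no inversion and raises every other value by one. Prepending j + 1 puts a
  -- new entry to the left of the value 0, and this entry becomes the lowest inversion top.
  step : ℕ → ℕ → ℕ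
  step k zero    = suc k
  step k (suc j) = suc j

  prepend : ∀ {m} → Fin (suc m) → Word m → Word (suc m)
  prepend s w = s ∷ map (punchIn s) w

  -- A total conversion, so that `decode` can be defined without proofs of bounds; the bounds follow
  -- from `decode-state`, and no value is ever actually cut off there.
  clamp : ∀ m → ℕ → Fin (suc m)
  clamp zero    j       = zero
  clamp (suc m) zero    = zero
  clamp (suc m) (suc j) = suc (clamp m j)

  toℕ-clamp : ∀ {m j} → j ≤ m → toℕ (clamp m j) ≡ j
  toℕ-clamp {zero}  z≤n       = refl
  toℕ-clamp {suc m} z≤n       = refl
  toℕ-clamp {suc m} (s≤s j≤m) = cong suc (toℕ-clamp j≤m)

  clamp-toℕ : ∀ {m} (s : Fin (suc m)) → clamp m (toℕ s) ≡ s
  clamp-toℕ {zero}  zero    = refl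
  clamp-toℕ {suc m} zero    = refl
  clamp-toℕ {suc m} (suc s) = cong suc (clamp-toℕ s)

  punchIn-mono-< : ∀ {m} (s : Fin (suc m)) {x y} → x Fin.< y → punchIn s x Fin.< punchIn s y
  punchIn-mono-< s {x} {y} x<y = ℕ.≰⇒> λ le → ℕ.<⇒≱ x<y (Fin.punchIn-cancel-≤ s y x le)

  punchIn-cancel-< : ∀ {m} (s : Fin (suc m)) {x y} → punchIn s x Fin.< punchIn s y → x Fin.< y
  punchIn-cancel-< s {x} {y} lt = ℕ.≰⇒> λ le → ℕ.<⇒≱ lt (Fin.punchIn-mono-≤ s y x le)

  ≤⇒<punchIn : ∀ {m} (s : Fin (suc m)) x → toℕ s ≤ toℕ x → s Fin.< punchIn s x
  ≤⇒<punchIn zero    x       _   = z<s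
  ≤⇒<punchIn (suc s) (suc x) s≤x = s≤s (≤⇒<punchIn s x (s≤s⁻¹ s≤x))

  <punchIn⇒≤ : ∀ {m} (s : Fin (suc m)) x → s Fin.< punchIn s x → toℕ s ≤ toℕ x
  <punchIn⇒≤ zero    x       _  = z≤n
  <punchIn⇒≤ (suc s) (suc x) lt = s≤s (<punchIn⇒≤ s x (s≤s⁻¹ lt))

  <⇒punchIn< : ∀ {m} (s : Fin (suc m)) x → toℕ x < toℕ s → punchIn s x Fin.< s
  <⇒punchIn< (suc s) zero    _   = z<s
  <⇒punchIn< (suc s) (suc x) x<s = s≤s (<⇒punchIn< s x (s≤s⁻¹ x<s))

  punchIn<⇒< : ∀ {m} (s : Fin (suc m)) x → punchIn s x Fin.< s → toℕ x < toℕ s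
  punchIn<⇒< (suc s) zero    _  = z<s
  punchIn<⇒< (suc s) (suc x) lt = s≤s (punchIn<⇒< s x (s≤s⁻¹ lt))

  ≤punchIn⇒≤ : ∀ {m} a (s : Fin (suc m)) x → a ≤ toℕ s → a ≤ toℕ (punchIn s x) → a ≤ toℕ x
  ≤punchIn⇒≤ a zero    x       z≤n _ = z≤n
  ≤punchIn⇒≤ a (suc s) zero    _   a≤0 = a≤0
  ≤punchIn⇒≤ zero    (suc s) (suc x) _ _ = z≤n
  ≤punchIn⇒≤ (suc a) (suc s) (suc x) (s≤s p) (s≤s q) = s≤s (≤punchIn⇒≤ a s x p q)

  ≤⇒≤punchIn : ∀ {m} a (s : Fin (suc m)) x → a ≤ toℕ x → a ≤ toℕ (punchIn s x)
  ≤⇒≤punchIn a       zero    x       a≤x     = ℕ.m≤n⇒m≤1+n a≤x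
  ≤⇒≤punchIn a       (suc s) zero    a≤0     = a≤0
  ≤⇒≤punchIn zero    (suc s) (suc x) _       = z≤n
  ≤⇒≤punchIn (suc a) (suc s) (suc x) (s≤s p) = s≤s (≤⇒≤punchIn a s x p)

  lookup-prepend : ∀ {m} (s : Fin (suc m)) (w : Word m) i → lookup (prepend s w) (suc i) ≡ punchIn s (lookup w i)
  lookup-prepend s w i = lookup-map i (punchIn s) w

  -- A new leftmost entry s, with the values from s on raised by one, completes a 321 precisely with
  -- an inversion whose top is below s.
  NoInversionBelow : ∀ {m} → Word m → ℕ → Set
  NoInversionBelow w s = ∀ i j → i Fin.< j → lookup w j Fin.< lookup w i → s ≤ toℕ (lookup w i)

  Surjective : ∀ {m} → Word m → Set
  Surjective {m} w = ∀ (y : Fin m) → ∃ λ i → lookup w i ≡ y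

  -- The state is the largest value that may be prepended. The restriction s ≤ m in `necessary`
  -- takes care of words without inversions, whose state is m.
  record State {m} (w : Word m) (k : ℕ) : Set where
    field
      permutation : IsPermutation w
      surjective  : Surjective w
      avoids      : Avoids321 w
      bounded     : k ≤ m
      sufficient  : NoInversionBelow w k
      necessary   : ∀ s → s ≤ m → NoInversionBelow w s → s ≤ k

  open State

  inversion-prepend : ∀ {m} (s : Fin (suc m)) (w : Word m) i j →
    lookup w j Fin.< lookup w i → lookup (prepend s w) (suc j) Fin.< lookup (prepend s w) (suc i)
  inversion-prepend s w i j lt =
    subst₂ Fin._<_ (sym (lookup-prepend s w j)) (sym (lookup-prepend s w i)) (punchIn-mono-< s lt)

  inversion-unprepend : ∀ {m} (s : Fin (suc m)) (w : Word m) i j →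
    lookup (prepend s w) (suc j) Fin.< lookup (prepend s w) (suc i) → lookup w j Fin.< lookup w i
  inversion-unprepend s w i j lt =
    punchIn-cancel-< s (subst₂ Fin._<_ (lookup-prepend s w j) (lookup-prepend s w i) lt)

  prepend-permutation : ∀ {m} (s : Fin (suc m)) (w : Word m) → IsPermutation w → IsPermutation (prepend s w)
  prepend-permutation s w perm zero    zero    eq = refl
  prepend-permutation s w perm zero    (suc j) eq =
    contradiction (sym (trans eq (lookup-prepend s w j))) (Fin.punchInᵢ≢i s _)
  prepend-permutation s w perm (suc i) zero    eq =
    contradiction (trans (sym (lookup-prepend s w i)) eq) (Fin.punchInᵢ≢i s _)
  prepend-permutation s w perm (suc i) (suc j) eq = cong suc (perm i j (Fin.punchIn-injective s _ _
    (trans (sym (lookup-prepend s w i)) (trans eq (lookup-prepend s w j)))))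

  unprepend-permutation : ∀ {m} (s : Fin (suc m)) (w : Word m) → IsPermutation (prepend s w) → IsPermutation w
  unprepend-permutation s w perm i j eq = Fin.suc-injective (perm (suc i) (suc j)
    (trans (lookup-prepend s w i) (trans (cong (punchIn s) eq) (sym (lookup-prepend s w j)))))

  prepend-surjective : ∀ {m} (s : Fin (suc m)) (w : Word m) → Surjective w → Surjective (prepend s w)
  prepend-surjective s w surj y with s Fin.≟ y
  ... | yes s≡y = zero , s≡y
  ... | no  s≢y with surj (punchOut s≢y)
  ...   | i , eq = suc i , trans (lookup-prepend s w i) (trans (cong (punchIn s) eq) (Fin.punchIn-punchOut s≢y))

  prepend-avoids : ∀ {m} (s : Fin (suc m)) (w : Word m) → Avoids321 w → NoInversionBelow w (toℕ s) → Avoids321 (prepend s w)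
  prepend-avoids s w av no-inv (zero , suc b , suc c , _ , s≤s b<c , c<b , b<a) =
    ℕ.<⇒≱ (punchIn<⇒< s (lookup w b) (subst (Fin._< s) (lookup-prepend s w b) b<a))
      (no-inv b c b<c (inversion-unprepend s w b c c<b))
  prepend-avoids s w av no-inv (suc a , suc b , suc c , s≤s a<b , s≤s b<c , c<b , b<a) =
    av (a , b , c , a<b , b<c , inversion-unprepend s w b c c<b , inversion-unprepend s w a b b<a)

  unprepend-avoids : ∀ {m} (s : Fin (suc m)) (w : Word m) → Avoids321 (prepend s w) → Avoids321 w
  unprepend-avoids s w av (a , b , c , a<b , b<c , c<b , b<a) =
    av (suc a , suc b , suc c , s≤s a<b , s≤s b<c , inversion-prepend s w b c c<b , inversion-prepend s w a b b<a)

  unprepend-noInversion : ∀ {m} (s : Fin (suc m)) (w : Word m) → Avoids321 (prepend s w) → NoInversionBelow w (toℕ s)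
  unprepend-noInversion s w av i j i<j lt with toℕ s ℕ.≤? toℕ (lookup w i)
  ... | yes s≤ = s≤
  ... | no  s≰ = contradiction
    (zero , suc i , suc j , z<s , s≤s i<j , inversion-prepend s w i j lt ,
      subst (Fin._< s) (sym (lookup-prepend s w i)) (<⇒punchIn< s (lookup w i) (ℕ.≰⇒> s≰))) av

  prepend-state : ∀ {m} {w : Word m} {k} (s : Fin (suc m)) → State w k → toℕ s ≤ k → State (prepend s w) (step k (toℕ s))
  prepend-state {m} {w} {k} zero st _ = record
    { permutation = prepend-permutation zero w (permutation st)
    ; surjective  = prepend-surjective zero w (surjective st)
    ; avoids      = prepend-avoids zero w (avoids st) (λ _ _ _ _ → z≤n)
    ; bounded     = s≤s (bounded st)
    ; sufficient  = sufficient′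
    ; necessary   = necessary′ }
    where
    sufficient′ : NoInversionBelow (prepend zero w) (suc k)
    sufficient′ (suc i) (suc j) (s≤s i<j) lt = subst (suc k ≤_) (sym (cong toℕ (lookup-prepend zero w i)))
      (s≤s (sufficient st i j i<j (inversion-unprepend zero w i j lt)))
    necessary′ : ∀ s → s ≤ suc m → NoInversionBelow (prepend zero w) s → s ≤ suc k
    necessary′ zero    _         _      = z≤n
    necessary′ (suc s) (s≤s s≤m) no-inv = s≤s (necessary st s s≤m λ i j i<j lt →
      s≤s⁻¹ (subst (suc s ≤_) (cong toℕ (lookup-prepend zero w i))
        (no-inv (suc i) (suc j) (s≤s i<j) (inversion-prepend zero w i j lt))))
  prepend-state {suc m} {w} {k} s@(suc j) st s≤k = record
    { permutation = prepend-permutation s w (permutation st)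
    ; surjective  = prepend-surjective s w (surjective st)
    ; avoids      = prepend-avoids s w (avoids st) no-inv
    ; bounded     = Fin.toℕ≤n s
    ; sufficient  = sufficient′
    ; necessary   = necessary′ }
    where
    no-inv : NoInversionBelow w (toℕ s)
    no-inv i i′ i<i′ lt = ℕ.≤-trans s≤k (sufficient st i i′ i<i′ lt)
    sufficient′ : NoInversionBelow (prepend s w) (toℕ s)
    sufficient′ zero    (suc i′) _          lt = ℕ.≤-refl
    sufficient′ (suc i) (suc i′) (s≤s i<i′) lt = subst (toℕ s ≤_) (sym (cong toℕ (lookup-prepend s w i)))
      (≤⇒≤punchIn (toℕ s) s (lookup w i) (no-inv i i′ i<i′ (inversion-unprepend s w i i′ lt)))
    necessary′ : ∀ t → t ≤ suc (suc m) → NoInversionBelow (prepend s w) t → t ≤ toℕ s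
    -- The new entry is positive, so the value 0 occurs to its right and makes it an inversion top.
    necessary′ t _ no-inv′ with prepend-surjective s w (surjective st) zero
    ... | suc i , eq = no-inv′ zero (suc i) z<s (subst (Fin._< s) (sym eq) z<s)

  unprepend : ∀ {m} (v : Word (suc m)) → IsPermutation v → Σ (Fin (suc m)) λ s → Σ (Word m) λ w → prepend s w ≡ v
  unprepend {m} v@(s ∷ t) perm = s , w , cong (s ∷_) (begin
    map (punchIn s) w                              ≡⟨ tabulate∘lookup _ ⟨
    tabulate (lookup (map (punchIn s) w))          ≡⟨ tabulate-cong same ⟩
    tabulate (lookup t)                            ≡⟨ tabulate∘lookup t ⟩
    t                                              ∎)
    where
    open ≡-Reasoning
    fresh : ∀ i → s ≢ lookup t i
    fresh i eq with perm zero (suc i) eq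
    ... | ()
    w : Word m
    w = tabulate (λ i → punchOut (fresh i))
    same : ∀ i → lookup (map (punchIn s) w) i ≡ lookup t i
    same i = begin
      lookup (map (punchIn s) w) i  ≡⟨ lookup-map i (punchIn s) w ⟩
      punchIn s (lookup w i)        ≡⟨ cong (punchIn s) (lookup∘tabulate (λ i → punchOut (fresh i)) i) ⟩
      punchIn s (punchOut (fresh i)) ≡⟨ Fin.punchIn-punchOut (fresh i) ⟩
      lookup t i                    ∎

  map-injective : ∀ {a b} {A : Set a} {B : Set b} {f : A → B} → (∀ {x y} → f x ≡ f y → x ≡ y) →
    ∀ {m} (v w : Vec A m) → map f v ≡ map f w → v ≡ w
  map-injective inj []      []      _  = refl
  map-injective inj (x ∷ v) (y ∷ w) eq with ∷-injective eq
  ... | p , q = cong₂ _∷_ (inj p) (map-injective inj v w q)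

  prepend-injective : ∀ {m} (s s′ : Fin (suc m)) (w w′ : Word m) → prepend s w ≡ prepend s′ w′ → s ≡ s′ × w ≡ w′
  prepend-injective s s′ w w′ eq with ∷-injective eq
  ... | refl , tails = refl , map-injective (Fin.punchIn-injective s _ _) w w′ tails

  module _ {m : ℕ} (a : Fin (3 ℕ.+ m)) (b : Fin (2 ℕ.+ m)) (c : Fin (1 ℕ.+ m)) (w : Word m) where
    shrub : Word (3 ℕ.+ m)
    shrub = prepend a (prepend b (prepend c w))

    lookup-shrub : ∀ i → lookup shrub (3 ↑ʳ i) ≡ punchIn a (punchIn b (punchIn c (lookup w i)))
    lookup-shrub i = trans (lookup-prepend a (prepend b (prepend c w)) (2 ↑ʳ i))
      (cong (punchIn a) (trans (lookup-prepend b (prepend c w) (1 ↑ʳ i)) (cong (punchIn b) (lookup-prepend c w i))))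

    shrub-mono-< : ∀ i j → lookup w i Fin.< lookup w j → lookup shrub (3 ↑ʳ i) Fin.< lookup shrub (3 ↑ʳ j)
    shrub-mono-< i j lt = subst₂ Fin._<_ (sym (lookup-shrub i)) (sym (lookup-shrub j))
      (punchIn-mono-< a (punchIn-mono-< b (punchIn-mono-< c lt)))

    shrub-cancel-< : ∀ i j → lookup shrub (3 ↑ʳ i) Fin.< lookup shrub (3 ↑ʳ j) → lookup w i Fin.< lookup w j
    shrub-cancel-< i j lt = punchIn-cancel-< c (punchIn-cancel-< b (punchIn-cancel-< a
      (subst₂ Fin._<_ (lookup-shrub i) (lookup-shrub j) lt)))

    -- The numbers are ranks at the moment of insertion. Entries at or above an inserted value move
    -- up, so strict inequalities between final values become weak ones between ranks.
    root-smallest : toℕ a ≤ toℕ b ⊓ toℕ c →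
      lookup shrub zero Fin.< lookup shrub (suc zero) × lookup shrub zero Fin.< lookup shrub (suc (suc zero))
    root-smallest a≤ =
      ≤⇒<punchIn a b (ℕ.m≤n⊓o⇒m≤n (toℕ b) (toℕ c) a≤) ,
      ≤⇒<punchIn a (punchIn b c) (≤⇒≤punchIn (toℕ a) b c (ℕ.m≤n⊓o⇒m≤o (toℕ b) (toℕ c) a≤))

    root-smallest⁻¹ :
      lookup shrub zero Fin.< lookup shrub (suc zero) × lookup shrub zero Fin.< lookup shrub (suc (suc zero)) →
      toℕ a ≤ toℕ b ⊓ toℕ c
    root-smallest⁻¹ (a<₁ , a<₂) = ℕ.⊓-glb a≤b (≤punchIn⇒≤ (toℕ a) b c a≤b (<punchIn⇒≤ a (punchIn b c) a<₂))
      where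
      a≤b : toℕ a ≤ toℕ b
      a≤b = <punchIn⇒≤ a b a<₁

  shrub-condition : ∀ {n} a b c (w : Word (n ℕ.* 3)) → toℕ a ≤ toℕ b ⊓ toℕ c → ShrubCondition n w →
    ShrubCondition (suc n) (shrub a b c w)
  shrub-condition a b c w a≤ sc zero    = root-smallest a b c w a≤
  shrub-condition a b c w a≤ sc (suc i) =
    shrub-mono-< a b c w _ _ (proj₁ (sc i)) , shrub-mono-< a b c w _ _ (proj₂ (sc i))

  shrub-condition⁻¹ : ∀ {n} a b c (w : Word (n ℕ.* 3)) → ShrubCondition (suc n) (shrub a b c w) →
    toℕ a ≤ toℕ b ⊓ toℕ c × ShrubCondition n w
  shrub-condition⁻¹ a b c w sc = root-smallest⁻¹ a b c w (sc zero) ,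
    λ i → shrub-cancel-< a b c w _ _ (proj₁ (sc (suc i))) , shrub-cancel-< a b c w _ _ (proj₂ (sc (suc i)))

  -- Shrub forests as sequences of moves

  infixl 1 _⨾_
  _⨾_ : ∀ {A B C : Set} → A ↔ B → B ↔ C → A ↔ C
  p ⨾ q = q ↔-∘ p

  -- Entries are prepended from right to left: `c` is the last entry of the shrub, `b` the middle
  -- one and `a` the root. The bound a ≤ b already makes the root admissible, since the state after
  -- prepending b is at least b.
  Move : ℕ → Set
  Move k = Σ (Fin (suc k)) λ c → Σ (Fin (suc (step k (toℕ c)))) λ b → Fin (suc (toℕ b ⊓ toℕ c))

  after : ∀ k → Move k → ℕ
  after k (c , b , a) = step (step (step k (toℕ c)) (toℕ b)) (toℕ a)

  mutual
    Forest : ℕ → Set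
    Forest zero    = ⊤
    Forest (suc n) = Σ (Forest n) λ f → Move (state n f)

    state : ∀ n → Forest n → ℕ
    state zero    _       = 0
    state (suc n) (f , μ) = after (state n f) μ

  decode : ∀ n → Forest n → Word (n ℕ.* 3)
  decode zero    _                 = []
  decode (suc n) (f , (c , b , a)) = shrub (clamp _ (toℕ a)) (clamp _ (toℕ b)) (clamp _ (toℕ c)) (decode n f)

  ≤step : ∀ k j → j ≤ step k j
  ≤step k zero    = z≤n
  ≤step k (suc j) = ℕ.≤-refl

  step-bounded : ∀ {k m} j → k ≤ m → j ≤ m → step k j ≤ suc m
  step-bounded zero    k≤m _   = s≤s k≤m
  step-bounded (suc j) _   j≤m = ℕ.m≤n⇒m≤1+n j≤m

  clamp-state : ∀ {m} {w : Word m} {k} j → State w k → j ≤ k → State (prepend (clamp m j) w) (step k j)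
  clamp-state {m} {w} {k} j st j≤k = subst (λ i → State (prepend (clamp m j) w) (step k i)) eq
    (prepend-state (clamp m j) st (subst (_≤ k) (sym eq) j≤k))
    where
    eq : toℕ (clamp m j) ≡ j
    eq = toℕ-clamp (ℕ.≤-trans j≤k (State.bounded st))

  record Bounds {k : ℕ} (m : ℕ) (μ : Move k) : Set where
    constructor mkBounds
    field
      c≤ : toℕ (proj₁ μ) ≤ m
      b≤ : toℕ (proj₁ (proj₂ μ)) ≤ suc m
      a≤ : toℕ (proj₂ (proj₂ μ)) ≤ suc (suc m)

  bounds : ∀ {k m} → k ≤ m → (μ : Move k) → Bounds m μ
  bounds {k} {m} k≤m (c , b , a) = mkBounds c≤m
    (ℕ.≤-trans (Fin.toℕ≤pred[n] b) (step-bounded (toℕ c) k≤m c≤m))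
    (ℕ.≤-trans (ℕ.m≤n⊓o⇒m≤o (toℕ b) (toℕ c) (Fin.toℕ≤pred[n] a)) (ℕ.m≤n⇒m≤1+n (ℕ.m≤n⇒m≤1+n c≤m)))
    where
    c≤m : toℕ c ≤ m
    c≤m = ℕ.≤-trans (Fin.toℕ≤pred[n] c) k≤m

  empty-state : State {0} [] 0
  empty-state = record
    { permutation = λ () ; surjective = λ () ; avoids = λ { (() , _) }
    ; bounded = z≤n ; sufficient = λ () ; necessary = λ _ s≤0 _ → s≤0 }

  decode-state : ∀ n f → State (decode n f) (state n f)
  decode-state zero    _                 = empty-state
  decode-state (suc n) (f , (c , b , a)) =
    clamp-state (toℕ a)
      (clamp-state (toℕ b) (clamp-state (toℕ c) (decode-state n f) (Fin.toℕ≤pred[n] c)) (Fin.toℕ≤pred[n] b))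
      (ℕ.≤-trans (ℕ.m≤n⊓o⇒m≤n (toℕ b) (toℕ c) (Fin.toℕ≤pred[n] a)) (≤step _ (toℕ b)))

  decode-shrub : ∀ n f → ShrubCondition n (decode n f)
  decode-shrub (suc n) (f , μ@(c , b , a)) = shrub-condition {n} _ _ _ (decode n f)
    (subst₂ _≤_ (sym (toℕ-clamp (Bounds.a≤ bs)))
      (sym (cong₂ _⊓_ (toℕ-clamp (Bounds.b≤ bs)) (toℕ-clamp (Bounds.c≤ bs)))) (Fin.toℕ≤pred[n] a))
    (decode-shrub n f)
    where
    bs : Bounds (n ℕ.* 3) μ
    bs = bounds (State.bounded (decode-state n f)) μ

  clamp-injective : ∀ {m i j} → i ≤ m → j ≤ m → clamp m i ≡ clamp m j → i ≡ j
  clamp-injective i≤m j≤m eq = trans (sym (toℕ-clamp i≤m)) (trans (cong toℕ eq) (toℕ-clamp j≤m))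

  move-injective : ∀ {k} (μ ν : Move k) → toℕ (proj₁ μ) ≡ toℕ (proj₁ ν) →
    toℕ (proj₁ (proj₂ μ)) ≡ toℕ (proj₁ (proj₂ ν)) → toℕ (proj₂ (proj₂ μ)) ≡ toℕ (proj₂ (proj₂ ν)) → μ ≡ ν
  move-injective (c , b , a) (c′ , b′ , a′) p q r with Fin.toℕ-injective p
  ... | refl with Fin.toℕ-injective q
  ...   | refl with Fin.toℕ-injective r
  ...     | refl = refl

  decode-injective : ∀ n f g → decode n f ≡ decode n g → f ≡ g
  decode-injective zero    _       _       _  = refl
  decode-injective (suc n) (f , μ) (g , ν) eq with prepend-injective _ _ _ _ eq
  ... | a≡ , eq₁ with prepend-injective _ _ _ _ eq₁
  ...   | b≡ , eq₂ with prepend-injective _ _ _ _ eq₂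
  ...     | c≡ , eq₃ with decode-injective n f g eq₃
  ...       | refl = cong (f ,_) (move-injective μ ν
    (clamp-injective (Bounds.c≤ (bs μ)) (Bounds.c≤ (bs ν)) c≡)
    (clamp-injective (Bounds.b≤ (bs μ)) (Bounds.b≤ (bs ν)) b≡)
    (clamp-injective (Bounds.a≤ (bs μ)) (Bounds.a≤ (bs ν)) a≡))
    where
    bs : (μ : Move (state n f)) → Bounds (n ℕ.* 3) μ
    bs = bounds (State.bounded (decode-state n f))

  bounded-index : ∀ {j k} → j ≤ k → Σ (Fin (suc k)) λ i → toℕ i ≡ j
  bounded-index j≤k = fromℕ< (s≤s j≤k) , Fin.toℕ-fromℕ< (s≤s j≤k)

  move : ∀ {k} c b a → c ≤ k → b ≤ step k c → a ≤ b ⊓ c →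
    Σ (Move k) λ μ → toℕ (proj₁ μ) ≡ c × toℕ (proj₁ (proj₂ μ)) ≡ b × toℕ (proj₂ (proj₂ μ)) ≡ a
  move c b a c≤ b≤ a≤ with bounded-index c≤
  ... | c′ , refl with bounded-index b≤
  ...   | b′ , refl with bounded-index a≤
  ...     | a′ , refl = (c′ , b′ , a′) , refl , refl , refl

  decode-surjective : ∀ n v → IsS2-321 n v → Σ (Forest n) λ f → decode n f ≡ v
  decode-surjective zero    []  _ = tt , refl
  decode-surjective (suc n) v (perm , av , sc) with unprepend v perm
  ... | a , v₁ , refl with unprepend v₁ (unprepend-permutation a v₁ perm)
  ...   | b , v₂ , refl with unprepend v₂ (unprepend-permutation b v₂ (unprepend-permutation a v₁ perm))
  ...     | c , w , refl = from-parts a b c w perm av sc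
    where
    from-parts : ∀ a b c (w : Word (n ℕ.* 3)) → IsPermutation (shrub a b c w) → Avoids321 (shrub a b c w) →
      ShrubCondition (suc n) (shrub a b c w) → Σ (Forest (suc n)) λ f → decode (suc n) f ≡ shrub a b c w
    from-parts a b c w perm av sc with shrub-condition⁻¹ {n} a b c w sc
    ... | a≤ , sc′
      with decode-surjective n w
             ( unprepend-permutation c w (unprepend-permutation b _ (unprepend-permutation a _ perm))
             , unprepend-avoids c w (unprepend-avoids b _ (unprepend-avoids a _ av)) , sc′)
    ...   | f , refl = combine-move (move (toℕ c) (toℕ b) (toℕ a) c≤ b≤ a≤)
      where
      st : State (decode n f) (state n f)
      st = decode-state n f
      av₁ : Avoids321 (prepend b (prepend c (decode n f)))
      av₁ = unprepend-avoids a _ av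
      c≤ : toℕ c ≤ state n f
      c≤ = State.necessary st (toℕ c) (Fin.toℕ≤pred[n] c)
        (unprepend-noInversion c (decode n f) (unprepend-avoids b _ av₁))
      b≤ : toℕ b ≤ step (state n f) (toℕ c)
      b≤ = State.necessary (prepend-state c st c≤) (toℕ b) (Fin.toℕ≤pred[n] b) (unprepend-noInversion b _ av₁)
      combine-move : (Σ (Move (state n f)) λ μ → toℕ (proj₁ μ) ≡ toℕ c ×
          toℕ (proj₁ (proj₂ μ)) ≡ toℕ b × toℕ (proj₂ (proj₂ μ)) ≡ toℕ a) →
        Σ (Forest (suc n)) λ f′ → decode (suc n) f′ ≡ shrub a b c (decode n f)
      combine-move (μ , p , q , r) = (f , μ) , cong₂ prepend (index a r)
        (cong₂ prepend (index b q) (cong (λ t → prepend t (decode n f)) (index c p)))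
        where
        index : ∀ {m} {i : ℕ} (s : Fin (suc m)) → i ≡ toℕ s → clamp m i ≡ s
        index s refl = clamp-toℕ s

  Forest↔S2 : ∀ n → Forest n ↔ S2-321 n
  Forest↔S2 n = mk↔ₛ′ to (λ { (v , t) → proj₁ (preimage v t) })
    (λ { (v , t) → member-≡ (proj₂ (preimage v t)) })
    (λ f → decode-injective n _ f (proj₂ (preimage (proj₁ (to f)) (proj₂ (to f)))))
    where
    preimage : ∀ v → True (isS2-321? n v) → Σ (Forest n) λ f → decode n f ≡ v
    preimage v t = decode-surjective n v (toWitness t)
    to : Forest n → S2-321 n
    to f = decode n f , fromWitness
      (State.permutation (decode-state n f) , State.avoids (decode-state n f) , decode-shrub n f)
    member-≡ : ∀ {v v′} {t : True (isS2-321? n v)} {t′ : True (isS2-321? n v′)} → v ≡ v′ → _≡_ {A = S2-321 n} (v , t) (v′ , t′)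
    member-≡ {v} refl = cong (v ,_) (T-irrelevant _ _)

  -- Counting moves and forests

  sumTo : ℕ → (ℕ → ℕ) → ℕ
  sumTo zero    f = 0
  sumTo (suc n) f = f 0 ℕ.+ sumTo n (f ∘ suc)

  sumTo-snoc : ∀ n f → sumTo (suc n) f ≡ sumTo n f ℕ.+ f n
  sumTo-snoc zero    f = ℕ.+-comm (f 0) 0
  sumTo-snoc (suc n) f = trans (cong (f 0 ℕ.+_) (sumTo-snoc n (f ∘ suc))) (sym (ℕ.+-assoc (f 0) _ _))

  sumTo-cong : ∀ n {f g} → (∀ i → i < n → f i ≡ g i) → sumTo n f ≡ sumTo n g
  sumTo-cong zero    eq = refl
  sumTo-cong (suc n) eq = cong₂ ℕ._+_ (eq 0 ℕ.z<s) (sumTo-cong n λ i i<n → eq (suc i) (s≤s i<n))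

  Σ-Fin-suc : ∀ {n} {B : Fin (suc n) → Set} → (B zero ⊎ Σ (Fin n) (B ∘ suc)) ↔ Σ (Fin (suc n)) B
  Σ-Fin-suc = mk↔ₛ′
    (λ { (inj₁ b) → zero , b ; (inj₂ (i , b)) → suc i , b })
    (λ { (zero , b) → inj₁ b ; (suc i , b) → inj₂ (i , b) })
    (λ { (zero , b) → refl ; (suc i , b) → refl })
    (λ { (inj₁ b) → refl ; (inj₂ (i , b)) → refl })

  Fin-sumTo : ∀ n (f : ℕ → ℕ) {B : Fin n → Set} → (∀ i → Fin (f (toℕ i)) ↔ B i) → Fin (sumTo n f) ↔ Σ (Fin n) B
  Fin-sumTo zero    f e = mk↔ₛ′ (λ ()) (λ ()) (λ ()) (λ ())
  Fin-sumTo (suc n) f e = (Fin.+↔⊎ ⨾ (e zero ⊎-↔ Fin-sumTo n (f ∘ suc) (e ∘ suc))) ⨾ Σ-Fin-suc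

  rooted : (ℕ → ℕ) → ℕ → ℕ → ℕ → ℕ
  rooted h k c b = sumTo (suc (b ⊓ c)) λ a → h (step (step (step k c) b) a)

  leaves : (ℕ → ℕ) → ℕ → ℕ → ℕ
  leaves h k c = sumTo (suc (step k c)) (rooted h k c)

  moves : (ℕ → ℕ) → ℕ → ℕ
  moves h k = sumTo (suc k) (leaves h k)

  Σ-assoc : ∀ {A : Set} {B : A → Set} {C : Σ A B → Set} → Σ A (λ a → Σ (B a) (λ b → C (a , b))) ↔ Σ (Σ A B) C
  Σ-assoc = mk↔ₛ′ (λ (a , b , c) → (a , b) , c) (λ ((a , b) , c) → a , b , c) (λ _ → refl) (λ _ → refl)

  Fin-moves : ∀ h {B : ℕ → Set} → (∀ k → Fin (h k) ↔ B k) → ∀ k → Fin (moves h k) ↔ Σ (Move k) (B ∘ after k)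
  Fin-moves h e k =
    Fin-sumTo (suc k) (leaves h k) (λ c →
      Fin-sumTo (suc (step k (toℕ c))) (rooted h k (toℕ c)) (λ b →
        Fin-sumTo (suc (toℕ b ⊓ toℕ c)) (λ a → h (step (step (step k (toℕ c)) (toℕ b)) a)) (λ a → e (after k (c , b , a)))))
    ⨾ mk↔ₛ′ (λ (c , b , a , x) → (c , b , a) , x) (λ ((c , b , a) , x) → c , b , a , x) (λ _ → refl) (λ _ → refl)

  ψ-sum : ∀ h b → ψ h b ≡ sumTo (suc b) (h ∘ suc)
  ψ-sum h zero    = sym (ℕ.+-identityʳ _)
  ψ-sum h (suc b) = trans (cong (ℕ._+ h (suc (suc b))) (ψ-sum h b)) (sym (sumTo-snoc (suc b) (h ∘ suc)))

  Ψ-sum : ∀ h c → Ψ h c ≡ sumTo c (ψ h ∘ suc)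
  Ψ-sum h zero    = refl
  Ψ-sum h (suc c) = trans (cong (ℕ._+ ψ h (suc c)) (Ψ-sum h c)) (sym (sumTo-snoc c (ψ h ∘ suc)))

  -- The first two summands are the moves with last entry 0, which force the root to be 0. In the
  -- last sum, index `c` stands for last entry c + 1, and `h (3 + c)` is the case of middle entry 0.
  φ-sum : ∀ h k → φ h k ≡
    h (3 ℕ.+ k) ℕ.+ sumTo (suc k) (λ b → h (2 ℕ.+ b)) ℕ.+ sumTo k (λ c → h (3 ℕ.+ c) ℕ.+ Ψ h (suc c))
  φ-sum h zero    = lemma (h 3) (h 2)
    where
    lemma : ∀ x y → x ℕ.+ y ≡ x ℕ.+ (y ℕ.+ 0) ℕ.+ 0
    lemma = solve-∀
  φ-sum h (suc k) = begin
    φ h k ℕ.+ ((h (4 ℕ.+ k) ℕ.+ h (3 ℕ.+ k)) ℕ.+ Ψ h (suc k))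
      ≡⟨ cong (ℕ._+ ((h (4 ℕ.+ k) ℕ.+ h (3 ℕ.+ k)) ℕ.+ Ψ h (suc k))) (φ-sum h k) ⟩
    h (3 ℕ.+ k) ℕ.+ S₁ ℕ.+ S₂ ℕ.+ ((h (4 ℕ.+ k) ℕ.+ h (3 ℕ.+ k)) ℕ.+ Ψ h (suc k))
      ≡⟨ lemma (h (3 ℕ.+ k)) (h (4 ℕ.+ k)) S₁ S₂ (Ψ h (suc k)) ⟩
    h (4 ℕ.+ k) ℕ.+ (S₁ ℕ.+ h (3 ℕ.+ k)) ℕ.+ (S₂ ℕ.+ (h (3 ℕ.+ k) ℕ.+ Ψ h (suc k)))
      ≡⟨ cong₂ (λ s t → h (4 ℕ.+ k) ℕ.+ s ℕ.+ t) (sumTo-snoc (suc k) (λ b → h (2 ℕ.+ b))) (sumTo-snoc k (λ c → h (3 ℕ.+ c) ℕ.+ Ψ h (suc c))) ⟨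
    h (4 ℕ.+ k) ℕ.+ sumTo (2 ℕ.+ k) (λ b → h (2 ℕ.+ b)) ℕ.+ sumTo (suc k) (λ c → h (3 ℕ.+ c) ℕ.+ Ψ h (suc c)) ∎
    where
    open ≡-Reasoning
    S₁ S₂ : ℕ
    S₁ = sumTo (suc k) (λ b → h (2 ℕ.+ b))
    S₂ = sumTo k (λ c → h (3 ℕ.+ c) ℕ.+ Ψ h (suc c))
    lemma : ∀ x y s t p → x ℕ.+ s ℕ.+ t ℕ.+ ((y ℕ.+ x) ℕ.+ p) ≡ y ℕ.+ (s ℕ.+ x) ℕ.+ (t ℕ.+ (x ℕ.+ p))
    lemma = solve-∀

  moves≡φ : ∀ h k → moves h k ≡ φ h k
  moves≡φ h k = begin
    moves h k ≡⟨ cong₂ ℕ._+_ first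
      (sumTo-cong k {λ c → sumTo (2 ℕ.+ c) (inner (suc c))} {λ c → h (3 ℕ.+ c) ℕ.+ Ψ h (suc c)} λ c _ → later c) ⟩
    (h (3 ℕ.+ k) ℕ.+ sumTo (suc k) (λ b → h (2 ℕ.+ b))) ℕ.+ sumTo k (λ c → h (3 ℕ.+ c) ℕ.+ Ψ h (suc c)) ≡⟨ φ-sum h k ⟨
    φ h k     ∎
    where
    open ≡-Reasoning
    inner : ℕ → ℕ → ℕ
    inner = rooted h k

    first : sumTo (suc (suc k)) (inner 0) ≡ h (3 ℕ.+ k) ℕ.+ sumTo (suc k) (λ b → h (2 ℕ.+ b))
    first = cong₂ ℕ._+_ (ℕ.+-identityʳ (h (3 ℕ.+ k)))
      (sumTo-cong (suc k) {inner 0 ∘ suc} {λ b → h (2 ℕ.+ b)} λ b _ → ℕ.+-identityʳ (h (2 ℕ.+ b)))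

    at : ∀ c b → b < suc c → inner (suc c) (suc b) ≡ ψ h (suc b)
    at c b b<1+c = begin
      inner (suc c) (suc b)
        ≡⟨ cong (λ t → sumTo (suc t) λ a → h (step (suc b) a)) (ℕ.m≤n⇒m⊓n≡m b<1+c) ⟩
      h (2 ℕ.+ b) ℕ.+ sumTo (suc b) (h ∘ suc) ≡⟨ ℕ.+-comm (h (2 ℕ.+ b)) _ ⟩
      sumTo (suc b) (h ∘ suc) ℕ.+ h (2 ℕ.+ b) ≡⟨ cong (ℕ._+ h (2 ℕ.+ b)) (ψ-sum h b) ⟨
      ψ h (suc b)                             ∎

    later : ∀ c → sumTo (2 ℕ.+ c) (inner (suc c)) ≡ h (3 ℕ.+ c) ℕ.+ Ψ h (suc c)
    later c = cong₂ ℕ._+_ (ℕ.+-identityʳ (h (3 ℕ.+ c)))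
      (trans (sumTo-cong (suc c) {inner (suc c) ∘ suc} {ψ h ∘ suc} (at c)) (sym (Ψ-sum h (suc c))))

  iterate-φ : ℕ → (ℕ → ℕ) → ℕ → ℕ
  iterate-φ zero    h = h
  iterate-φ (suc n) h = iterate-φ n (φ h)

  -- The weight `h` on final states lets the induction peel off the leftmost shrub: summing `h` over
  -- its moves gives φ `h`. By contrast, `count` peels off the shrub prepended earliest, and
  -- `iterate-count` reconciles the two.
  Fin-forest : ∀ n h {B : ℕ → Set} → (∀ k → Fin (h k) ↔ B k) → Fin (iterate-φ n h 0) ↔ Σ (Forest n) (B ∘ state n)
  Fin-forest zero    h e = e 0 ⨾ mk↔ₛ′ (tt ,_) proj₂ (λ _ → refl) (λ _ → refl)
  Fin-forest (suc n) h {B} e =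
    Fin-forest n (φ h) (λ k → subst (λ t → Fin t ↔ Σ (Move k) (B ∘ after k)) (moves≡φ h k) (Fin-moves h e k)) ⨾ Σ-assoc

  iterate-count : ∀ n m k → iterate-φ n (count m) k ≡ count (n ℕ.+ m) k
  iterate-count zero    m k = refl
  iterate-count (suc n) m k = trans (iterate-count n (suc m) k) (cong (λ t → count t k) (ℕ.+-suc n m))

  Fin-count : ∀ n → Fin (count n 0) ↔ S2-321 n
  Fin-count n = (subst (λ t → Fin t ↔ Σ (Forest n) (λ _ → ⊤)) eq (Fin-forest n (count 0) λ _ → Fin1↔⊤)
    ⨾ mk↔ₛ′ proj₁ (_, tt) (λ _ → refl) (λ _ → refl)) ⨾ Forest↔S2 n
    where
    eq : iterate-φ n (count 0) 0 ≡ count n 0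
    eq = trans (iterate-count n 0 0) (cong (λ t → count t 0) (ℕ.+-identityʳ n))
    Fin1↔⊤ : Fin 1 ↔ ⊤
    Fin1↔⊤ = mk↔ₛ′ (λ _ → tt) (λ _ → zero) (λ _ → refl) (λ { zero → refl })

  cardinality : ∀ {a : ℕ → ℕ} → (∀ n → Fin (a n) ↔ S2-321 n) → ∀ n → a n ≡ count n 0
  cardinality e n = ↔⇒≡ (e n ⨾ ↔-sym (Fin-count n))

-- Inequalities between polynomial expressions over ℚ

module GrowthRate where
  open import Data.Bool.Base using (Bool; true; false; _∧_)
  open import Data.Fin.Base as Fin using (Fin)
  open import Data.Fin.Base using (zero; suc)
  open import Data.Fin.Patterns
  open import Data.Integer.Base as ℤ using (ℤ; +_; -[1+_])
  import Data.Integer.Properties as ℤ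
  open import Data.Integer.Tactic.RingSolver using (solve-∀)
  open import Data.List.Base using (List; []; _∷_)
  open import Data.List.Relation.Unary.All using (All; []; _∷_)
  open import Data.Nat.Base as ℕ using (ℕ; zero; suc; z≤n; s≤s)
  import Data.Nat.Properties as ℕ
  open import Data.Product using (_×_; _,_; proj₂; ∃; Σ; proj₁)
  open import Data.Rational.Base as ℚ using (ℚ; 0ℚ; 1ℚ; mkℚ; _/_; toℚᵘ; _≤_; _<_; _+_; _*_; -_; _-_; _⊔_; 1/_; _⊓_)
  import Data.Rational.Properties as ℚ
  open import Data.Rational.Unnormalised.Base as ℚᵘ using (mkℚᵘ; *≡*)
  import Data.Rational.Unnormalised.Properties as ℚᵘ
  open import Data.Sum.Base using (inj₁; inj₂; [_,_]′)
  open import Data.Unit.Base using (tt)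
  open import Data.Vec.Base using (Vec; []; _∷_; lookup)
  open import Data.Vec.Relation.Binary.Pointwise.Inductive as Pointwise using (Pointwise; []; _∷_)
  open import Data.Vec.Relation.Binary.Pointwise.Inductive using ([]; _∷_)
  open import Defs using (_^ℚ_)
  open import Relation.Binary.PropositionalEquality
  open import Relation.Nullary using (yes; no)
  open import Relation.Nullary.Decidable using (toWitness)
  open PolySolver
  open Transfer
  open Counting using (count)

  fromℤ : ℤ → ℚ
  fromℤ i = i / 1

  toℚᵘ-fromℤ : ∀ i → toℚᵘ (fromℤ i) ℚᵘ.≃ mkℚᵘ i 0
  toℚᵘ-fromℤ i = ℚ.toℚᵘ-fromℚᵘ (mkℚᵘ i 0)

  fromℤ-+ : ∀ a b → fromℤ (a ℤ.+ b) ≡ fromℤ a + fromℤ b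
  fromℤ-+ a b = ℚ.toℚᵘ-injective (begin-equality
    toℚᵘ (fromℤ (a ℤ.+ b))                     ≃⟨ toℚᵘ-fromℤ (a ℤ.+ b) ⟩
    mkℚᵘ (a ℤ.+ b) 0                           ≃⟨ *≡* (lemma a b) ⟩
    mkℚᵘ a 0 ℚᵘ.+ mkℚᵘ b 0                     ≃⟨ ℚᵘ.+-cong (toℚᵘ-fromℤ a) (toℚᵘ-fromℤ b) ⟨
    toℚᵘ (fromℤ a) ℚᵘ.+ toℚᵘ (fromℤ b)         ≃⟨ ℚ.toℚᵘ-homo-+ (fromℤ a) (fromℤ b) ⟨
    toℚᵘ (fromℤ a + fromℤ b)                   ∎)
    where
    open ℚᵘ.≤-Reasoning
    lemma : ∀ a b → (a ℤ.+ b) ℤ.* + 1 ≡ (a ℤ.* + 1 ℤ.+ b ℤ.* + 1) ℤ.* + 1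
    lemma = solve-∀

  fromℤ-* : ∀ a b → fromℤ (a ℤ.* b) ≡ fromℤ a * fromℤ b
  fromℤ-* a b = ℚ.toℚᵘ-injective (begin-equality
    toℚᵘ (fromℤ (a ℤ.* b))                     ≃⟨ toℚᵘ-fromℤ (a ℤ.* b) ⟩
    mkℚᵘ (a ℤ.* b) 0                           ≃⟨ *≡* refl ⟩
    mkℚᵘ a 0 ℚᵘ.* mkℚᵘ b 0                     ≃⟨ ℚᵘ.*-cong (toℚᵘ-fromℤ a) (toℚᵘ-fromℤ b) ⟨
    toℚᵘ (fromℤ a) ℚᵘ.* toℚᵘ (fromℤ b)         ≃⟨ ℚ.toℚᵘ-homo-* (fromℤ a) (fromℤ b) ⟨
    toℚᵘ (fromℤ a * fromℤ b)                   ∎)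
    where open ℚᵘ.≤-Reasoning

  fromℤ-neg : ∀ a → fromℤ (ℤ.- a) ≡ - fromℤ a
  fromℤ-neg a = ℚ.toℚᵘ-injective (begin-equality
    toℚᵘ (fromℤ (ℤ.- a))      ≃⟨ toℚᵘ-fromℤ (ℤ.- a) ⟩
    ℚᵘ.- mkℚᵘ a 0             ≃⟨ ℚᵘ.-‿cong (toℚᵘ-fromℤ a) ⟨
    ℚᵘ.- toℚᵘ (fromℤ a)       ≃⟨ ℚ.toℚᵘ-homo‿- (fromℤ a) ⟨
    toℚᵘ (- fromℤ a)          ∎)
    where open ℚᵘ.≤-Reasoning

  fromℤ-homomorphism : IsIntegerHomomorphism ℚ.+-*-commutativeRing fromℤ
  fromℤ-homomorphism = record
    { ι-0 = refl ; ι-1 = refl ; ι-+ = fromℤ-+ ; ι-* = fromℤ-* ; ι-neg = fromℤ-neg }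

  open Evaluation ℚ.+-*-commutativeRing fromℤ fromℤ-homomorphism public

  0≤1 : 0ℚ ≤ 1ℚ
  0≤1 = ℚ.*≤* (ℤ.+≤+ ℕ.z≤n)

  0≤fromℤ : ∀ n → 0ℚ ≤ fromℤ (+ n)
  0≤fromℤ zero    = ℚ.≤-refl
  0≤fromℤ (suc n) = subst (0ℚ ≤_) (sym (fromℤ-+ (+ 1) (+ n))) (ℚ.+-mono-≤ 0≤1 (0≤fromℤ n))

  *-nonneg : ∀ {p q} → 0ℚ ≤ p → 0ℚ ≤ q → 0ℚ ≤ p * q
  *-nonneg {p} {q} 0≤p 0≤q = subst (_≤ p * q) (ℚ.*-zeroʳ p)
    (ℚ.*-monoˡ-≤-nonNeg p {{ℚ.nonNegative 0≤p}} 0≤q)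

  +-nonneg : ∀ {p q} → 0ℚ ≤ p → 0ℚ ≤ q → 0ℚ ≤ p + q
  +-nonneg = ℚ.+-mono-≤

  *-mono : ∀ {p p′ q q′} → 0ℚ ≤ p → 0ℚ ≤ q′ → p ≤ p′ → q ≤ q′ → p * q ≤ p′ * q′
  *-mono {p} {p′} {q} {q′} 0≤p 0≤q′ p≤p′ q≤q′ = ℚ.≤-trans
    (ℚ.*-monoˡ-≤-nonNeg p {{ℚ.nonNegative 0≤p}} q≤q′)
    (ℚ.*-monoʳ-≤-nonNeg q′ {{ℚ.nonNegative 0≤q′}} p≤p′)

  *-pos : ∀ {p q} → 0ℚ < p → 0ℚ < q → 0ℚ < p * q
  *-pos {p} {q} 0<p 0<q = subst (_< p * q) (ℚ.*-zeroʳ p) (ℚ.*-monoʳ-<-pos p {{ℚ.positive 0<p}} 0<q)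

  ≤-from-difference : ∀ {p q} → 0ℚ ≤ q - p → p ≤ q
  ≤-from-difference {p} {q} 0≤ = subst₂ _≤_ (ℚ.+-identityʳ p) eq (ℚ.+-monoʳ-≤ p 0≤)
    where
    eq : p + (q - p) ≡ q
    eq = trans (cong (λ t → p + t) (ℚ.+-comm q (- p)))
      (trans (sym (ℚ.+-assoc p (- p) q)) (trans (cong (_+ q) (ℚ.+-inverseʳ p)) (ℚ.+-identityˡ q)))

  difference-nonneg : ∀ {p q} → p ≤ q → 0ℚ ≤ q - p
  difference-nonneg {p} {q} p≤q = subst (_≤ q - p) (ℚ.+-inverseʳ p) (ℚ.+-monoˡ-≤ (- p) p≤q)

  isNonNegℤ : ℤ → Bool
  isNonNegℤ (+ _)    = true
  isNonNegℤ -[1+ _ ] = false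

  isNonNeg : ∀ {n} → Pol n → Bool
  isNonNeg {zero}  c       = isNonNegℤ c
  isNonNeg {suc n} []      = true
  isNonNeg {suc n} (a ∷ p) = isNonNeg a ∧ isNonNeg p

  NonNegVec : ∀ {n} → Vec ℚ n → Set
  NonNegVec ρ = ∀ i → 0ℚ ≤ lookup ρ i

  infixr 5 _∷⁺_
  _∷⁺_ : ∀ {n x} {ρ : Vec ℚ n} → 0ℚ ≤ x → NonNegVec ρ → NonNegVec (x ∷ ρ)
  (p ∷⁺ ps) zero    = p
  (p ∷⁺ ps) (suc i) = ps i

  []⁺ : NonNegVec []
  []⁺ ()

  value-nonneg : ∀ {n} (p : Pol n) ρ → isNonNeg p ≡ true → NonNegVec ρ → 0ℚ ≤ value p ρ
  value-nonneg {zero}  (+ c)   ρ       eq 0≤ρ = 0≤fromℤ c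
  value-nonneg {suc n} []      ρ       eq 0≤ρ = ℚ.≤-refl
  value-nonneg {suc n} (a ∷ p) (x ∷ ρ) eq 0≤ρ with isNonNeg a in eqa | isNonNeg p in eqp
  ... | true | true = +-nonneg (value-nonneg a ρ eqa (λ i → 0≤ρ (suc i)))
    (*-nonneg (0≤ρ zero) (value-nonneg p (x ∷ ρ) eqp 0≤ρ))

  -- Up to a combination of the relations, f - e has nonnegative coefficients only, and all
  -- arguments are nonnegative.
  positivity : ∀ {n} (e f : Expr n) (cs : List (Expr n × Expr n)) →
    isNonNeg (normalise (f :- e :- combination cs)) ≡ true →
    ∀ ρ → NonNegVec ρ → All (λ cl → ⟦ proj₂ cl ⟧ ρ ≡ 0ℚ) cs → ⟦ e ⟧ ρ ≤ ⟦ f ⟧ ρ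
  positivity e f cs eq ρ 0≤ρ zs = ≤-from-difference (subst (0ℚ ≤_) same
    (value-nonneg (normalise (f :- e :- combination cs)) ρ eq 0≤ρ))
    where
    open ≡-Reasoning
    same : value (normalise (f :- e :- combination cs)) ρ ≡ ⟦ f ⟧ ρ - ⟦ e ⟧ ρ
    same = begin
      value (normalise (f :- e :- combination cs)) ρ ≡⟨ correct (f :- e :- combination cs) ρ ⟩
      ⟦ f ⟧ ρ - ⟦ e ⟧ ρ - ⟦ combination cs ⟧ ρ
        ≡⟨ cong (λ t → ⟦ f ⟧ ρ - ⟦ e ⟧ ρ - t) (combination-vanishes cs ρ zs) ⟩
      ⟦ f ⟧ ρ - ⟦ e ⟧ ρ - 0ℚ                         ≡⟨ ℚ.+-identityʳ _ ⟩
      ⟦ f ⟧ ρ - ⟦ e ⟧ ρ                              ∎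

  isMonotone : ∀ {n} → Expr n → Bool
  isMonotone (var i)  = true
  isMonotone (con c)  = isNonNegℤ c
  isMonotone (e :+ f) = isMonotone e ∧ isMonotone f
  isMonotone (e :* f) = isMonotone e ∧ isMonotone f
  isMonotone (:- e)   = false

  ⟦⟧-nonneg : ∀ {n} (e : Expr n) ρ → isMonotone e ≡ true → NonNegVec ρ → 0ℚ ≤ ⟦ e ⟧ ρ
  ⟦⟧-nonneg (var i)     ρ eq 0≤ρ = 0≤ρ i
  ⟦⟧-nonneg (# c) ρ eq 0≤ρ = 0≤fromℤ c
  ⟦⟧-nonneg (e :+ f)    ρ eq 0≤ρ with isMonotone e in eqe | isMonotone f in eqf
  ... | true | true = +-nonneg (⟦⟧-nonneg e ρ eqe 0≤ρ) (⟦⟧-nonneg f ρ eqf 0≤ρ)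
  ⟦⟧-nonneg (e :* f)    ρ eq 0≤ρ with isMonotone e in eqe | isMonotone f in eqf
  ... | true | true = *-nonneg (⟦⟧-nonneg e ρ eqe 0≤ρ) (⟦⟧-nonneg f ρ eqf 0≤ρ)

  ⟦⟧-mono : ∀ {n} (e : Expr n) ρ ρ′ → isMonotone e ≡ true → NonNegVec ρ → Pointwise _≤_ ρ ρ′ → ⟦ e ⟧ ρ ≤ ⟦ e ⟧ ρ′
  ⟦⟧-mono (var i)     ρ ρ′ eq 0≤ρ ρ≤ρ′ = Pointwise.lookup ρ≤ρ′ i
  ⟦⟧-mono (con c)     ρ ρ′ eq 0≤ρ ρ≤ρ′ = ℚ.≤-refl
  ⟦⟧-mono (e :+ f)    ρ ρ′ eq 0≤ρ ρ≤ρ′ with isMonotone e in eqe | isMonotone f in eqf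
  ... | true | true = ℚ.+-mono-≤ (⟦⟧-mono e ρ ρ′ eqe 0≤ρ ρ≤ρ′) (⟦⟧-mono f ρ ρ′ eqf 0≤ρ ρ≤ρ′)
  ⟦⟧-mono (e :* f)    ρ ρ′ eq 0≤ρ ρ≤ρ′ with isMonotone e in eqe | isMonotone f in eqf
  ... | true | true = *-mono (⟦⟧-nonneg e ρ eqe 0≤ρ)
    (⟦⟧-nonneg f ρ′ eqf (λ i → ℚ.≤-trans (0≤ρ i) (Pointwise.lookup ρ≤ρ′ i)))
    (⟦⟧-mono e ρ ρ′ eqe 0≤ρ ρ≤ρ′) (⟦⟧-mono f ρ ρ′ eqf 0≤ρ ρ≤ρ′)

  archimedean : ∀ q → ∃ λ n → q < fromℤ (+ n)
  archimedean q@(mkℚ -[1+ _ ] _ _) = 0 , ℚ.negative⁻¹ q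
  archimedean q@(mkℚ (+ i) d c) = suc i , ℚ.toℚᵘ-cancel-< (begin-strict
    mkℚᵘ (+ i) d            <⟨ ℚᵘ.*<* bound ⟩
    mkℚᵘ (+ suc i) 0        ≃⟨ toℚᵘ-fromℤ (+ suc i) ⟨
    toℚᵘ (fromℤ (+ suc i))  ∎)
    where
    open ℚᵘ.≤-Reasoning
    bound : + i ℤ.* + 1 ℤ.< + suc i ℤ.* + suc d
    bound = subst₂ ℤ._<_ (ℤ.pos-* i 1) (ℤ.pos-* (suc i) (suc d)) (ℤ.+<+ (subst (ℕ._< suc i ℕ.* suc d) (sym (ℕ.*-identityʳ i)) (ℕ.m≤m*n (suc i) (suc d))))

  -- Super- and subharmonic test functions

  open Operator _+_ 0ℚ public
  open Homomorphism ℕ._+_ 0 _+_ 0ℚ (λ n → fromℤ (+ n)) (λ m n → fromℤ-+ (+ m) (+ n)) refl using (φ-homo)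

  countℚ : ℕ → ℕ → ℚ
  countℚ n k = fromℤ (+ count n k)

  countℚ-suc : ∀ n k → countℚ (suc n) k ≡ φ (countℚ n) k
  countℚ-suc n k = φ-homo (count n) k

  module _ {G H : ℕ → ℚ} (G≤H : ∀ k → G k ≤ H k) where
    ψ-mono : ∀ k → ψ G k ≤ ψ H k
    ψ-mono zero    = G≤H 1
    ψ-mono (suc k) = ℚ.+-mono-≤ (ψ-mono k) (G≤H _)

    Ψ-mono : ∀ k → Ψ G k ≤ Ψ H k
    Ψ-mono zero    = ℚ.≤-refl
    Ψ-mono (suc k) = ℚ.+-mono-≤ (Ψ-mono k) (ψ-mono (suc k))

    φ-mono : ∀ k → φ G k ≤ φ H k
    φ-mono zero    = ℚ.+-mono-≤ (G≤H 3) (G≤H 2)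
    φ-mono (suc k) = ℚ.+-mono-≤ (φ-mono k) (ℚ.+-mono-≤ (ℚ.+-mono-≤ (G≤H _) (G≤H _)) (Ψ-mono (suc k)))

  φ-scale : ∀ c H k → c * φ H k ≡ φ (λ i → c * H i) k
  φ-scale c H k = Homomorphism.φ-homo _+_ 0ℚ _+_ 0ℚ (c *_) (ℚ.*-distribˡ-+ c) (ℚ.*-zeroʳ c) H k

  φ-nonneg : ∀ {H} → (∀ k → 0ℚ ≤ H k) → ∀ k → 0ℚ ≤ φ H k
  φ-nonneg {H} 0≤H k = subst (_≤ φ H k) zero-φ (φ-mono {λ _ → 0ℚ} 0≤H k)
    where
    zero-φ : φ (λ _ → 0ℚ) k ≡ 0ℚ
    zero-φ = trans (cong (λ f → φ f k) refl) (trans (sym (φ-scale 0ℚ (λ _ → 0ℚ) k)) (ℚ.*-zeroˡ (φ (λ _ → 0ℚ) k)))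

  ^ℚ-nonneg : ∀ {r} n → 0ℚ ≤ r → 0ℚ ≤ r ^ℚ n
  ^ℚ-nonneg zero    0≤r = 0≤1
  ^ℚ-nonneg (suc n) 0≤r = *-nonneg 0≤r (^ℚ-nonneg n 0≤r)

  -- φ is linear and monotone, so the comparison with `count zero`, which is constantly 1,
  -- propagates to every n. The argument for `subharmonic` is dual.
  superharmonic : ∀ {H S} → 0ℚ ≤ S → (∀ k → 1ℚ ≤ H k) → (∀ k → φ H k ≤ S * H k) →
    ∀ n k → countℚ n k ≤ S ^ℚ n * H k
  superharmonic {H} {S} 0≤S 1≤H φH≤SH zero    k = subst (1ℚ ≤_) (sym (ℚ.*-identityˡ (H k))) (1≤H k)
  superharmonic {H} {S} 0≤S 1≤H φH≤SH (suc n) k = begin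
    countℚ (suc n) k           ≡⟨ countℚ-suc n k ⟩
    φ (countℚ n) k             ≤⟨ φ-mono (superharmonic 0≤S 1≤H φH≤SH n) k ⟩
    φ (λ i → S ^ℚ n * H i) k   ≡⟨ φ-scale (S ^ℚ n) H k ⟨
    S ^ℚ n * φ H k             ≤⟨ *-mono (^ℚ-nonneg n 0≤S) (ℚ.≤-trans (φ-nonneg 0≤H k) (φH≤SH k)) ℚ.≤-refl (φH≤SH k) ⟩
    S ^ℚ n * (S * H k)         ≡⟨ ℚ.*-assoc (S ^ℚ n) S (H k) ⟨
    S ^ℚ n * S * H k           ≡⟨ cong (_* H k) (ℚ.*-comm (S ^ℚ n) S) ⟩
    S ^ℚ suc n * H k           ∎
    where
    open ℚ.≤-Reasoning
    0≤H : ∀ i → 0ℚ ≤ H i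
    0≤H i = ℚ.≤-trans 0≤1 (1≤H i)

  subharmonic : ∀ {W : ℕ → ℚ} {S M} → 0ℚ ≤ S → (∀ k → W k ≤ M) → (∀ k → S * W k ≤ φ W k) →
    ∀ n k → S ^ℚ n * W k ≤ M * countℚ n k
  subharmonic {W} {S} {M} 0≤S W≤M SW≤φW zero    k =
    subst₂ _≤_ (sym (ℚ.*-identityˡ (W k))) (sym (ℚ.*-identityʳ M)) (W≤M k)
  subharmonic {W} {S} {M} 0≤S W≤M SW≤φW (suc n) k = begin
    S ^ℚ suc n * W k           ≡⟨ cong (_* W k) (ℚ.*-comm S (S ^ℚ n)) ⟩
    S ^ℚ n * S * W k           ≡⟨ ℚ.*-assoc (S ^ℚ n) S (W k) ⟩
    S ^ℚ n * (S * W k)         ≤⟨ ℚ.*-monoˡ-≤-nonNeg (S ^ℚ n) {{ℚ.nonNegative (^ℚ-nonneg n 0≤S)}} (SW≤φW k) ⟩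
    S ^ℚ n * φ W k             ≡⟨ φ-scale (S ^ℚ n) W k ⟩
    φ (λ i → S ^ℚ n * W i) k   ≤⟨ φ-mono (subharmonic 0≤S W≤M SW≤φW n) k ⟩
    φ (λ i → M * countℚ n i) k ≡⟨ φ-scale M (countℚ n) k ⟨
    M * φ (countℚ n) k         ≡⟨ cong (λ t → M * t) (countℚ-suc n k) ⟨
    M * countℚ (suc n) k       ∎
    where open ℚ.≤-Reasoning

  -- The bump used below is positive only above state 3, which one shrub prepended to the empty word
  -- cannot exceed. The path 0 → 3 → 6 reaches its support with two shrubs.
  count-two-steps : ∀ n → count n 6 ℕ.≤ count (2 ℕ.+ n) 0
  count-two-steps n = begin
    count n 6            ≤⟨ ℕ.m≤m+n _ _ ⟩
    count n 6 ℕ.+ count n 5 ≤⟨ ℕ.m≤m+n _ _ ⟩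
    count n 6 ℕ.+ count n 5 ℕ.+ Counting.Ψ (count n) 3 ≤⟨ ℕ.m≤n+m _ (Counting.φ (count n) 2) ⟩
    count (suc n) 3      ≤⟨ ℕ.m≤m+n _ _ ⟩
    count (2 ℕ.+ n) 0    ∎
    where open ℕ.≤-Reasoning

  fromℕ-mono : ∀ {m n} → m ℕ.≤ n → fromℤ (+ m) ≤ fromℤ (+ n)
  fromℕ-mono {m} {n} m≤n = subst₂ _≤_ (ℚ.+-identityʳ (fromℤ (+ m))) eq (ℚ.+-monoʳ-≤ (fromℤ (+ m)) (0≤fromℤ (n ℕ.∸ m)))
    where
    eq : fromℤ (+ m) + fromℤ (+ (n ℕ.∸ m)) ≡ fromℤ (+ n)
    eq = trans (sym (fromℤ-+ (+ m) (+ (n ℕ.∸ m)))) (cong (λ t → fromℤ (+ t)) (ℕ.m+[n∸m]≡n m≤n))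

  -- Eigenvalue of the transfer operator on k ↦ uᵏ away from the boundary, where 1/u + 1/v = 1, and its
  -- images under u d/du and (u d/du)².
  module Rate {n} (u v : Expr n) where
    conjugate rate slope curvature : Expr n
    conjugate = u :* v :- u :- v
    rate      = u :^ 3 :+ # 2 :* u :^ 2 :* v :+ u :* v :^ 3
    slope     = # 3 :* u :^ 3 :+ # 6 :* u :^ 2 :* v :- # 2 :* u :^ 2 :* v :^ 2
      :+ # 4 :* u :* v :^ 3 :- # 3 :* u :* v :^ 4
    curvature = # 9 :* u :^ 3 :+ # 18 :* u :^ 2 :* v :- # 14 :* u :^ 2 :* v :^ 2
      :+ # 4 :* u :^ 2 :* v :^ 3 :+ # 16 :* u :* v :^ 3 :- # 27 :* u :* v :^ 4
      :+ # 12 :* u :* v :^ 5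

  module UpperBound (u v : ℚ) (0≤u : 0ℚ ≤ u) (0≤v : 0ℚ ≤ v)
    (conj : ⟦ Rate.conjugate {2} (var 0F) (var 1F) ⟧ (u ∷ v ∷ []) ≡ 0ℚ) where

    S : ℚ
    S = ⟦ Rate.rate {2} (var 0F) (var 1F) ⟧ (u ∷ v ∷ [])

    0≤S : 0ℚ ≤ S
    0≤S = ⟦⟧-nonneg (Rate.rate {2} (var 0F) (var 1F)) (u ∷ v ∷ []) refl (0≤u ∷⁺ 0≤v ∷⁺ []⁺)

    power : ℕ → ℚ
    power k = u ^ℚ k

    0≤power : ∀ k → 0ℚ ≤ power k
    0≤power k = ^ℚ-nonneg k 0≤u

    module Upper where
      private
        a b c : Expr 3
        a = var 0F
        b = var 1F
        c = var 2F
        module R = Rate a b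

        ρ : ℚ → Vec ℚ 3
        ρ p = u ∷ v ∷ p ∷ []

        0≤ρ : ∀ {p} → 0ℚ ≤ p → NonNegVec (ρ p)
        0≤ρ 0≤p = 0≤u ∷⁺ 0≤v ∷⁺ 0≤p ∷⁺ []⁺

        one : Expr 3
        one = # 1

      -- The factors uv, uv² and S for ψ, Ψ and φ are those of geometric sums extended down to -∞,
      -- as v = u/(u - 1). Hence the induction steps are identities modulo uv = u + v, and
      -- truncation is felt only at k = 0.
      ψ-power : ∀ k → ψ power k ≤ ⟦ a :* b :* c ⟧ (ρ (power k))
      ψ-power zero    = positivity (a :* one) (a :* b :* one) ((one , R.conjugate) ∷ []) refl (ρ 1ℚ) (0≤ρ 0≤1) (conj ∷ [])
      ψ-power (suc k) = ℚ.≤-trans (ℚ.+-monoˡ-≤ (power (2 ℕ.+ k)) (ψ-power k))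
        (positivity (a :* b :* c :+ a :* (a :* c)) (a :* b :* (a :* c)) ((a :* c , R.conjugate) ∷ []) refl
          (ρ (power k)) (0≤ρ (0≤power k)) (conj ∷ []))

      Ψ-power : ∀ k → Ψ power k ≤ ⟦ a :* b :* b :* c ⟧ (ρ (power k))
      Ψ-power zero    = positivity (# 0) (a :* b :* b :* one) [] refl (ρ 1ℚ) (0≤ρ 0≤1) []
      Ψ-power (suc k) = ℚ.≤-trans (ℚ.+-mono-≤ (Ψ-power k) (ψ-power (suc k)))
        (positivity (a :* b :* b :* c :+ a :* b :* (a :* c)) (a :* b :* b :* (a :* c)) ((a :* b :* c , R.conjugate) ∷ []) refl
          (ρ (power k)) (0≤ρ (0≤power k)) (conj ∷ []))

      φ-power : ∀ k → φ power k ≤ S * power k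
      φ-power zero    = positivity (a :* (a :* (a :* one)) :+ a :* (a :* one)) (R.rate :* one) ((a , R.conjugate) ∷ []) refl
        (ρ 1ℚ) (0≤ρ 0≤1) (conj ∷ [])
      φ-power (suc k) = ℚ.≤-trans
        (ℚ.+-mono-≤ (φ-power k) (ℚ.+-monoʳ-≤ (power (4 ℕ.+ k) + power (3 ℕ.+ k)) (Ψ-power (suc k))))
        (positivity (R.rate :* c :+ (a :* (a :* (a :* (a :* c))) :+ a :* (a :* (a :* c)) :+ a :* b :* b :* (a :* c)))
          (R.rate :* (a :* c)) (((a :* b :^ 2 :+ # 2 :* a :^ 2) :* c , R.conjugate) ∷ []) refl
          (ρ (power k)) (0≤ρ (0≤power k)) (conj ∷ []))

    count-upper : 1ℚ ≤ u → ∀ n → countℚ n 0 ≤ S ^ℚ n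
    count-upper 1≤u n = subst (countℚ n 0 ≤_) (ℚ.*-identityʳ (S ^ℚ n)) (superharmonic 0≤S 1≤power Upper.φ-power n 0)
      where
      1≤power : ∀ k → 1ℚ ≤ power k
      1≤power zero    = ℚ.≤-refl
      1≤power (suc k) = subst (_≤ power (suc k)) (ℚ.*-identityˡ 1ℚ) (*-mono 0≤1 (0≤power k) 1≤u (1≤power k))

  -- The bump k ↦ uᵏ (k − 3)(l − k), truncated at 0: starting from k ≤ 0 one shrub never reaches the
  -- region k > 3, so truncating the sums at 1 only discards nonpositive terms.
  index : ℕ → ℚ
  index zero    = 0ℚ
  index (suc k) = 1ℚ + index k

  index-nonneg : ∀ k → 0ℚ ≤ index k
  index-nonneg zero    = ℚ.≤-refl
  index-nonneg (suc k) = +-nonneg 0≤1 (index-nonneg k)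

  index-+ : ∀ a b → index (a ℕ.+ b) ≡ index a + index b
  index-+ zero    b = sym (ℚ.+-identityˡ (index b))
  index-+ (suc a) b = trans (cong (λ t → 1ℚ + t) (index-+ a b)) (sym (ℚ.+-assoc 1ℚ (index a) (index b)))

  module Bump {n} (k l : Expr n) where
    bump bump′ : Expr n
    bump  = (k :- # 3) :* (l :- k)
    bump′ = l :+ # 3 :- # 2 :* k

    -- Let θ = u d/du. An operator that maps uᵏ to g(u)uᵏ maps uᵏf(k) to uᵏ(g f + θg f′ + θ²g f″/2)
    -- for quadratic f, because k acts on uᵏ as θ. For the bump, f″/2 = -1.
    transform : Expr n → Expr n → Expr n → Expr n
    transform g g′ g″ = g :* bump :+ g′ :* bump′ :- g″

  module LowerBound (u v : ℚ) (0≤u : 0ℚ ≤ u) (0≤v : 0ℚ ≤ v)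
    (conj : ⟦ Rate.conjugate {2} (var 0F) (var 1F) ⟧ (u ∷ v ∷ []) ≡ 0ℚ)
    (j : ℕ) (p η σ : ℚ) (0≤p : 0ℚ ≤ p) (0≤η : 0ℚ ≤ η) (0≤σ : 0ℚ ≤ σ) (σ≤η : σ ≤ η)
    (slope≡ : ⟦ Rate.slope {2} (var 0F) (var 1F) ⟧ (u ∷ v ∷ []) ≡ - σ)
    (gap : p + (η + η) ≤ ⟦ Rate.rate {2} (var 0F) (var 1F) ⟧ (u ∷ v ∷ []))
    (0≤curvature : 0ℚ ≤ ⟦ Rate.curvature {2} (var 0F) (var 1F) ⟧ (u ∷ v ∷ []))
    (curvature≤ : ⟦ Rate.curvature {2} (var 0F) (var 1F) ⟧ (u ∷ v ∷ []) ≤ η * (index (7 ℕ.+ j) - fromℤ (+ 5)))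
    where
    private
      l : ℕ
      l = 7 ℕ.+ j

      power : ℕ → ℚ
      power k = u ^ℚ k

      0≤power : ∀ k → 0ℚ ≤ power k
      0≤power k = ^ℚ-nonneg k 0≤u

      R C : ℚ
      R = ⟦ Rate.rate {2} (var 0F) (var 1F) ⟧ (u ∷ v ∷ [])
      C = ⟦ Rate.curvature {2} (var 0F) (var 1F) ⟧ (u ∷ v ∷ [])

      w W : ℕ → ℚ
      w k = power k * ((index k - fromℤ (+ 3)) * (index l - index k))
      W k = 0ℚ ⊔ w k

      0≤W : ∀ k → 0ℚ ≤ W k
      0≤W k = ℚ.p≤p⊔q 0ℚ (w k)

      w≤W : ∀ k → w k ≤ W k
      w≤W k = ℚ.p≤q⊔p 0ℚ (w k)

      u′ v′ P K L : Expr 5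
      u′ = var 0F
      v′ = var 1F
      P  = var 2F
      K  = var 3F
      L  = var 4F

      module T (k : Expr 5) where
        open Bump k L public
        open Rate u′ v′
        t₁ t₂ t₃ : Expr 5
        -- `t₁`, `t₂` and `t₃` belong to ψ, Ψ and φ; their coefficients come from θu = u and θv = v
        -- - v².
        t₁ = transform (u′ :* v′) (# 2 :* u′ :* v′ :- u′ :* v′ :^ 2)
          (# 4 :* u′ :* v′ :- # 5 :* u′ :* v′ :^ 2 :+ # 2 :* u′ :* v′ :^ 3)
        t₂ = transform (u′ :* v′ :^ 2) (# 3 :* u′ :* v′ :^ 2 :- # 2 :* u′ :* v′ :^ 3)
          (# 9 :* u′ :* v′ :^ 2 :- # 14 :* u′ :* v′ :^ 3 :+ # 6 :* u′ :* v′ :^ 4)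
        t₃ = transform rate slope curvature

      one k₁ k₂ k₃ k₄ : Expr 5
      one = # 1
      k₁ = one :+ K
      k₂ = one :+ k₁
      k₃ = one :+ k₂
      k₄ = one :+ k₃

      ρ : ℕ → Vec ℚ 5
      ρ k = u ∷ v ∷ power k ∷ index k ∷ index l ∷ []

      0≤ρ : ∀ k → NonNegVec (ρ k)
      0≤ρ k = 0≤u ∷⁺ 0≤v ∷⁺ 0≤power k ∷⁺ index-nonneg k ∷⁺ index-nonneg l ∷⁺ []⁺

      conjugate : Expr 5
      conjugate = Rate.conjugate u′ v′

      seven : ∀ {n} → Expr n → Expr n
      seven x = o :+ (o :+ (o :+ (o :+ (o :+ (o :+ (o :+ x))))))
        where
        o = # 1

      module Start where
        a b x : Expr 3
        a = var 0F
        b = var 1F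
        x = var 2F
        open Bump {3} (# 0) (seven x) public

      ρ₀ : Vec ℚ 3
      ρ₀ = u ∷ v ∷ index j ∷ []

      0≤ρ₀ : NonNegVec ρ₀
      0≤ρ₀ = 0≤u ∷⁺ 0≤v ∷⁺ index-nonneg j ∷⁺ []⁺

      ψ-lower : ∀ k → ⟦ P :* T.t₁ K ⟧ (ρ k) ≤ ψ W k
      ψ-lower zero = ℚ.≤-trans
        (positivity
          (# 1 :* Start.transform (a :* b) (# 2 :* a :* b :- a :* b :^ 2)
            (# 4 :* a :* b :- # 5 :* a :* b :^ 2 :+ # 2 :* a :* b :^ 3))
          (# 0) [] refl ρ₀ 0≤ρ₀ [])
        (0≤W 1)
        where open Start using (a; b)
      ψ-lower (suc k) = ℚ.≤-trans
        (positivity (u′ :* P :* T.t₁ k₁) (P :* T.t₁ K :+ u′ :* (u′ :* P) :* T.bump k₂)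
          ((:- P :* (con -[1+ 1 ] :* u′ :* v′ :^ 2 :+ # 2 :* u′ :* v′ :* K :- u′ :* v′ :* L
          :+ # 2 :* u′ :* v′ :- u′ :* K :^ 2 :+ u′ :* K :* L :- u′ :* K :- u′ :* L :+ # 2 :* u′) , conjugate) ∷ [])
          refl (ρ k) (0≤ρ k) (conj ∷ []))
        (ℚ.+-mono-≤ (ψ-lower k) (w≤W (2 ℕ.+ k)))

      Ψ-lower : ∀ k → ⟦ P :* T.t₂ K ⟧ (ρ k) ≤ Ψ W k
      Ψ-lower zero =
        positivity
          (# 1 :* Start.transform (a :* b :^ 2) (# 3 :* a :* b :^ 2 :- # 2 :* a :* b :^ 3)
            (# 9 :* a :* b :^ 2 :- # 14 :* a :* b :^ 3 :+ # 6 :* a :* b :^ 4))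
          (# 0) [] refl ρ₀ 0≤ρ₀ []
        where open Start using (a; b)
      Ψ-lower (suc k) = ℚ.≤-trans
        (positivity (u′ :* P :* T.t₂ k₁) (P :* T.t₂ K :+ u′ :* P :* T.t₁ k₁)
          ((:- P :* (con -[1+ 5 ] :* u′ :* v′ :^ 3 :+ # 4 :* u′ :* v′ :^ 2 :* K :- # 2 :* u′ :* v′ :^ 2 :* L
          :+ # 8 :* u′ :* v′ :^ 2 :- u′ :* v′ :* K :^ 2 :+ u′ :* v′ :* K :* L
          :- # 3 :* u′ :* v′ :* K) , conjugate) ∷ [])
          refl (ρ k) (0≤ρ k) (conj ∷ []))
        (ℚ.+-mono-≤ (Ψ-lower k) (ψ-lower (suc k)))

      limit : ℕ → ℚ
      limit k = ⟦ var 0F :* Bump.transform (var 1F) (var 2F) (var 3F) (:- var 4F) (var 5F) ⟧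
        (power k ∷ index k ∷ index l ∷ R ∷ σ ∷ C ∷ [])

      limit≡ : ∀ k → limit k ≡ ⟦ P :* T.t₃ K ⟧ (ρ k)
      limit≡ k = cong (λ s → power k * (R * ((index k - fromℤ (+ 3)) * (index l - index k))
        + s * (index l + fromℤ (+ 3) - fromℤ (+ 2) * index k) - C)) (sym slope≡)

      φ-lower : ∀ k → ⟦ P :* T.t₃ K ⟧ (ρ k) ≤ φ W k
      φ-lower zero = ℚ.≤-trans
        (subst (_≤ 0ℚ) (limit≡ 0)
          (positivity (# 1 :* Bump.transform (# 0) (var 0F) (var 1F) (:- var 2F) (var 3F)) (# 0) [] refl
            (index l ∷ R ∷ σ ∷ C ∷ []) (index-nonneg l ∷⁺ 0≤R ∷⁺ 0≤σ ∷⁺ 0≤curvature ∷⁺ []⁺) []))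
        (+-nonneg (0≤W 3) (0≤W 2))
        where
        0≤R : 0ℚ ≤ R
        0≤R = ⟦⟧-nonneg (Rate.rate {2} (var 0F) (var 1F)) (u ∷ v ∷ []) refl (0≤u ∷⁺ 0≤v ∷⁺ []⁺)
      φ-lower (suc k) = ℚ.≤-trans
        (positivity (u′ :* P :* T.t₃ k₁)
          (P :* T.t₃ K :+ (u′ :* (u′ :* (u′ :* (u′ :* P))) :* T.bump k₄ :+ u′ :* (u′ :* (u′ :* P)) :* T.bump k₃
            :+ u′ :* P :* T.t₂ k₁))
          ((:- P :* (con -[1+ 3 ] :* u′ :^ 2 :* v′ :^ 2 :+ # 4 :* u′ :^ 2 :* v′ :* K
          :- # 2 :* u′ :^ 2 :* v′ :* L :+ # 8 :* u′ :^ 2 :* v′ :- # 2 :* u′ :^ 2 :* K :^ 2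
          :+ # 2 :* u′ :^ 2 :* K :* L :- # 6 :* u′ :^ 2 :* K :- # 12 :* u′ :* v′ :^ 4
          :+ # 6 :* u′ :* v′ :^ 3 :* K :- # 3 :* u′ :* v′ :^ 3 :* L :+ # 18 :* u′ :* v′ :^ 3
          :- u′ :* v′ :^ 2 :* K :^ 2 :+ u′ :* v′ :^ 2 :* K :* L :- # 5 :* u′ :* v′ :^ 2 :* K
          :+ u′ :* v′ :^ 2 :* L :- # 4 :* u′ :* v′ :^ 2) , conjugate) ∷ [])
          refl (ρ k) (0≤ρ k) (conj ∷ []))
        (ℚ.+-mono-≤ (φ-lower k) (ℚ.+-mono-≤ (ℚ.+-mono-≤ (w≤W (4 ℕ.+ k)) (w≤W (3 ℕ.+ k))) (Ψ-lower (suc k))))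

      -- With k = 4 + a and l = 5 + a + b the bump is (1 + a)(1 + b) and its derivative is b - a.
      -- The slope costs at most ηb and the curvature at most η(a + b); the `gap` supplies 2η(1 +
      -- a)(1 + b), which covers both.
      interior : ∀ a b → a ℕ.+ b ≡ 2 ℕ.+ j → p * w (4 ℕ.+ a) ≤ limit (4 ℕ.+ a)
      interior a b a+b = positivity (p′ :* (Q :* B.bump)) (Q :* B.transform R′ (:- σ′) C′)
        ( (Q :* B.bump , gap-relation)
        ∷ (Q :* ((# 2 :* η′ :+ ε) :* (κ :- # 3) :- σ′) :- Q :* η′ , length-relation)
        ∷ (Q , curvature-relation)
        ∷ (Q :* y , slope-relation) ∷ [])
        refl
        (power (4 ℕ.+ a) ∷ index a ∷ index b ∷ index l ∷ R ∷ σ ∷ C ∷ p ∷ η ∷ R - (p + (η + η)) ∷ η - σ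
          ∷ η * (index l - fromℤ (+ 5)) - C ∷ [])
        (0≤power (4 ℕ.+ a) ∷⁺ index-nonneg a ∷⁺ index-nonneg b ∷⁺ index-nonneg l
          ∷⁺ ℚ.≤-trans (+-nonneg 0≤p (+-nonneg 0≤η 0≤η)) gap ∷⁺ 0≤σ ∷⁺ 0≤curvature ∷⁺ 0≤p ∷⁺ 0≤η
          ∷⁺ difference-nonneg gap ∷⁺ difference-nonneg σ≤η ∷⁺ difference-nonneg curvature≤ ∷⁺ []⁺)
        ( identity {9} (var 4F :- var 7F :- # 2 :* var 8F :- (var 4F :- (var 7F :+ (var 8F :+ var 8F)))) (# 0) refl
            (power (4 ℕ.+ a) ∷ index a ∷ index b ∷ index l ∷ R ∷ σ ∷ C ∷ p ∷ η ∷ [])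
        ∷ trans (cong (λ t → t - (fromℤ (+ 5) + index a + index b)) length)
            (identity {2} (# 5 :+ (var 0F :+ var 1F) :- (# 5 :+ var 0F :+ var 1F)) (# 0) refl
              (index a ∷ index b ∷ []))
        ∷ identity {3} (var 0F :* (var 1F :- # 5) :- var 2F :- (var 0F :* (var 1F :- # 5) :- var 2F)) (# 0) refl
            (η ∷ index l ∷ C ∷ [])
        ∷ identity {2} (var 0F :- var 1F :- (var 0F :- var 1F)) (# 0) refl (η ∷ σ ∷ []) ∷ [])
        where
        Q x y ℓ R′ σ′ C′ p′ η′ ε τ ω κ : Expr 12
        Q  = var 0F
        x  = var 1F
        y  = var 2F
        ℓ  = var 3F
        R′ = var 4F
        σ′ = var 5F
        C′ = var 6F
        p′ = var 7F
        η′ = var 8F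
        ε  = var 9F
        τ  = var (Fin.suc 9F)
        ω  = var (Fin.suc (Fin.suc 9F))
        κ  = # 1 :+ (# 1 :+ (# 1 :+ (# 1 :+ x)))
        module B = Bump κ ℓ
        gap-relation length-relation curvature-relation slope-relation : Expr 12
        gap-relation       = R′ :- p′ :- # 2 :* η′ :- ε
        length-relation    = ℓ :- (# 5 :+ x :+ y)
        curvature-relation = η′ :* (ℓ :- # 5) :- C′ :- ω
        slope-relation     = η′ :- σ′ :- τ
        length : index l ≡ fromℤ (+ 5) + (index a + index b)
        length = trans (cong (λ t → index (5 ℕ.+ t)) (sym a+b))
          (trans (index-+ 5 (a ℕ.+ b)) (cong (λ t → fromℤ (+ 5) + t) (index-+ a b)))

      left : ∀ a b → a ℕ.+ b ≡ 3 → p * w a ≤ 0ℚ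
      left a b a+b = positivity (q :* (Q :* Bump.bump k ℓ)) (# 0)
        ((:- q :* Q :* (ℓ :- k) , r₁) ∷ (q :* Q :* x , r₂) ∷ []) refl
        (p ∷ power a ∷ index a ∷ index b ∷ index l ∷ index (l ℕ.∸ a) ∷ [])
        (0≤p ∷⁺ 0≤power a ∷⁺ index-nonneg a ∷⁺ index-nonneg b ∷⁺ index-nonneg l ∷⁺ index-nonneg (l ℕ.∸ a) ∷⁺ []⁺)
        ( trans (cong (λ t → t - fromℤ (+ 3)) (trans (sym (index-+ a b)) (cong index a+b))) refl
        ∷ trans (cong (λ t → t - index a - index (l ℕ.∸ a)) (trans (cong index (sym (ℕ.m+[n∸m]≡n a≤l))) (index-+ a (l ℕ.∸ a))))
            (identity {2} (var 0F :+ var 1F :- var 0F :- var 1F) (# 0) refl (index a ∷ index (l ℕ.∸ a) ∷ [])) ∷ [])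
        where
        q Q k x ℓ y r₁ r₂ : Expr 6
        q = var 0F
        Q = var 1F
        k = var 2F
        x = var 3F
        ℓ = var 4F
        y = var 5F
        r₁ = k :+ x :- # 3
        r₂ = ℓ :- k :- y
        a≤l : a ℕ.≤ l
        a≤l = ℕ.≤-trans (subst (a ℕ.≤_) a+b (ℕ.m≤m+n a b)) (s≤s (s≤s (s≤s z≤n)))

      right : ∀ s i → 0ℚ ≤ s → s * w (l ℕ.+ i) ≤ 0ℚ
      right s i 0≤s = positivity (q :* (Q :* Bump.bump k ℓ)) (# 0)
        ((q :* Q :* (k :- # 3 :+ y) , r) ∷ []) refl
        (s ∷ power (l ℕ.+ i) ∷ index (l ℕ.+ i) ∷ index (4 ℕ.+ j) ∷ index i ∷ [])
        (0≤s ∷⁺ 0≤power (l ℕ.+ i) ∷⁺ index-nonneg (l ℕ.+ i) ∷⁺ index-nonneg (4 ℕ.+ j) ∷⁺ index-nonneg i ∷⁺ []⁺)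
        (trans (cong (λ t → t - index l - index i) (index-+ l i))
          (identity {2} (var 0F :+ var 1F :- var 0F :- var 1F) (# 0) refl (index l ∷ index i ∷ [])) ∷ [])
        where
        q Q k x ℓ y r : Expr 5
        q = var 0F
        Q = var 1F
        k = var 2F
        x = var 3F
        ℓ = # 1 :+ (# 1 :+ (# 1 :+ x))
        y = var 4F
        r = k :- ℓ :- y

      p*w≤φW : ∀ k → p * w k ≤ φ W k
      p*w≤φW 0 = ℚ.≤-trans (left 0 3 refl) (φ-nonneg 0≤W 0)
      p*w≤φW 1 = ℚ.≤-trans (left 1 2 refl) (φ-nonneg 0≤W 1)
      p*w≤φW 2 = ℚ.≤-trans (left 2 1 refl) (φ-nonneg 0≤W 2)
      p*w≤φW 3 = ℚ.≤-trans (left 3 0 refl) (φ-nonneg 0≤W 3)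
      p*w≤φW k@(suc (suc (suc (suc a)))) with a ℕ.≤? 2 ℕ.+ j
      ... | yes a≤ = ℚ.≤-trans (interior a _ (ℕ.m+[n∸m]≡n a≤)) (subst (_≤ φ W k) (sym (limit≡ k)) (φ-lower k))
      ... | no  a≰ = ℚ.≤-trans
        (subst (λ t → p * w t ≤ 0ℚ) (cong (4 ℕ.+_) (ℕ.m+[n∸m]≡n (ℕ.≰⇒> a≰))) (right p (a ℕ.∸ (3 ℕ.+ j)) 0≤p))
        (φ-nonneg 0≤W k)

      p*W≤φW : ∀ k → p * W k ≤ φ W k
      p*W≤φW k with ℚ.⊔-sel 0ℚ (w k)
      ... | inj₁ W≡0 = subst (_≤ φ W k) (sym (trans (cong (λ t → p * t) W≡0) (ℚ.*-zeroʳ p))) (φ-nonneg 0≤W k)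
      ... | inj₂ W≡w = subst (_≤ φ W k) (sym (cong (λ t → p * t) W≡w)) (p*w≤φW k)

      total : ℕ → ℚ
      total zero    = 0ℚ
      total (suc m) = total m + W m

      0≤total : ∀ m → 0ℚ ≤ total m
      0≤total zero    = ℚ.≤-refl
      0≤total (suc m) = +-nonneg (0≤total m) (0≤W m)

      W≤total : ∀ m k → k ℕ.< m → W k ≤ total m
      W≤total (suc m) k (s≤s k≤m) with ℕ.m≤n⇒m<n∨m≡n k≤m
      ... | inj₁ k<m  = subst (_≤ total m + W m) (ℚ.+-identityʳ (W k)) (ℚ.+-mono-≤ (W≤total m k k<m) (0≤W m))
      ... | inj₂ refl = subst (_≤ total m + W m) (ℚ.+-identityˡ (W k)) (ℚ.+-monoˡ-≤ (W k) (0≤total m))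

      W≤M : ∀ k → W k ≤ total l
      W≤M k with k ℕ.<? l
      ... | yes k<l = W≤total l k k<l
      ... | no  k≮l = ℚ.⊔-lub (0≤total l) (ℚ.≤-trans
        (subst (_≤ 0ℚ) (trans (ℚ.*-identityˡ (w (l ℕ.+ (k ℕ.∸ l)))) (cong w (ℕ.m+[n∸m]≡n (ℕ.≮⇒≥ k≮l))))
          (right 1ℚ (k ℕ.∸ l) 0≤1))
        (0≤total l))

    mass : ℚ
    mass = total l

    0≤mass : 0ℚ ≤ mass
    0≤mass = 0≤total l

    count-lower : 1ℚ ≤ u → ∀ n → p ^ℚ n ≤ mass * countℚ (2 ℕ.+ n) 0
    count-lower 1≤u n = begin
      p ^ℚ n                          ≡⟨ ℚ.*-identityʳ (p ^ℚ n) ⟨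
      p ^ℚ n * 1ℚ                     ≤⟨ *-mono (^ℚ-nonneg n 0≤p) (0≤W 6) ℚ.≤-refl 1≤W₆ ⟩
      p ^ℚ n * W 6                    ≤⟨ subharmonic 0≤p W≤M p*W≤φW n 6 ⟩
      mass * countℚ n 6              ≤⟨ *-mono 0≤mass (0≤fromℤ (count (2 ℕ.+ n) 0)) ℚ.≤-refl (fromℕ-mono (count-two-steps n)) ⟩
      mass * countℚ (2 ℕ.+ n) 0      ∎
      where
      open ℚ.≤-Reasoning
      1≤power : ∀ k → 1ℚ ≤ power k
      1≤power zero    = ℚ.≤-refl
      1≤power (suc k) = subst (_≤ power (suc k)) (ℚ.*-identityˡ 1ℚ) (*-mono 0≤1 (0≤power k) 1≤u (1≤power k))
      1≤bump : 1ℚ ≤ (index 6 - fromℤ (+ 3)) * (index l - index 6)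
      1≤bump = positivity {1} (# 1) ((# 6 :- # 3) :* (seven (var 0F) :- # 6)) [] refl
        (index j ∷ []) (index-nonneg j ∷⁺ []⁺) []
      1≤W₆ : 1ℚ ≤ W 6
      1≤W₆ = ℚ.≤-trans (subst (_≤ w 6) (ℚ.*-identityˡ 1ℚ) (*-mono 0≤1 (ℚ.≤-trans 0≤1 1≤bump) (1≤power 6) 1≤bump)) (w≤W 6)

  -- Rational points close to the minimum of the rate

  index≡fromℤ : ∀ n → index n ≡ fromℤ (+ n)
  index≡fromℤ zero    = refl
  index≡fromℤ (suc n) = trans (cong (λ t → 1ℚ + t) (index≡fromℤ n)) (sym (fromℤ-+ (+ 1) (+ n)))

  archimedean-index : ∀ q → ∃ λ n → q ≤ index n
  archimedean-index q with archimedean q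
  ... | n , q<n = n , ℚ.≤-trans (ℚ.<⇒≤ q<n) (ℚ.≤-reflexive (sym (index≡fromℤ n)))

  inverse : ∀ q → 0ℚ < q → Σ ℚ λ r → q * r ≡ 1ℚ × 0ℚ < r
  inverse q 0<q = 1/ q , ℚ.*-inverseʳ q , ℚ.positive⁻¹ (1/ q) {{ℚ.1/pos⇒pos q}}
    where
    instance
      q-pos : ℚ.Positive q
      q-pos = ℚ.positive 0<q
      q-nonZero : ℚ.NonZero q
      q-nonZero = ℚ.pos⇒nonZero q

  0<fromℤ : ∀ n → 0ℚ < fromℤ (+ suc n)
  0<fromℤ n = ℚ.<-≤-trans {0ℚ} {1ℚ} (toWitness {a? = 0ℚ ℚ.<? 1ℚ} tt) (fromℕ-mono {1} {suc n} (s≤s z≤n))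

  neg-≤ : ∀ {a b} → 0ℚ ≤ a + b → - a ≤ b
  neg-≤ {a} {b} le = ≤-from-difference (subst (0ℚ ≤_)
    (identity {2} (var 0F :+ var 1F) (var 1F :- :- var 0F) refl (a ∷ b ∷ [])) le)

  -- For u = 1 + y and v = 1 + 1/y, the slope of the rate is (1 + y)³y⁻⁴ times this polynomial.
  slopeFactor : ∀ {n} → Expr n → Expr n
  slopeFactor y = # 3 :* y :^ 4 :+ # 4 :* y :^ 3 :- y :^ 2 :- # 2 :* y :- # 3

  N : ℚ → ℚ
  N y = ⟦ slopeFactor {1} (var 0F) ⟧ (y ∷ [])

  -- In the polynomial certificates 1/100 is a variable subject to `100 * percent = 1`, which keeps
  -- every coefficient an integer.
  percent : ℚ
  percent = + 1 / 100

  -- A discrete intermediate value theorem. The zero of `N` is irrational, so neighbouring grid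
  -- points with opposite signs take its place.
  sign-change : ∀ (f : ℕ → ℚ) m → f 0 ≤ 0ℚ → 0ℚ ≤ f (suc m) → ∃ λ i → i ℕ.≤ m × f i ≤ 0ℚ × 0ℚ ≤ f (suc i)
  sign-change f zero    f₀≤0 0≤f = 0 , z≤n , f₀≤0 , 0≤f
  sign-change f (suc m) f₀≤0 0≤f with ℚ.≤-total 0ℚ (f (suc m))
  ... | inj₂ f≤0  = suc m , ℕ.≤-refl , f≤0 , 0≤f
  ... | inj₁ 0≤f′ with sign-change f m f₀≤0 0≤f′
  ...   | i , i≤m , p , q = i , ℕ.m≤n⇒m≤1+n i≤m , p , q

  -- The critical point of the rate is u = 1 + y with y ≈ 0.9459, inside the interval [94/100, 95/100].
  module Grid (m : ℕ) (H : ℚ) (0≤H : 0ℚ ≤ H) (mesh : index (suc m) * H ≡ 1ℚ) where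
    private
      percent-relation : fromℤ (+ 100) * percent - fromℤ (+ 1) ≡ 0ℚ
      percent-relation = refl

      0≤percent : 0ℚ ≤ percent
      0≤percent = toWitness {a? = 0ℚ ℚ.≤? percent} tt

    point : ℕ → ℚ
    point i = (fromℤ (+ 94) + index i * H) * percent

    point-lower : ∀ i → fromℤ (+ 94) ≤ fromℤ (+ 100) * point i
    point-lower i = positivity (# 94) (# 100 :* ((# 94 :+ var 0F :* var 1F) :* var 2F))
      ((# 94 , # 100 :* var 2F :- # 1) ∷ []) refl
      (index i ∷ H ∷ percent ∷ []) (index-nonneg i ∷⁺ 0≤H ∷⁺ 0≤percent ∷⁺ []⁺) (percent-relation ∷ [])

    point-upper : ∀ i → i ℕ.≤ suc m → fromℤ (+ 100) * point i ≤ fromℤ (+ 95)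
    point-upper i i≤ = positivity (# 100 :* ((# 94 :+ var 0F :* var 2F) :* var 3F)) (# 95)
      ((:- (# 94 :+ var 0F :* var 2F) , # 100 :* var 3F :- # 1)
        ∷ (con -[1+ 0 ] , (var 0F :+ var 1F) :* var 2F :- # 1) ∷ []) refl
      (index i ∷ index (suc m ℕ.∸ i) ∷ H ∷ percent ∷ [])
      (index-nonneg i ∷⁺ index-nonneg (suc m ℕ.∸ i) ∷⁺ 0≤H ∷⁺ 0≤percent ∷⁺ []⁺)
      (percent-relation ∷ cong (λ t → t - fromℤ (+ 1)) (trans (cong (_* H) (trans (sym (index-+ i _)) (cong index (ℕ.m+[n∸m]≡n i≤)))) mesh) ∷ [])

    private
      H≤1 : H ≤ 1ℚ
      H≤1 = subst (H ≤_) mesh (positivity (var 0F) ((# 1 :+ var 1F) :* var 0F) [] refl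
        (H ∷ index m ∷ []) (0≤H ∷⁺ index-nonneg m ∷⁺ []⁺) [])

      d : ℚ
      d = H * percent

      0≤d : 0ℚ ≤ d
      0≤d = *-nonneg 0≤H 0≤percent

      increment : Expr 2
      increment = # 12 :* var 0F :^ 3 :+ # 18 :* var 0F :^ 2 :* var 1F :+ # 12 :* var 0F :* var 1F :^ 2
        :+ # 3 :* var 1F :^ 3 :+ # 12 :* var 0F :^ 2 :+ # 12 :* var 0F :* var 1F :+ # 4 :* var 1F :^ 2

    point-nonneg : ∀ i → 0ℚ ≤ point i
    point-nonneg i = *-nonneg (+-nonneg (0≤fromℤ 94) (*-nonneg (index-nonneg i) 0≤H)) 0≤percent

    N-step : ∀ i → i ℕ.≤ m → N (point (suc i)) ≤ N (point i) + H
    N-step i i≤m = begin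
      N (point (suc i))                             ≡⟨ cong N next ⟩
      N (point i + d)                               ≤⟨ positivity (slopeFactor (var 0F :+ var 1F)) (slopeFactor (var 0F) :+ var 1F :* increment)
                                                         [] refl (point i ∷ d ∷ []) (point-nonneg i ∷⁺ 0≤d ∷⁺ []⁺) [] ⟩
      N (point i) + d * ⟦ increment ⟧ (point i ∷ d ∷ []) ≤⟨ ℚ.+-monoʳ-≤ (N (point i)) bound ⟩
      N (point i) + H                               ∎
      where
      open ℚ.≤-Reasoning
      next : point (suc i) ≡ point i + d
      next = identity {3} ((# 94 :+ (# 1 :+ var 0F) :* var 1F) :* var 2F)
        ((# 94 :+ var 0F :* var 1F) :* var 2F :+ var 1F :* var 2F) refl (index i ∷ H ∷ percent ∷ [])
      point≤1 : point i ≤ 1ℚ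
      point≤1 = ℚ.*-cancelˡ-≤-pos (fromℤ (+ 100)) (ℚ.≤-trans (point-upper i (ℕ.m≤n⇒m≤1+n i≤m)) (fromℕ-mono {95} {100} (ℕ.m≤n+m 95 5)))
      d≤1 : d ≤ 1ℚ
      d≤1 = *-mono {q′ = 1ℚ} 0≤H 0≤1 H≤1 (toWitness {a? = percent ℚ.≤? 1ℚ} tt)
      bound : d * ⟦ increment ⟧ (point i ∷ d ∷ []) ≤ H
      bound = ℚ.≤-trans
        (*-mono 0≤d (⟦⟧-nonneg increment (1ℚ ∷ 1ℚ ∷ []) refl (0≤1 ∷⁺ 0≤1 ∷⁺ []⁺)) ℚ.≤-refl
          (⟦⟧-mono increment (point i ∷ d ∷ []) (1ℚ ∷ 1ℚ ∷ []) refl (point-nonneg i ∷⁺ 0≤d ∷⁺ []⁺) (point≤1 ∷ d≤1 ∷ [])))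
        -- 73 is the value of `increment` at (1, 1), and the grid spacing is H/100, so one step
        -- raises `N` by at most 73H/100.
        (positivity (var 0F :* var 1F :* # 73) (var 0F) ((:- var 0F , # 100 :* var 1F :- # 1) ∷ []) refl
          (H ∷ percent ∷ []) (0≤H ∷⁺ 0≤percent ∷⁺ []⁺) (percent-relation ∷ []))

    N-start : N (point 0) ≤ 0ℚ
    N-start = subst (λ t → N t ≤ 0ℚ)
      (identity {2} (# 94 :* var 1F) ((# 94 :+ # 0 :* var 0F) :* var 1F) refl (H ∷ percent ∷ []))
      (positivity (slopeFactor (# 94 :* var 0F)) (# 0)
        ((con -[1+ 2 ] :+ var 0F :* (con -[1+ 487 ] :+ var 0F :* (con -[1+ 57635 ] :+ var 0F :* (con -[1+ 2441263 ]))) , # 100 :* var 0F :- # 1) ∷ [])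
        refl (percent ∷ []) (0≤percent ∷⁺ []⁺) (percent-relation ∷ []))

    N-end : 0ℚ ≤ N (point (suc m))
    N-end = subst (λ t → 0ℚ ≤ N ((fromℤ (+ 94) + t) * percent)) (sym mesh)
      (positivity (# 0) (slopeFactor ((# 94 :+ # 1) :* var 0F))
        ((# 3 :+ var 0F :* (# 490 :+ var 0F :* (# 58025 :+ var 0F :* (# 2373000))) , # 100 :* var 0F :- # 1) ∷ [])
        refl (percent ∷ []) (0≤percent ∷⁺ []⁺) (percent-relation ∷ []))

  record NearCritical (ε : ℚ) : Set where
    field
      y     : ℚ
      lower : fromℤ (+ 94) ≤ fromℤ (+ 100) * y
      upper : fromℤ (+ 100) * y ≤ fromℤ (+ 95)
      0≤-N  : 0ℚ ≤ - N y
      -N≤   : - N y ≤ ε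

  module _ (ε : ℚ) (m : ℕ) (H : ℚ) (0≤H : 0ℚ ≤ H) (mesh : index (suc m) * H ≡ 1ℚ) (H≤ε : H ≤ ε) where
    open Grid m H 0≤H mesh

    near-critical-at : (∃ λ i → i ℕ.≤ m × N (point i) ≤ 0ℚ × 0ℚ ≤ N (point (suc i))) → NearCritical ε
    near-critical-at (i , i≤m , N≤0 , 0≤N) = record
      { y = point i ; lower = point-lower i ; upper = point-upper i (ℕ.m≤n⇒m≤1+n i≤m)
      ; 0≤-N = ℚ.neg-antimono-≤ N≤0
      ; -N≤ = ℚ.≤-trans (neg-≤ (ℚ.≤-trans 0≤N (N-step i i≤m))) H≤ε }

    near-critical-grid : NearCritical ε
    near-critical-grid = near-critical-at (sign-change (λ i → N (point i)) m N-start N-end)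

  mesh-bound : ∀ {ε r I H} → 0ℚ ≤ ε → 0ℚ ≤ H → ε * r ≡ 1ℚ → I * H ≡ 1ℚ → r ≤ I → H ≤ ε
  mesh-bound {ε} {r} {I} {H} 0≤ε 0≤H εr≡1 mesh r≤I = begin
    H             ≡⟨ ℚ.*-identityʳ H ⟨
    H * 1ℚ        ≡⟨ cong (λ t → H * t) εr≡1 ⟨
    H * (ε * r)   ≤⟨ ℚ.*-monoˡ-≤-nonNeg H {{ℚ.nonNegative 0≤H}} (ℚ.*-monoˡ-≤-nonNeg ε {{ℚ.nonNegative 0≤ε}} r≤I) ⟩
    H * (ε * I)   ≡⟨ identity {3} (var 0F :* (var 1F :* var 2F)) (var 1F :* (var 2F :* var 0F)) refl (H ∷ ε ∷ I ∷ []) ⟩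
    ε * (I * H)   ≡⟨ cong (λ t → ε * t) mesh ⟩
    ε * 1ℚ        ≡⟨ ℚ.*-identityʳ ε ⟩
    ε             ∎
    where open ℚ.≤-Reasoning

  near-critical : ∀ ε → 0ℚ < ε → NearCritical ε
  near-critical ε 0<ε = refine (inverse ε 0<ε)
    where
    with-inverse : ∀ r m → ε * r ≡ 1ℚ → r ≤ index m → (Σ ℚ λ H → index (suc m) * H ≡ 1ℚ × 0ℚ < H) → NearCritical ε
    with-inverse r m εr≡1 r≤m (H , mesh , 0<H) = near-critical-grid ε m H (ℚ.<⇒≤ 0<H) mesh
      (mesh-bound (ℚ.<⇒≤ 0<ε) (ℚ.<⇒≤ 0<H) εr≡1 mesh
        (ℚ.≤-trans r≤m (subst (_≤ index (suc m)) (ℚ.+-identityˡ (index m)) (ℚ.+-monoˡ-≤ (index m) 0≤1))))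

    refine : (Σ ℚ λ r → ε * r ≡ 1ℚ × 0ℚ < r) → NearCritical ε
    refine (r , εr≡1 , 0<r) with archimedean-index r
    ... | m , r≤m = with-inverse r m εr≡1 r≤m (inverse (index (suc m))
      (ℚ.<-≤-trans (toWitness {a? = 0ℚ ℚ.<? 1ℚ} tt)
        (subst (_≤ index (suc m)) (ℚ.+-identityʳ 1ℚ) (ℚ.+-monoʳ-≤ 1ℚ (index-nonneg m)))))

  -- The quartic and the values of the rate near its minimum

  difference-zero : ∀ {a b} → a - b ≡ 0ℚ → a ≡ b
  difference-zero {a} {b} eq = trans (identity {2} (var 0F) (var 0F :- var 1F :+ var 1F) refl (a ∷ b ∷ []))
    (trans (cong (_+ b) eq) (ℚ.+-identityˡ b))

  0≤percent : 0ℚ ≤ percent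
  0≤percent = toWitness {a? = 0ℚ ℚ.≤? percent} tt

  percent-relation : fromℤ (+ 100) * percent - fromℤ (+ 1) ≡ 0ℚ
  percent-relation = refl

  -- The nested products ending in 1 follow `_^ℚ_`, so that the value is `growthQuartic` by
  -- definition.
  quartic : ∀ {n} → Expr n → Expr n
  quartic x = # 729 :* (x :* (x :* (x :* (x :* # 1)))) :- # 28674 :* (x :* (x :* (x :* # 1)))
    :- # 15505 :* (x :* (x :* # 1)) :- # 25758 :* x :+ # 621

  secantExpr : ∀ {n} → Expr n → Expr n → Expr n
  secantExpr a b = # 729 :* (a :^ 3 :+ a :^ 2 :* b :+ a :* b :^ 2 :+ b :^ 3)
    :- # 28674 :* (a :^ 2 :+ a :* b :+ b :^ 2) :- # 15505 :* (a :+ b) :- # 25758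

  Secant : ℚ → ℚ → ℚ
  Secant a b = ⟦ secantExpr {2} (var 0F) (var 1F) ⟧ (a ∷ b ∷ [])

  quartic-difference : ∀ a b → growthQuartic b - growthQuartic a ≡ (b - a) * Secant a b
  quartic-difference a b = identity {2} (quartic (var 1F) :- quartic (var 0F))
    ((var 1F :- var 0F) :* secantExpr (var 0F) (var 1F)) refl (a ∷ b ∷ [])

  -- The quartic is negative at 39 and increases from there on: its difference quotient, expanded
  -- around 39, has nonnegative coefficients only.
  base : ℚ
  base = fromℤ (+ 39)

  quartic-base : ∀ x → x ≡ base → growthQuartic x ≤ fromℤ (-[1+ 0 ])
  quartic-base x refl = positivity {1} (quartic (var 0F)) (con -[1+ 0 ])
    ((# 1000056 :+ var 0F :* (# 24982 :+ var 0F :* (# 243 :- # 729 :* var 0F)) , var 0F :- # 39) ∷ [])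
    refl (x ∷ []) (0≤fromℤ 39 ∷⁺ []⁺) (ℚ.+-inverseʳ base ∷ [])

  Secant-nonneg : ∀ {a b} → base ≤ a → base ≤ b → 0ℚ ≤ Secant a b
  Secant-nonneg {a} {b} base≤a base≤b = subst₂ (λ s t → 0ℚ ≤ Secant s t) (shift a) (shift b)
    (positivity {2} (# 0) (secantExpr (# 39 :+ var 0F) (# 39 :+ var 1F)) [] refl
      (a - base ∷ b - base ∷ []) (difference-nonneg base≤a ∷⁺ difference-nonneg base≤b ∷⁺ []⁺) [])
    where
    shift : ∀ x → base + (x - base) ≡ x
    shift x = identity {2} (var 1F :+ (var 0F :- var 1F)) (var 0F) refl (x ∷ base ∷ [])

  quartic-mono : ∀ {a b} → base ≤ a → a ≤ b → growthQuartic a ≤ growthQuartic b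
  quartic-mono {a} {b} base≤a a≤b = ≤-from-difference (subst (0ℚ ≤_) (sym (quartic-difference a b))
    (*-nonneg (difference-nonneg a≤b) (Secant-nonneg base≤a (ℚ.≤-trans base≤a a≤b))))

  -- The cofactor of N(y)² in y¹² times the quartic at S. Its positive coefficients make the quartic
  -- nonnegative at S.
  residue : ∀ {n} → Expr n → Expr n
  residue y = # 81 :+ y :* (# 1188 :+ y :* (# 8694 :+ y :* (# 39486 :+ y :* (
      # 124661 :+ y :* (# 296204 :+ y :* (# 554033 :+ y :* (# 829914 :+ y :* (# 1001620 :+ y :* (
      # 971576 :+ y :* (# 744147 :+ y :* (# 436062 :+ y :* (# 188312 :+ y :* (
      # 57282 :+ y :* (# 11556 :+ y :* (# 1404 :+ y :* (# 81))))))))))))))))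

  module Point {ε : ℚ} (c : NearCritical ε) where
    open NearCritical c public

    private
      s t q : ℚ
      s = fromℤ (+ 100) * y - fromℤ (+ 94)
      t = fromℤ (+ 95) - fromℤ (+ 100) * y
      q = percent

      0≤s : 0ℚ ≤ s
      0≤s = difference-nonneg lower

      0≤t : 0ℚ ≤ t
      0≤t = difference-nonneg upper

    0<y : 0ℚ < y
    0<y = ℚ.≰⇒> λ y≤0 → ℚ.<-irrefl refl (ℚ.<-≤-trans (0<fromℤ 93) (ℚ.≤-trans lower
      (subst (fromℤ (+ 100) * y ≤_) (ℚ.*-zeroʳ (fromℤ (+ 100))) (ℚ.*-monoˡ-≤-nonNeg (fromℤ (+ 100)) y≤0))))

    0≤y : 0ℚ ≤ y
    0≤y = ℚ.<⇒≤ 0<y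

    z : ℚ
    z = proj₁ (inverse y 0<y)

    0≤z : 0ℚ ≤ z
    0≤z = ℚ.<⇒≤ (proj₂ (proj₂ (inverse y 0<y)))

    yz : y * z - fromℤ (+ 1) ≡ 0ℚ
    yz = trans (cong (λ r → r - fromℤ (+ 1)) (proj₁ (proj₂ (inverse y 0<y)))) refl

    -- The curve uv = u + v is parametrised by (u - 1)(v - 1) = 1.
    u v ν : ℚ
    u = 1ℚ + y
    v = 1ℚ + z
    ν = - N y

    0≤u : 0ℚ ≤ u
    0≤u = +-nonneg 0≤1 0≤y

    0≤v : 0ℚ ≤ v
    0≤v = +-nonneg 0≤1 0≤z

    1≤u : 1ℚ ≤ u
    1≤u = subst (_≤ u) (ℚ.+-identityʳ 1ℚ) (ℚ.+-monoʳ-≤ 1ℚ 0≤y)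

    conjugate : ⟦ Rate.conjugate {2} (var 0F) (var 1F) ⟧ (u ∷ v ∷ []) ≡ 0ℚ
    conjugate = consequence {2} (Rate.conjugate (# 1 :+ var 0F) (# 1 :+ var 1F))
      ((# 1 , var 0F :* var 1F :- # 1) ∷ []) refl (y ∷ z ∷ []) (yz ∷ [])

    private
      Y Z Q σ τ r-percent r-yz r-lower r-upper : Expr 5
      Y = var 0F
      Z = var 1F
      Q = var 2F
      σ = var 3F
      τ = var 4F
      r-percent = # 100 :* Q :- # 1
      r-yz      = Y :* Z :- # 1
      r-lower   = σ :- # 100 :* Y :+ # 94
      r-upper   = τ :- # 95 :+ # 100 :* Y

      ρ : Vec ℚ 5
      ρ = y ∷ z ∷ q ∷ s ∷ t ∷ []

      0≤ρ : NonNegVec ρ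
      0≤ρ = 0≤y ∷⁺ 0≤z ∷⁺ 0≤percent ∷⁺ 0≤s ∷⁺ 0≤t ∷⁺ []⁺

      lower-relation : ⟦ r-lower ⟧ ρ ≡ 0ℚ
      lower-relation = identity {1} (# 100 :* var 0F :- # 94 :- # 100 :* var 0F :+ # 94) (# 0) refl (y ∷ [])

      upper-relation : ⟦ r-upper ⟧ ρ ≡ 0ℚ
      upper-relation = identity {1} (# 95 :- # 100 :* var 0F :- # 95 :+ # 100 :* var 0F) (# 0) refl (y ∷ [])

    u-lower : fromℤ (+ 194) * q ≤ u
    u-lower = positivity (# 194 :* Q) (# 1 :+ Y)
      ((:- (# 1 :+ Y) , r-percent) ∷ (:- Q , r-lower) ∷ []) refl ρ 0≤ρ (percent-relation ∷ lower-relation ∷ [])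

    u-upper : u ≤ fromℤ (+ 195) * q
    u-upper = positivity (# 1 :+ Y) (# 195 :* Q)
      ((# 1 :+ Y , r-percent) ∷ (:- Q , r-upper) ∷ []) refl ρ 0≤ρ (percent-relation ∷ upper-relation ∷ [])

    -- The bounds 2.05 and 2.07 on v come from 1/0.95 > 1.05 and 1/0.94 < 1.07.
    v-lower : fromℤ (+ 205) * q ≤ v
    v-lower = positivity (# 205 :* Q) (# 1 :+ Z)
      ( (# 105 :* Q :* Y :* Z :- Z :* (# 1 :+ # 100 :* Q) :- # 1 , r-percent)
      ∷ (# 105 :* Q , r-yz) ∷ (con -[1+ 104 ] :* Q :^ 2 :* Z , r-upper) ∷ [])
      refl ρ 0≤ρ (percent-relation ∷ yz ∷ upper-relation ∷ [])

    v-upper : v ≤ fromℤ (+ 207) * q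
    v-upper = positivity (# 1 :+ Z) (# 207 :* Q)
      ( (Z :* (# 1 :+ # 100 :* Q) :- # 107 :* Q :* Y :* Z :+ # 1 , r-percent)
      ∷ (con -[1+ 106 ] :* Q , r-yz) ∷ (con -[1+ 106 ] :* Q :^ 2 :* Z , r-lower) ∷ [])
      refl ρ 0≤ρ (percent-relation ∷ yz ∷ lower-relation ∷ [])

    private
      smallest largest here : Vec ℚ 2
      smallest = fromℤ (+ 194) * q ∷ fromℤ (+ 205) * q ∷ []
      largest  = fromℤ (+ 195) * q ∷ fromℤ (+ 207) * q ∷ []
      here     = u ∷ v ∷ []

      0≤smallest : NonNegVec smallest
      0≤smallest = *-nonneg (0≤fromℤ 194) 0≤percent ∷⁺ *-nonneg (0≤fromℤ 205) 0≤percent ∷⁺ []⁺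

      0≤here : NonNegVec here
      0≤here = 0≤u ∷⁺ 0≤v ∷⁺ []⁺

      from-smallest : ∀ e → isMonotone e ≡ true → ⟦ e ⟧ smallest ≤ ⟦ e ⟧ here
      from-smallest e m = ⟦⟧-mono e smallest here m 0≤smallest (u-lower ∷ v-lower ∷ [])

      to-largest : ∀ e → isMonotone e ≡ true → ⟦ e ⟧ here ≤ ⟦ e ⟧ largest
      to-largest e m = ⟦⟧-mono e here largest m 0≤here (u-upper ∷ v-upper ∷ [])

      module R {n} (a b : Expr n) where
        open Rate a b public
        positive negative : Expr n
        positive = # 9 :* a :^ 3 :+ # 18 :* a :^ 2 :* b :+ # 4 :* a :^ 2 :* b :^ 3
          :+ # 16 :* a :* b :^ 3 :+ # 12 :* a :* b :^ 5
        negative = # 14 :* a :^ 2 :* b :^ 2 :+ # 27 :* a :* b :^ 4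

      module H = R {2} (var 0F) (var 1F)
      module A = R {1} (# 194 :* var 0F) (# 205 :* var 0F)
      module B = R {1} (# 195 :* var 0F) (# 207 :* var 0F)

      q₁ : Expr 1
      q₁ = var 0F

      -- c is the cofactor of 100 q − 1 that makes f − e homogeneous in q.
      in-percent : ∀ (e f c : Expr 1) →
        isNonNeg (normalise (f :- e :- combination ((c , # 100 :* var 0F :- # 1) ∷ []))) ≡ true →
        ⟦ e ⟧ (q ∷ []) ≤ ⟦ f ⟧ (q ∷ [])
      in-percent e f c eq = positivity e f ((c , # 100 :* var 0F :- # 1) ∷ []) eq (q ∷ []) (0≤percent ∷⁺ []⁺)
        (percent-relation ∷ [])

    S C : ℚ
    S = ⟦ H.rate ⟧ here
    C = ⟦ H.curvature ⟧ here

    S-lower : base ≤ S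
    S-lower = ℚ.≤-trans (in-percent (# 39) A.rate
      (# 39 :+ q₁ :* (# 3900 :+ q₁ :* (# 390000 :+ q₁ :* (# 16267856)))) refl) (from-smallest H.rate refl)

    S-upper : S ≤ fromℤ (+ 41)
    S-upper = ℚ.≤-trans (to-largest H.rate refl) (in-percent B.rate (# 41)
      (con -[1+ 40 ] :+ q₁ :* (con -[1+ 4099 ] :+ q₁ :* (con -[1+ 409999 ] :+ q₁ :* (con -[1+ 17842774 ])))) refl)

    private
      C-split : C ≡ ⟦ H.positive :- H.negative ⟧ here
      C-split = identity H.curvature (H.positive :- H.negative) refl here

    -- The curvature has terms of both signs, so its positive part is bounded below at one corner of
    -- the box for (u, v) and its negative part above at the opposite corner; the box is small
    -- enough for the former to win.
    0≤C : 0ℚ ≤ C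
    0≤C = subst (0ℚ ≤_) (sym C-split) (difference-nonneg (ℚ.≤-trans (to-largest H.negative refl)
      (ℚ.≤-trans (in-percent B.negative A.positive
        (q₁ :^ 3 :* (con -[1+ 204589295 ] :+ q₁ :* (con -[1+ 24389612449 ]
          :+ q₁ :* # 5930817134265))) refl) (from-smallest H.positive refl))))

    C-upper : C ≤ fromℤ (+ 1600)
    C-upper = begin
      C                                       ≡⟨ C-split ⟩
      ⟦ H.positive ⟧ here - ⟦ H.negative ⟧ here ≤⟨ ℚ.+-monoʳ-≤ (⟦ H.positive ⟧ here) (ℚ.neg-antimono-≤ (⟦⟧-nonneg H.negative here refl 0≤here)) ⟩
      ⟦ H.positive ⟧ here + - 0ℚ              ≡⟨ ℚ.+-identityʳ (⟦ H.positive ⟧ here) ⟩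
      ⟦ H.positive ⟧ here                     ≤⟨ to-largest H.positive refl ⟩
      ⟦ H.positive ⟧ largest                  ≤⟨ in-percent B.positive (# 1600)
          (con -[1+ 1599 ] :+ q₁ :* (con -[1+ 159999 ] :+ q₁ :* (con -[1+ 15999999 ]
            :+ q₁ :* (con -[1+ 1391584974 ] :+ q₁ :* (con -[1+ 111484899339 ] :+ q₁ :* (con -[1+ 9799402023699 ])))))) refl ⟩
      fromℤ (+ 1600)                          ∎
      where open ℚ.≤-Reasoning

    private
      fall : Expr 3
      fall = var 0F :^ 3 :* var 1F :^ 4 :* var 2F

      u≤2 : u ≤ fromℤ (+ 2)
      u≤2 = ℚ.≤-trans u-upper (in-percent (# 195 :* var 0F) (# 2) (con -[1+ 1 ]) refl)

      z≤2 : z ≤ fromℤ (+ 2)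
      z≤2 = ℚ.≤-trans
        (positivity Z (# 107 :* Q)
          ( (Z :* (# 1 :+ # 100 :* Q) :- # 107 :* Q :* Y :* Z , r-percent)
          ∷ (con -[1+ 106 ] :* Q , r-yz) ∷ (con -[1+ 106 ] :* Q :^ 2 :* Z , r-lower) ∷ [])
          refl ρ 0≤ρ (percent-relation ∷ yz ∷ lower-relation ∷ []))
        (in-percent (# 107 :* var 0F) (# 2) (con -[1+ 1 ]) refl)

      y≤1 : y ≤ 1ℚ
      y≤1 = ℚ.*-cancelˡ-≤-pos (fromℤ (+ 100)) (ℚ.≤-trans upper (fromℕ-mono {95} {100} (ℕ.m≤n+m 95 5)))

    descent : ℚ
    descent = ⟦ fall ⟧ (u ∷ z ∷ ν ∷ [])

    0≤descent : 0ℚ ≤ descent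
    0≤descent = ⟦⟧-nonneg fall (u ∷ z ∷ ν ∷ []) refl (0≤u ∷⁺ 0≤z ∷⁺ 0≤-N ∷⁺ []⁺)

    -- 128 = 2³ · 2⁴, from u ≤ 2 and 1/y ≤ 2.
    descent-upper : descent ≤ fromℤ (+ 128) * ε
    descent-upper = ℚ.≤-trans
      (⟦⟧-mono fall (u ∷ z ∷ ν ∷ []) (fromℤ (+ 2) ∷ fromℤ (+ 2) ∷ ε ∷ []) refl (0≤u ∷⁺ 0≤z ∷⁺ 0≤-N ∷⁺ []⁺)
        (u≤2 ∷ z≤2 ∷ -N≤ ∷ []))
      (ℚ.≤-reflexive (identity {1} (# 2 :^ 3 :* # 2 :^ 4 :* var 0F) (# 128 :* var 0F) refl (ε ∷ [])))

    slope≡ : ⟦ H.slope ⟧ here ≡ - descent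
    slope≡ = difference-zero (consequence {2}
      (Rate.slope (# 1 :+ var 0F) (# 1 :+ var 1F)
        :- (:- ((# 1 :+ var 0F) :^ 3 :* var 1F :^ 4 :* (:- slopeFactor (var 0F)))))
      ((con -[1+ 2 ] :* var 0F :^ 6 :* var 1F :^ 3 :- # 13 :* var 0F :^ 5 :* var 1F :^ 3
          :- # 3 :* var 0F :^ 5 :* var 1F :^ 2 :- # 20 :* var 0F :^ 4 :* var 1F :^ 3
          :- # 13 :* var 0F :^ 4 :* var 1F :^ 2 :- # 3 :* var 0F :^ 4 :* var 1F
          :- # 10 :* var 0F :^ 3 :* var 1F :^ 3 :- # 20 :* var 0F :^ 3 :* var 1F :^ 2
          :- # 13 :* var 0F :^ 3 :* var 1F :- # 3 :* var 0F :^ 3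
          :+ # 8 :* var 0F :^ 2 :* var 1F :^ 3 :- # 10 :* var 0F :^ 2 :* var 1F :^ 2
          :- # 20 :* var 0F :^ 2 :* var 1F :- # 13 :* var 0F :^ 2
          :+ # 16 :* var 0F :* var 1F :^ 3 :+ # 8 :* var 0F :* var 1F :^ 2
          :- # 12 :* var 0F :* var 1F :- # 18 :* var 0F :+ # 8 :* var 1F :^ 3
          :+ # 8 :* var 1F :^ 2 :- # 2 :* var 1F :- # 8 , var 0F :* var 1F :- # 1) ∷ [])
      refl (y ∷ z ∷ []) (yz ∷ []))

    private
      cleared numerator : Expr 2
      cleared   = var 0F :^ 3 :* var 1F
      numerator = (# 1 :+ var 0F) :^ 3 :* (# 1 :+ var 0F :* (# 1 :+ var 0F :* (# 2 :+ var 0F)))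

      rate-relation : ⟦ cleared :- numerator ⟧ (y ∷ S ∷ []) ≡ 0ℚ
      rate-relation = consequence {2}
        (var 0F :^ 3 :* Rate.rate (# 1 :+ var 0F) (# 1 :+ var 1F) :- numerator)
        ((# 2 :* var 0F :^ 4 :+ var 0F :^ 3 :* var 1F :^ 2 :+ # 3 :* var 0F :^ 3 :* var 1F
            :+ # 7 :* var 0F :^ 3 :+ var 0F :^ 2 :* var 1F :^ 2 :+ # 4 :* var 0F :^ 2 :* var 1F
            :+ # 8 :* var 0F :^ 2 :+ var 0F :* var 1F :+ # 4 :* var 0F :+ # 1 , var 0F :* var 1F :- # 1) ∷ [])
        refl (y ∷ z ∷ []) (yz ∷ [])

      cleared-quartic : Expr 2
      cleared-quartic = var 0F :^ 12 :* quartic (var 1F) :- slopeFactor (var 0F) :^ 2 :* residue (var 0F)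

      -- The growth rate is a critical value of S, so the quartic evaluated at S vanishes to second order
      -- at the critical point: y¹² times it is divisible by the square of the slope factor.
      quartic-relation : ⟦ cleared-quartic ⟧ (y ∷ S ∷ []) ≡ 0ℚ
      quartic-relation = consequence cleared-quartic
        ((# 729 :* (a :^ 3 :+ a :^ 2 :* b :+ a :* b :^ 2 :+ b :^ 3)
            :- # 28674 :* var 0F :^ 3 :* (a :^ 2 :+ a :* b :+ b :^ 2)
            :- # 15505 :* var 0F :^ 6 :* (a :+ b) :- # 25758 :* var 0F :^ 9
          , cleared :- numerator) ∷ [])
        refl (y ∷ S ∷ []) (rate-relation ∷ [])
        where
        a b : Expr 2
        a = cleared
        b = numerator

      square : Expr 4
      square = var 0F :* (var 1F :* residue (var 2F) :* var 3F :^ 12)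

    quartic-value : growthQuartic S ≡ ⟦ square ⟧ (ν ∷ ν ∷ y ∷ z ∷ [])
    quartic-value = difference-zero (consequence {3}
      (var 2F :- (:- f :* (:- f :* residue (var 0F) :* var 1F :^ 12)))
      ( (var 1F :^ 12 , var 0F :^ 12 :* var 2F :- f :^ 2 :* residue (var 0F))
      ∷ (:- var 2F :* (# 1 :+ w) :* (# 1 :+ w :^ 2 :+ w :^ 4) :* (# 1 :+ w :^ 6) , var 0F :* var 1F :- # 1) ∷ [])
      refl (y ∷ z ∷ growthQuartic S ∷ []) (quartic-relation ∷ yz ∷ []))
      where
      f w : Expr 3
      f = slopeFactor (var 0F)
      w = var 0F :* var 1F

    0≤quartic : 0ℚ ≤ growthQuartic S
    0≤quartic = subst (0ℚ ≤_) (sym quartic-value)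
      (⟦⟧-nonneg square (ν ∷ ν ∷ y ∷ z ∷ []) refl (0≤-N ∷⁺ 0≤-N ∷⁺ 0≤y ∷⁺ 0≤z ∷⁺ []⁺))

    -- The constant is `residue` at 1 times 2¹². Of the two factors ν in the square, one is bounded
    -- by ε and the other by 1.
    quartic-upper : ε ≤ 1ℚ → growthQuartic S ≤ ε * fromℤ (+ 21570768896)
    quartic-upper ε≤1 = subst (_≤ ε * fromℤ (+ 21570768896)) (sym quartic-value)
      (ℚ.≤-trans
        (⟦⟧-mono square (ν ∷ ν ∷ y ∷ z ∷ []) (ε ∷ 1ℚ ∷ 1ℚ ∷ fromℤ (+ 2) ∷ []) refl (0≤-N ∷⁺ 0≤-N ∷⁺ 0≤y ∷⁺ 0≤z ∷⁺ []⁺)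
          (-N≤ ∷ ℚ.≤-trans -N≤ ε≤1 ∷ y≤1 ∷ z≤2 ∷ []))
        (ℚ.≤-reflexive (identity {1} (var 0F :* (# 1 :* residue (# 1) :* # 2 :^ 12)) (var 0F :* # 21570768896)
          refl (ε ∷ []))))

    upper-bound : ∀ n → countℚ n 0 ≤ S ^ℚ n
    upper-bound = UpperBound.count-upper u v 0≤u 0≤v conjugate 1≤u

    lower-bound : ∀ j p η → 0ℚ ≤ p → 0ℚ ≤ η → descent ≤ η → p + (η + η) ≤ S → C ≤ η * (index (7 ℕ.+ j) - fromℤ (+ 5)) →
      Σ ℚ λ M → 0ℚ ≤ M × (∀ n → p ^ℚ n ≤ M * countℚ (2 ℕ.+ n) 0)
    lower-bound j p η 0≤p 0≤η descent≤η gap C≤ = L.mass , L.0≤mass , L.count-lower 1≤u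
      where
      module L = LowerBound u v 0≤u 0≤v conjugate j p η descent 0≤p 0≤η 0≤descent descent≤η slope≡ gap 0≤C C≤

  -- From bounds up to constants to the limit

  ^ℚ-pos : ∀ {r} n → 0ℚ < r → 0ℚ < r ^ℚ n
  ^ℚ-pos zero    0<r = toWitness {a? = 0ℚ ℚ.<? 1ℚ} tt
  ^ℚ-pos (suc n) 0<r = *-pos 0<r (^ℚ-pos n 0<r)

  ^ℚ-mono : ∀ {r s} n → 0ℚ ≤ r → r ≤ s → r ^ℚ n ≤ s ^ℚ n
  ^ℚ-mono zero    0≤r r≤s = ℚ.≤-refl
  ^ℚ-mono (suc n) 0≤r r≤s = *-mono 0≤r (^ℚ-nonneg n (ℚ.≤-trans 0≤r r≤s)) r≤s (^ℚ-mono n 0≤r r≤s)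

  ^ℚ-mono-< : ∀ {r s} n → 0ℚ ≤ r → r < s → r ^ℚ suc n < s ^ℚ suc n
  ^ℚ-mono-< {r} {s} n 0≤r r<s = ℚ.≤-<-trans
    (ℚ.*-monoˡ-≤-nonNeg r {{ℚ.nonNegative 0≤r}} (^ℚ-mono n 0≤r (ℚ.<⇒≤ r<s)))
    (ℚ.*-monoˡ-<-pos (s ^ℚ n) {{ℚ.positive (^ℚ-pos n (ℚ.≤-<-trans 0≤r r<s))}} r<s)

  bernoulli : ∀ {r s κ} → 0ℚ ≤ r → 0ℚ ≤ κ → (1ℚ + κ) * r ≤ s → ∀ n → (1ℚ + index n * κ) * r ^ℚ n ≤ s ^ℚ n
  bernoulli {r} {s} {κ} 0≤r 0≤κ le zero    =
    ℚ.≤-reflexive (identity {1} ((# 1 :+ # 0 :* var 0F) :* # 1) (# 1) refl (κ ∷ []))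
  bernoulli {r} {s} {κ} 0≤r 0≤κ le (suc n) = begin
    (1ℚ + (1ℚ + index n) * κ) * (r * r ^ℚ n)
      ≤⟨ positivity ((# 1 :+ (# 1 :+ var 0F) :* var 1F) :* (var 2F :* var 3F))
           (((# 1 :+ var 1F) :* var 2F) :* ((# 1 :+ var 0F :* var 1F) :* var 3F)) [] refl
           (index n ∷ κ ∷ r ∷ r ^ℚ n ∷ []) (index-nonneg n ∷⁺ 0≤κ ∷⁺ 0≤r ∷⁺ ^ℚ-nonneg n 0≤r ∷⁺ []⁺) [] ⟩
    ((1ℚ + κ) * r) * ((1ℚ + index n * κ) * r ^ℚ n)
      ≤⟨ *-mono 0≤scaled (^ℚ-nonneg n (ℚ.≤-trans 0≤scaled le)) le (bernoulli 0≤r 0≤κ le n) ⟩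
    s * s ^ℚ n ∎
    where
    open ℚ.≤-Reasoning
    0≤scaled : 0ℚ ≤ (1ℚ + κ) * r
    0≤scaled = *-nonneg (+-nonneg 0≤1 0≤κ) 0≤r

  half : ∀ {x γ} → 0ℚ < x → x + x ≡ γ → x < γ
  half {x} 0<x refl = subst (_< x + x) (ℚ.+-identityʳ x) (ℚ.+-monoʳ-< x 0<x)

  -- For large literals: the literal must not be unfolded to a successor, since comparing it with one
  -- evaluates the normalisation of rationals.
  0<fromℕ : ∀ n → 0 ℕ.< n → 0ℚ < fromℤ (+ n)
  0<fromℕ (suc n) _ = 0<fromℤ n

  ⊓-pos : ∀ {a b} → 0ℚ < a → 0ℚ < b → 0ℚ < a ⊓ b
  ⊓-pos {a} {b} 0<a 0<b with ℚ.⊓-sel a b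
  ... | inj₁ eq = subst (0ℚ <_) (sym eq) 0<a
  ... | inj₂ eq = subst (0ℚ <_) (sym eq) 0<b

  0≤base : 0ℚ ≤ base
  0≤base = 0≤fromℤ 39

  below-base : ∀ {x} → x ≡ base → growthQuartic x < 0ℚ
  below-base eq = ℚ.≤-<-trans (quartic-base _ eq) (toWitness {a? = fromℤ (-[1+ 0 ]) ℚ.<? 0ℚ} tt)

  Dominated : ℚ → Set
  Dominated q = ∃ λ S → 0ℚ ≤ S × S < q × (∀ n → countℚ n 0 ≤ S ^ℚ n)

  Exceeded : ℚ → Set
  Exceeded r = ∃ λ m₀ → ∀ d → r ^ℚ (2 ℕ.+ (m₀ ℕ.+ d)) < countℚ (2 ℕ.+ (m₀ ℕ.+ d)) 0

  module Above (q : ℚ) (above : AboveGreatestRoot q) where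
    private
      γ : ℚ
      γ = growthQuartic q

      0<γ : 0ℚ < γ
      0<γ = above q ℚ.≤-refl

      base<q : base < q
      base<q = ℚ.≰⇒> λ q≤base → ℚ.<-asym (above base q≤base) (below-base refl)

      -- 43141537792 is twice the constant of `quartic-upper`, so the quartic at S stays at or below
      -- γ/2, and S < q follows by monotonicity.
      module _ (r : ℚ) (inv : fromℤ (+ 43141537792) * r ≡ 1ℚ) (0<r : 0ℚ < r) where
        ε : ℚ
        ε = 1ℚ ⊓ (γ * r)

        small : ε * fromℤ (+ 21570768896) < γ
        small = ℚ.≤-<-trans
          (ℚ.*-monoʳ-≤-nonNeg (fromℤ (+ 21570768896)) {{ℚ.nonNegative (0≤fromℤ 21570768896)}} (ℚ.p⊓q≤q 1ℚ (γ * r)))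
          (half (*-pos (*-pos 0<γ 0<r) (0<fromℕ 21570768896 ℕ.z<s))
            (trans (identity {2} (var 0F :* var 1F :* # 21570768896 :+ var 0F :* var 1F :* # 21570768896)
                     (var 0F :* (# 43141537792 :* var 1F)) refl (γ ∷ r ∷ []))
              (trans (cong (λ t → γ * t) inv) (ℚ.*-identityʳ γ))))

        result : NearCritical ε → Dominated q
        result c = S , ℚ.≤-trans 0≤base S-lower ,
          ℚ.≰⇒> (λ q≤S → ℚ.<-irrefl refl (ℚ.≤-<-trans
            (ℚ.≤-trans (quartic-mono (ℚ.<⇒≤ base<q) q≤S) (quartic-upper (ℚ.p⊓q≤p 1ℚ (γ * r)))) small)) ,
          upper-bound
          where open Point c

        0<ε : 0ℚ < ε
        0<ε = ⊓-pos (toWitness {a? = 0ℚ ℚ.<? 1ℚ} tt) (*-pos 0<γ 0<r)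

    dominated : Dominated q
    dominated = from-inverse (inverse (fromℤ (+ 43141537792)) (0<fromℕ 43141537792 ℕ.z<s))
      where
      from-inverse : (Σ ℚ λ r → fromℤ (+ 43141537792) * r ≡ 1ℚ × 0ℚ < r) → Dominated q
      from-inverse (r , inv , 0<r) = result r inv 0<r (near-critical _ (0<ε r inv 0<r))

  module Below (r : ℚ) (base≤r : base ≤ r) (negative : growthQuartic r < 0ℚ) where
    private
      δ : ℚ
      δ = - growthQuartic r

      0<δ : 0ℚ < δ
      0<δ = ℚ.neg-antimono-< negative

      0≤r : 0ℚ ≤ r
      0≤r = ℚ.≤-trans 0≤base base≤r

      0<r : 0ℚ < r
      0<r = ℚ.<-≤-trans (0<fromℤ 38) base≤r

      inverse-identity : ∀ x a b → a * b ≡ 1ℚ → x * (a * b) ≡ x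
      inverse-identity x a b eq = trans (cong (λ t → x * t) eq) (ℚ.*-identityʳ x)

      -- 602920908 = 3 · 200973636, where 200973636 = 4 · 729 · 41³ bounds the secant slope between
      -- r and S. Thus η is a third of a guaranteed distance from r to S: one third raises r to r +
      -- η, the other two provide the `gap`.
      module _ (η : ℚ) (0<η : 0ℚ < η) (η-relation : η * fromℤ (+ 602920908) ≡ δ) where
        0≤η : 0ℚ ≤ η
        0≤η = ℚ.<⇒≤ 0<η

        module _ {ε : ℚ} (ε-bound : fromℤ (+ 128) * ε ≤ η) (c : NearCritical ε) where
          open Point c

          r<S : r < S
          r<S = ℚ.≰⇒> λ S≤r → ℚ.<-irrefl refl
            (ℚ.≤-<-trans (ℚ.≤-trans 0≤quartic (quartic-mono S-lower S≤r)) negative)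

          r≤41 : r ≤ fromℤ (+ 41)
          r≤41 = ℚ.≤-trans (ℚ.<⇒≤ r<S) S-upper

          Secant-upper : Secant r S ≤ fromℤ (+ 200973636)
          Secant-upper = begin
            Secant r S                            ≤⟨ positivity {2} (secantExpr (var 0F) (var 1F)) cubic [] refl (r ∷ S ∷ []) 0≤ρ [] ⟩
            ⟦ cubic ⟧ (r ∷ S ∷ [])                ≤⟨ ⟦⟧-mono cubic (r ∷ S ∷ []) (fromℤ (+ 41) ∷ fromℤ (+ 41) ∷ []) refl 0≤ρ (r≤41 ∷ S-upper ∷ []) ⟩
            ⟦ cubic ⟧ (fromℤ (+ 41) ∷ fromℤ (+ 41) ∷ [])
              ≡⟨ identity {0} (# 729 :* (# 41 :^ 3 :+ # 41 :^ 2 :* # 41 :+ # 41 :* # 41 :^ 2 :+ # 41 :^ 3))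
                   (# 200973636) refl [] ⟩
            fromℤ (+ 200973636)                   ∎
            where
            open ℚ.≤-Reasoning
            cubic : Expr 2
            cubic = # 729 :* (var 0F :^ 3 :+ var 0F :^ 2 :* var 1F :+ var 0F :* var 1F :^ 2 :+ var 1F :^ 3)
            0≤ρ : NonNegVec (r ∷ S ∷ [])
            0≤ρ = 0≤r ∷⁺ ℚ.≤-trans 0≤base S-lower ∷⁺ []⁺

          δ-upper : δ ≤ (S - r) * fromℤ (+ 200973636)
          δ-upper = begin
            δ                                   ≡⟨ ℚ.+-identityˡ δ ⟨
            0ℚ + δ                              ≤⟨ ℚ.+-monoˡ-≤ δ 0≤quartic ⟩
            growthQuartic S - growthQuartic r   ≡⟨ quartic-difference r S ⟩
            (S - r) * Secant r S
              ≤⟨ ℚ.*-monoˡ-≤-nonNeg (S - r) {{ℚ.nonNegative (difference-nonneg (ℚ.<⇒≤ r<S))}} Secant-upper ⟩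
            (S - r) * fromℤ (+ 200973636)       ∎
            where open ℚ.≤-Reasoning

          gap : (r + η) + (η + η) ≤ S
          gap = begin
            (r + η) + (η + η)
              ≡⟨ identity {2} ((var 0F :+ var 1F) :+ (var 1F :+ var 1F)) (var 0F :+ # 3 :* var 1F) refl (r ∷ η ∷ []) ⟩
            r + fromℤ (+ 3) * η ≤⟨ ℚ.+-monoʳ-≤ r cancelled ⟩
            r + (S - r)         ≡⟨ identity {2} (var 0F :+ (var 1F :- var 0F)) (var 1F) refl (r ∷ S ∷ []) ⟩
            S                   ∎
            where
            open ℚ.≤-Reasoning
            scaled : fromℤ (+ 3) * η * fromℤ (+ 200973636) ≡ δ
            scaled = trans (identity {1} (# 3 :* var 0F :* # 200973636) (var 0F :* # 602920908) refl (η ∷ [])) η-relation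
            cancelled : fromℤ (+ 3) * η ≤ S - r
            cancelled = ℚ.*-cancelʳ-≤-pos (fromℤ (+ 200973636)) {{ℚ.positive (0<fromℕ 200973636 ℕ.z<s)}}
              (subst (_≤ (S - r) * fromℤ (+ 200973636)) (sym scaled) δ-upper)

          curvature-bound : ∀ e j → η * e ≡ 1ℚ → fromℤ (+ 1600) * e ≤ index j → C ≤ η * (index (7 ℕ.+ j) - fromℤ (+ 5))
          curvature-bound e j e-inv e≤j = begin
            C                                   ≤⟨ C-upper ⟩
            fromℤ (+ 1600)                      ≡⟨ inverse-identity (fromℤ (+ 1600)) η e e-inv ⟨
            fromℤ (+ 1600) * (η * e)
              ≡⟨ identity {2} (# 1600 :* (var 0F :* var 1F)) (var 0F :* (# 1600 :* var 1F)) refl (η ∷ e ∷ []) ⟩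
            η * (fromℤ (+ 1600) * e)
              ≤⟨ ℚ.*-monoˡ-≤-nonNeg η {{ℚ.nonNegative 0≤η}} (ℚ.≤-trans e≤j
                   (positivity {1} (var 0F) (seven (var 0F) :- # 5) [] refl (index j ∷ []) (index-nonneg j ∷⁺ []⁺) [])) ⟩
            η * (index (7 ℕ.+ j) - fromℤ (+ 5)) ∎
            where
            open ℚ.≤-Reasoning
            seven : ∀ {n} → Expr n → Expr n
            seven x = o :+ (o :+ (o :+ (o :+ (o :+ (o :+ (o :+ x))))))
              where
              o = # 1

          geometric : Σ ℚ λ M → 0ℚ ≤ M × (∀ n → (r + η) ^ℚ n ≤ M * countℚ (2 ℕ.+ n) 0)
          geometric = lower-bound j (r + η) η (+-nonneg 0≤r 0≤η) 0≤η (ℚ.≤-trans descent-upper ε-bound) gap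
            (curvature-bound e j (proj₁ (proj₂ (inverse η 0<η))) (proj₂ (archimedean-index (fromℤ (+ 1600) * e))))
            where
            e : ℚ
            e = proj₁ (inverse η 0<η)
            j : ℕ
            j = proj₁ (archimedean-index (fromℤ (+ 1600) * e))

          module _ (M : ℚ) (0≤M : 0ℚ ≤ M) (growth : ∀ n → (r + η) ^ℚ n ≤ M * countℚ (2 ℕ.+ n) 0)
            (κ e : ℚ) (κ-relation : fromℤ (+ 41) * κ ≡ η) (0≤κ : 0ℚ ≤ κ) (e-inv : κ * e ≡ 1ℚ)
            (m₀ : ℕ) (large : (M * (r * r)) * e ≤ index m₀) where

            ratio : (1ℚ + κ) * r ≤ r + η
            ratio = begin
              (1ℚ + κ) * r             ≡⟨ identity {2} ((# 1 :+ var 0F) :* var 1F) (var 1F :+ var 1F :* var 0F) refl (κ ∷ r ∷ []) ⟩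
              r + r * κ                ≤⟨ ℚ.+-monoʳ-≤ r (ℚ.*-monoʳ-≤-nonNeg κ {{ℚ.nonNegative 0≤κ}} r≤41) ⟩
              r + fromℤ (+ 41) * κ     ≡⟨ cong (λ t → r + t) κ-relation ⟩
              r + η                    ∎
              where open ℚ.≤-Reasoning

            factor : ∀ d → M * (r * r) < 1ℚ + index (m₀ ℕ.+ d) * κ
            factor d = begin-strict
              M * (r * r)                       ≡⟨ inverse-identity (M * (r * r)) κ e e-inv ⟨
              M * (r * r) * (κ * e)             ≡⟨ identity {3} (var 0F :* (var 1F :* var 2F)) (var 0F :* var 2F :* var 1F) refl (M * (r * r) ∷ κ ∷ e ∷ []) ⟩
              M * (r * r) * e * κ               ≤⟨ ℚ.*-monoʳ-≤-nonNeg κ {{ℚ.nonNegative 0≤κ}} (ℚ.≤-trans large m₀≤) ⟩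
              index (m₀ ℕ.+ d) * κ              ≡⟨ ℚ.+-identityˡ _ ⟨
              0ℚ + index (m₀ ℕ.+ d) * κ         <⟨ ℚ.+-monoˡ-< (index (m₀ ℕ.+ d) * κ) (toWitness {a? = 0ℚ ℚ.<? 1ℚ} tt) ⟩
              1ℚ + index (m₀ ℕ.+ d) * κ         ∎
              where
              open ℚ.≤-Reasoning
              m₀≤ : index m₀ ≤ index (m₀ ℕ.+ d)
              m₀≤ = subst₂ _≤_ (ℚ.+-identityʳ (index m₀)) (sym (index-+ m₀ d)) (ℚ.+-monoʳ-≤ (index m₀) (index-nonneg d))

            -- The surplus of r + η over r beats the constant factor: ((r + η)/r)ᵐ is at least 1 +
            -- mκ, which exceeds M r². The factor r² accounts for the two shrubs spent on reaching
            -- state 6.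
            exceeds : ∀ d → r ^ℚ (2 ℕ.+ (m₀ ℕ.+ d)) < countℚ (2 ℕ.+ (m₀ ℕ.+ d)) 0
            exceeds d = ℚ.≰⇒> λ count≤ → ℚ.<-irrefl refl (begin-strict
              M * r ^ℚ (2 ℕ.+ m)
                ≡⟨ identity {3} (var 0F :* (var 1F :* (var 1F :* var 2F))) (var 0F :* (var 1F :* var 1F) :* var 2F) refl (M ∷ r ∷ r ^ℚ m ∷ []) ⟩
              M * (r * r) * r ^ℚ m             <⟨ ℚ.*-monoˡ-<-pos (r ^ℚ m) {{ℚ.positive (^ℚ-pos m 0<r)}} (factor d) ⟩
              (1ℚ + index m * κ) * r ^ℚ m      ≤⟨ bernoulli 0≤r 0≤κ ratio m ⟩
              (r + η) ^ℚ m                     ≤⟨ growth m ⟩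
              M * countℚ (2 ℕ.+ m) 0           ≤⟨ ℚ.*-monoˡ-≤-nonNeg M {{ℚ.nonNegative 0≤M}} count≤ ⟩
              M * r ^ℚ (2 ℕ.+ m)               ∎)
              where
              open ℚ.≤-Reasoning
              m : ℕ
              m = m₀ ℕ.+ d

          eventually : Exceeded r
          eventually = m₀ , exceeds (proj₁ geometric) (proj₁ (proj₂ geometric)) (proj₂ (proj₂ geometric)) κ e
            (trans (identity {2} (# 41 :* (var 0F :* var 1F)) (var 0F :* (# 41 :* var 1F)) refl (η ∷ i ∷ []))
              (inverse-identity η (fromℤ (+ 41)) i (proj₁ (proj₂ (inverse (fromℤ (+ 41)) (0<fromℤ 40))))))
            (ℚ.<⇒≤ 0<κ) (proj₁ (proj₂ (inverse κ 0<κ))) m₀ (proj₂ (archimedean-index bound))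
            where
            i κ e bound : ℚ
            i = proj₁ (inverse (fromℤ (+ 41)) (0<fromℤ 40))
            κ = η * i
            0<κ : 0ℚ < κ
            0<κ = *-pos 0<η (proj₂ (proj₂ (inverse (fromℤ (+ 41)) (0<fromℤ 40))))
            e = proj₁ (inverse κ 0<κ)
            bound = (proj₁ geometric * (r * r)) * e
            m₀ : ℕ
            m₀ = proj₁ (archimedean-index bound)

    exceeded : Exceeded r
    exceeded = start (inverse (fromℤ (+ 602920908)) (0<fromℕ 602920908 ℕ.z<s)) (inverse (fromℤ (+ 128)) (0<fromℤ 127))
      where
      with-η : ∀ η (0<η : 0ℚ < η) → η * fromℤ (+ 602920908) ≡ δ →
        (Σ ℚ λ i → fromℤ (+ 128) * i ≡ 1ℚ × 0ℚ < i) → Exceeded r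
      with-η η 0<η η-relation (i , i-inv , 0<i) = eventually η 0<η η-relation
        (ℚ.≤-reflexive (trans
          (identity {2} (# 128 :* (var 0F :* var 1F)) (var 0F :* (# 128 :* var 1F)) refl (η ∷ i ∷ []))
          (inverse-identity η (fromℤ (+ 128)) i i-inv)))
        (near-critical (η * i) (*-pos 0<η 0<i))

      start : (Σ ℚ λ k → fromℤ (+ 602920908) * k ≡ 1ℚ × 0ℚ < k) → (Σ ℚ λ i → fromℤ (+ 128) * i ≡ 1ℚ × 0ℚ < i) → Exceeded r
      start (k , k-inv , 0<k) = with-η (δ * k) (*-pos 0<δ 0<k)
        (trans (identity {2} (var 0F :* var 1F :* # 602920908) (var 0F :* (# 602920908 :* var 1F)) refl (δ ∷ k ∷ []))
          (inverse-identity δ (fromℤ (+ 602920908)) k k-inv))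

  squeeze : ∀ (c : ℕ → ℕ) → (∀ n → c n ≡ Counting.count n 0) → ∀ {p q r} → 0ℚ ≤ p → p ≤ r → Exceeded r → Dominated q →
    ∃ λ N → ∀ n → N ℕ.≤ n → (p ^ℚ n < ℕ→ℚ (c n)) × (ℕ→ℚ (c n) < q ^ℚ n)
  squeeze c c≡count {p} {q} {r} 0≤p p≤r (m₀ , exceeds) (S , 0≤S , S<q , dominated) = 2 ℕ.+ m₀ , between
    where
    Between : ℕ → Set
    Between n = (p ^ℚ n < fromℤ (+ c n)) × (fromℤ (+ c n) < q ^ℚ n)

    above : ∀ n {m} → n ≡ suc m → fromℤ (+ c n) < q ^ℚ n
    above n {m} refl = ℚ.≤-<-trans (subst (λ t → fromℤ (+ t) ≤ S ^ℚ n) (sym (c≡count n)) (dominated n)) (^ℚ-mono-< m 0≤S S<q)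

    below : ∀ n d → n ≡ 2 ℕ.+ (m₀ ℕ.+ d) → p ^ℚ n < fromℤ (+ c n)
    below n d eq = ℚ.≤-<-trans (^ℚ-mono n 0≤p p≤r)
      (subst (λ t → r ^ℚ n < fromℤ (+ t)) (sym (c≡count n)) (subst (λ t → r ^ℚ t < countℚ t 0) (sym eq) (exceeds d)))

    between : ∀ n → 2 ℕ.+ m₀ ℕ.≤ n → Between n
    between n N≤n = below n (n ℕ.∸ (2 ℕ.+ m₀)) split , above n split
      where
      split : n ≡ 2 ℕ.+ (m₀ ℕ.+ (n ℕ.∸ (2 ℕ.+ m₀)))
      split = sym (ℕ.m+[n∸m]≡n N≤n)

  -- The witness r may lie anywhere with a negative value; passing to its maximum with 39 moves it
  -- into the range where the quartic increases.
  below-max : ∀ r → growthQuartic r < 0ℚ → growthQuartic (r ⊔ base) < 0ℚ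
  below-max r negative = [ (λ eq → subst (λ t → growthQuartic t < 0ℚ) (sym eq) negative) , below-base ]′ (ℚ.⊔-sel r base)

  growth-rate : ∀ c → (∀ n → c n ≡ Counting.count n 0) → GrowthRateIsGreatestRoot c
  growth-rate c c≡count p q 0≤p (r , p≤r , negative) above =
    squeeze c c≡count 0≤p (ℚ.≤-trans p≤r (ℚ.p≤p⊔q r base))
      (Below.exceeded (r ⊔ base) (ℚ.p≤q⊔p r base) (below-max r negative)) (Above.dominated q above)

theorem18 : (a : ℕ → ℕ) → (∀ n → Fin (a n) ↔ S2-321 n) →
    (∀ N → evalInSquare theorem18-coeffs (ogf a) N ≡ + 0) ×
    GrowthRateIsGreatestRoot a
theorem18 a bijection =
  Algebraicity.count-annihilated {a} (Enumeration.cardinality bijection) ,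
  GrowthRate.growth-rate a (Enumeration.cardinality bijection)
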